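{- Let $G$ be an abelian group, and let $A,B \subset G$ be two subsets with $|A| = |B| = N$. Let $K \geq 1$ and $\varepsilon \in (0,1/2)$. Then there exists $\delta = \delta(K,\varepsilon) > 0$ such that the following holds: if $\Gamma \subset A \times B$ is a subset with $|\Gamma| \geq (1-\delta)N^2$ and $|A+_{\Gamma}B| \leq KN$, where $A+_{\Gamma}B = \{a+b : (a,b)\in\Gamma\}$, then there exist subsets $A'\subset A$ and $B' \subset B$ such that \[ |A'| \geq (1-\varepsilon)N, \ \ |B'| \geq (1-\varepsilon)N, \ \ \hbox{and} \ \ |A'+B'| \leq |A+_{\Gamma}B| + \varepsilon N. \] Moreover, if $G = \mathbb F_p^n$ with $p$ fixed, then one may take $\delta = (\varepsilon/K)^{O_p(1)}$ in this statement.
   Context: For $\Gamma \subset A \times B$, the restricted sumset is $A+_{\Gamma}B = \{a+b : (a,b)\in\Gamma\}$. The notation $O_p(1)$ denotes a quantity bounded by a constant depending only on $p$.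
   Formalization: The parameters K ≥ 1 and ε in (0,1/2), and the resulting δ, are rational numbers instead of real numbers; the real version follows by monotonicity, enlarging the exponent O_p(1) in the second part. -}

module Defs where

open import Level using (Level; _⊔_)
open import Data.Nat as ℕ using (ℕ; zero; suc; NonZero)
open import Data.Fin using (Fin; toℕ)
open import Data.Fin.Subset using (Subset; _∈_; ∣_∣)
open import Data.Vec using (Vec; zipWith)
open import Data.Product using (Σ; ∃; ∃₂; _×_)
open import Data.List using (map; allFin)
open import Data.Nat.ListAction using (sum)
open import Data.Integer using (+_)
open import Data.Rational using (ℚ; _*_; _+_; _-_; _/_; _≤_; 1ℚ)
open import Data.Nat.DivMod using (_mod_)
open import Relation.Binary.PropositionalEquality using (_≡_)

_^ℚ_ : ℚ → ℕ → ℚ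
q ^ℚ zero = 1ℚ
q ^ℚ suc n = q * (q ^ℚ n)

ℕ→ℚ : ℕ → ℚ
ℕ→ℚ n = + n / 1

_+ₚ_ : ∀ {p n} .{{_ : NonZero p}} → Vec (Fin p) n → Vec (Fin p) n → Vec (Fin p) n
_+ₚ_ {p} u v = zipWith (λ x y → (toℕ x ℕ.+ toℕ y) mod p) u v

-- A relation Γ ⊆ A × B on index sets (A = {a i}, B = {b j}); row i = {j | (a i , b j) ∈ Γ}
Rel₂ : ℕ → Set
Rel₂ N = Fin N → Subset N

cardΓ : ∀ {N} → Rel₂ N → ℕ
cardΓ {N} Γ = sum (map (λ i → ∣ Γ i ∣) (allFin N))

module _ {c ℓ} {G : Set c} (_≈_ : G → G → Set ℓ) (_∙_ : G → G → G) where

  InjectiveEnum : ∀ {N} → (Fin N → G) → Set ℓ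
  InjectiveEnum {N} a = ∀ (i j : Fin N) → a i ≈ a j → i ≡ j

  RestrictedSumset : ∀ {N} → (a b : Fin N → G) → Rel₂ N → G → Set ℓ
  RestrictedSumset a b Γ x = ∃₂ λ i j → (j ∈ Γ i) × (x ≈ (a i ∙ b j))

  Sumset : ∀ {N} → (a b : Fin N → G) → Subset N → Subset N → G → Set ℓ
  Sumset a b A' B' x = ∃₂ λ i j → (i ∈ A') × (j ∈ B') × (x ≈ (a i ∙ b j))

  -- the set P (≈-closed) has exactly m elements
  HasCard : (G → Set ℓ) → ℕ → Set (c ⊔ ℓ)
  HasCard P m = Σ (Fin m → G) λ f →
    (∀ k l → f k ≈ f l → k ≡ l) × (∀ k → P (f k)) × (∀ x → P x → ∃ λ k → x ≈ f k)

  CardAtMost : (G → Set ℓ) → ℕ → Set (c ⊔ ℓ)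
  CardAtMost P m = Σ (Fin m → G) λ f → ∀ x → P x → ∃ λ k → x ≈ f k

  Works : (K ε δ : ℚ) → Set (c ⊔ ℓ)
  Works K ε δ =
    ∀ (N : ℕ) (a b : Fin N → G) → InjectiveEnum a → InjectiveEnum b →
    (Γ : Rel₂ N) (s : ℕ) → HasCard (RestrictedSumset a b Γ) s →
    (1ℚ - δ) * ℕ→ℚ (N ℕ.* N) ≤ ℕ→ℚ (cardΓ Γ) →
    ℕ→ℚ s ≤ K * ℕ→ℚ N →
    ∃₂ λ (A' B' : Subset N) →
      ((1ℚ - ε) * ℕ→ℚ N ≤ ℕ→ℚ ∣ A' ∣) ×
      ((1ℚ - ε) * ℕ→ℚ N ≤ ℕ→ℚ ∣ B' ∣) ×
      (∃ λ m → (ℕ→ℚ m ≤ ℕ→ℚ s + ε * ℕ→ℚ N) × CardAtMost (Sumset a b A' B') m)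

{-# OPTIONS --safe #-}
-- Put S = A +_Γ B and take a maximal family of pairs (a, b) with distinct a, distinct b and distinct sums outside S.
-- If it is small, deleting its members from A and B leaves only sums that lie in S or are sums of the family.  A large
-- family is impossible: the solutions of a + b = c inside it are indexed by pairs outside Γ, so there are few of them.
--
-- In a general group the solutions become triangles in a graph on S, B and B - B (which is small, since two columns
-- of Γ have many common neighbours), to which the triangle removal lemma applies.  The removal lemma is proved by
-- refining vertex colourings by neighbourhoods of vertices of the third class, with an integer-valued potential.  Equality
-- in the group need not be decidable, so only equalities certified by Γ are used.
--
-- In 𝔽_p^n a linear map to 𝔽_p^d with p^d of order KN keeps most of the family intact.  After passing to elements of
-- bounded degree at some scale p^j, a random subspace of codimension j contains many isolated solutions, contradicting
-- the slice rank bound for tri-coloured sum-free sets.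
module Submission where

-- In a general group the obstacle is size: a Cayley graph on the whole group may be infinite,
-- whereas removal needs O(N) vertices. A solution a + b = c is therefore spread over the triples (a
-- + b', b', b - b') with b' in B; in such a triple x - y = a, y + z = b and x + z = c, so each edge
-- remembers one of the three elements. Regularity makes the removal constant tower-like, which is
-- why a polynomial δ over 𝔽_p calls for a separate argument. The tri-coloured bound loses only a
-- power, but it speaks of solutions that share no coordinate, and the family may create many
-- further solutions. A random cut of codimension j keeps a solution with probability p^(-2j) and a
-- conflicting pair with probability at most p^(-3j); hence a cut pays off when degrees are below
-- about p^j, and the elements are sorted by this scale. Both K and ε enter through one integer q,
-- about K / ε. All estimates are multiplied out, so that they live in the natural numbers without
-- subtraction or division.

module AlmostAllSums where

  open import Defs
  open import Level using (Level; _⊔_)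
  open import Function using (_∘_; id)
  open import Data.Empty using (⊥; ⊥-elim)
  open import Data.Unit using (⊤; tt)
  open import Data.Bool using (Bool; true; false; if_then_else_; _∧_; not)
  open import Data.Product using (∃; ∃₂; _×_; _,_; proj₁; proj₂)
  open import Data.Sum using (_⊎_; inj₁; inj₂; [_,_]′)
  open import Data.Maybe using (Maybe; just; nothing; maybe′)
  import Data.Maybe.Properties as MaybeP
  open import Data.Nat using (ℕ; zero; suc; _+_; _*_; _∸_; _^_; _≤_; _<_; z≤n; s≤s; NonZero; _≤?_; _<?_; pred; nonZero; >-nonZero; ⌊_/2⌋; ⌈_/2⌉)
  open import Data.Nat.Properties
  open import Data.Nat.DivMod using (_mod_; m≡m%n+[m/n]*n; m%n<n) renaming (_/_ to _/ᴺ_; _%_ to _%ᴺ_)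
  open import Data.Nat.Divisibility using (_∣_; divides; >⇒∤)
  import Data.Nat.Coprimality as Coprimality
  open import Data.Nat.Primality using (Prime; euclidsLemma; prime⇒nonTrivial)
  open import Data.Nat.ListAction using (sum)
  open import Data.Nat.Tactic.RingSolver using (solve-∀)
  open import Data.Integer using (ℤ; 0ℤ; 1ℤ) renaming (+_ to pos; _+_ to _+ᶻ_; _*_ to _*ᶻ_; _-_ to _-ᶻ_; -_ to -ᶻ_; _^_ to _^ᶻ_; ∣_∣ to ∣_∣ᶻ)
  import Data.Integer as ℤ
  import Data.Integer.Properties as ℤP
  open import Data.Integer.DivMod using (_%ℕ_; _/ℕ_; a≡a%ℕn+[a/ℕn]*n; n%ℕd<d)
  open import Data.Integer.Divisibility.Signed using (∣ᵤ⇒∣; ∣⇒∣ᵤ; ∣m∣n⇒∣m+n; ∣m∣n⇒∣m-n; ∣m⇒∣-m; ∣n⇒∣m*n; ∣m⇒∣m*n) renaming (_∣_ to _∣ᶻ_; _∣?_ to _∣ᶻ?_)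
  open import Data.Integer.Tactic.RingSolver using () renaming (solve-∀ to solve-∀ᶻ)
  open import Data.Rational using (ℚ; mkℚ; 0ℚ; 1ℚ; ½; NonNegative; Positive; nonNegative; positive; *≤*; *<*; ↥_; ↧ₙ_) renaming (_*_ to _*ʳ_; _+_ to _+ʳ_; _-_ to _-ʳ_; _≤_ to _≤ʳ_; _<_ to _<ʳ_)
  import Data.Rational.Properties as ℚP
  import Data.Rational.Unnormalised as ℚᵘ
  import Data.Rational.Unnormalised.Properties as ℚᵘP
  open import Data.Rational.Solver using (module +-*-Solver)
  open import Data.Fin using (Fin; toℕ; combine; remQuot; funToFin; finToFun; inject≤; splitAt; _↑ˡ_; _↑ʳ_) renaming (zero to fzero; suc to fsuc)
  open import Data.Fin.Properties using (any?; remQuot-combine; finToFun-funToFin; inject≤-injective; splitAt-↑ˡ; splitAt-↑ʳ; toℕ-fromℕ<; toℕ-injective; toℕ<n) renaming (_≟_ to _≟ᶠ_)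
  open import Data.Fin.Subset using (Subset; ∣_∣) renaming (_∈_ to _∈ˢ_)
  open import Data.Fin.Subset.Properties using (_∈?_)
  open import Data.List using (List; []; _∷_; map; length; filter; allFin; cartesianProduct; cartesianProductWith; _++_; lookup; upTo; applyUpTo)
  open import Data.List.Properties using (length-++; length-filter; length-map; length-tabulate; map-tabulate)
  open import Data.List.Membership.Propositional using (_∈_; find; lose)
  open import Data.List.Membership.Propositional.Properties
  open import Data.List.Relation.Unary.All using (All; []; _∷_)
  import Data.List.Relation.Unary.All as All
  open import Data.List.Relation.Unary.Any using (Any; here; there)
  import Data.List.Relation.Unary.Any as Any
  import Data.List.Relation.Unary.Any.Properties as AnyP
  open import Data.List.Relation.Unary.AllPairs using ([]; _∷_)
  open import Data.List.Relation.Unary.Unique.Propositional using (Unique)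
  open import Data.List.Relation.Unary.Unique.Propositional.Properties using (allFin⁺; upTo⁺; filter⁺; cartesianProduct⁺; cartesianProductWith⁺)
  open import Data.Vec using (Vec; []; _∷_)
  import Data.Vec as Vec
  open import Data.Vec.Properties using ([]=⇒lookup; lookup∘tabulate)
  import Data.Vec.Properties as VecP
  import Data.Vec.Relation.Unary.All as VAll
  open import Algebra.Bundles using (AbelianGroup)
  open import Relation.Nullary using (¬_; Dec; yes; no; does; contradiction)
  open import Relation.Nullary.Decidable using (_×-dec_; _⊎-dec_; ¬?; T?; dec-true; dec-false; decidable-stable; toWitness)
  open import Relation.Binary.Structures using (IsEquivalence)
  open import Relation.Binary.PropositionalEquality using (_≡_; _≢_; refl; sym; trans; cong; cong₂; subst; subst₂; module ≡-Reasoning)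
  open import Relation.Binary.PropositionalEquality.Properties using () renaming (isEquivalence to ≡-isEquivalence)

  -- Finite sums and counting

  private variable
    ℓ₁ ℓ₂ ℓ ℓ′ : Level
    I : Set ℓ₁
    J : Set ℓ₂

  ∑ : List I → (I → ℕ) → ℕ
  ∑ []      f = 0
  ∑ (x ∷ L) f = f x + ∑ L f

  infixr 6.5 ∑
  syntax ∑ L (λ x → e) = ∑[ x ∈ L ] e

  ι : Bool → ℕ
  ι true  = 1
  ι false = 0

  𝟙 : {P : Set ℓ} → Dec P → ℕ
  𝟙 d = ι (does d)

  𝟙-yes : {P : Set ℓ} (d : Dec P) → P → 𝟙 d ≡ 1
  𝟙-yes (yes _) p = refl
  𝟙-yes (no ¬p) p = contradiction p ¬p

  𝟙-no : {P : Set ℓ} (d : Dec P) → ¬ P → 𝟙 d ≡ 0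
  𝟙-no (yes p) ¬p = contradiction p ¬p
  𝟙-no (no _)  ¬p = refl

  𝟙-mono : {P : Set ℓ} {Q : Set ℓ′} (d : Dec P) (e : Dec Q) → (P → Q) → 𝟙 d ≤ 𝟙 e
  𝟙-mono (yes p) e f = ≤-reflexive (sym (𝟙-yes e (f p)))
  𝟙-mono (no _)  e f = z≤n

  𝟙≤1 : {P : Set ℓ} (d : Dec P) → 𝟙 d ≤ 1
  𝟙≤1 (yes _) = ≤-refl
  𝟙≤1 (no _)  = z≤n

  𝟙-≤ : {P : Set ℓ} (d : Dec P) {n : ℕ} → (P → 1 ≤ n) → 𝟙 d ≤ n
  𝟙-≤ (yes p) f = f p
  𝟙-≤ (no _)  f = z≤n

  𝟙-*≤ : {P : Set ℓ} (d : Dec P) {m n : ℕ} → (P → m ≤ n) → 𝟙 d * m ≤ 𝟙 d * n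
  𝟙-*≤ (yes p) f = +-monoˡ-≤ 0 (f p)
  𝟙-*≤ (no _)  f = z≤n

  𝟙-× : {P : Set ℓ} {Q : Set ℓ′} (d : Dec P) (e : Dec Q) → 𝟙 (d ×-dec e) ≡ 𝟙 d * 𝟙 e
  𝟙-× (yes _) e = sym (+-identityʳ (𝟙 e))
  𝟙-× (no _)  e = refl

  𝟙-¬ : {P : Set ℓ} (d : Dec P) → 𝟙 d + 𝟙 (¬? d) ≡ 1
  𝟙-¬ (yes _) = refl
  𝟙-¬ (no _)  = refl

  ∑-cong : {f g : I → ℕ} (L : List I) → (∀ x → f x ≡ g x) → ∑ L f ≡ ∑ L g
  ∑-cong []      h = refl
  ∑-cong (x ∷ L) h = cong₂ _+_ (h x) (∑-cong L h)

  ∑-mono∈ : {f g : I → ℕ} (L : List I) → (∀ {x} → x ∈ L → f x ≤ g x) → ∑ L f ≤ ∑ L g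
  ∑-mono∈ []      h = z≤n
  ∑-mono∈ (x ∷ L) h = +-mono-≤ (h (here refl)) (∑-mono∈ L (h ∘ there))

  ∑-mono : {f g : I → ℕ} (L : List I) → (∀ x → f x ≤ g x) → ∑ L f ≤ ∑ L g
  ∑-mono L h = ∑-mono∈ L (λ {x} _ → h x)

  ∑-+ : (L : List I) (f g : I → ℕ) → ∑[ x ∈ L ] (f x + g x) ≡ ∑ L f + ∑ L g
  ∑-+ []      f g = refl
  ∑-+ (x ∷ L) f g rewrite ∑-+ L f g = mid (f x) (g x) (∑ L f) (∑ L g)
    where
    mid : ∀ p q r s → p + q + (r + s) ≡ p + r + (q + s)
    mid = solve-∀

  ∑-*ˡ : (L : List I) (c : ℕ) (f : I → ℕ) → ∑[ x ∈ L ] (c * f x) ≡ c * ∑ L f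
  ∑-*ˡ []      c f = sym (*-zeroʳ c)
  ∑-*ˡ (x ∷ L) c f rewrite ∑-*ˡ L c f = sym (*-distribˡ-+ c (f x) (∑ L f))

  ∑-*ʳ : (L : List I) (f : I → ℕ) (c : ℕ) → ∑[ x ∈ L ] (f x * c) ≡ ∑ L f * c
  ∑-*ʳ L f c = trans (∑-cong L (λ x → *-comm (f x) c)) (trans (∑-*ˡ L c f) (*-comm c (∑ L f)))

  ∑-const : (L : List I) (c : ℕ) → ∑[ x ∈ L ] c ≡ length L * c
  ∑-const []      c = refl
  ∑-const (x ∷ L) c = cong (c +_) (∑-const L c)

  ∑-1 : (L : List I) → ∑[ x ∈ L ] 1 ≡ length L
  ∑-1 L = trans (∑-const L 1) (*-identityʳ _)

  ∑-0 : {f : I → ℕ} (L : List I) → (∀ x → f x ≡ 0) → ∑ L f ≡ 0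
  ∑-0 L h = trans (∑-cong L h) (trans (∑-const L 0) (*-zeroʳ (length L)))

  ∑-swap : (L : List I) (M : List J) (f : I → J → ℕ) →
    ∑[ x ∈ L ] ∑[ y ∈ M ] f x y ≡ ∑[ y ∈ M ] ∑[ x ∈ L ] f x y
  ∑-swap []      M f = sym (∑-0 M (λ _ → refl))
  ∑-swap (x ∷ L) M f = trans (cong (∑ M (f x) +_) (∑-swap L M f)) (sym (∑-+ M (f x) _))

  ∑-++ : (L M : List I) (f : I → ℕ) → ∑ (L ++ M) f ≡ ∑ L f + ∑ M f
  ∑-++ []      M f = refl
  ∑-++ (x ∷ L) M f = trans (cong (f x +_) (∑-++ L M f)) (sym (+-assoc (f x) _ _))

  ∑-map : (g : I → J) (L : List I) (f : J → ℕ) → ∑ (map g L) f ≡ ∑ L (f ∘ g)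
  ∑-map g []      f = refl
  ∑-map g (x ∷ L) f = cong (f (g x) +_) (∑-map g L f)

  ∑-cartesianProduct : (L : List I) (M : List J) (f : I × J → ℕ) →
    ∑ (cartesianProduct L M) f ≡ ∑[ x ∈ L ] ∑[ y ∈ M ] f (x , y)
  ∑-cartesianProduct []      M f = refl
  ∑-cartesianProduct (x ∷ L) M f = trans (∑-++ (map (x ,_) M) _ f)
    (cong₂ _+_ (∑-map (x ,_) M f) (∑-cartesianProduct L M f))

  ∑-member : (L : List I) (f : I → ℕ) {x : I} → x ∈ L → f x ≤ ∑ L f
  ∑-member (x ∷ L) f (here refl) = m≤m+n (f x) _
  ∑-member (y ∷ L) f (there p)   = ≤-trans (∑-member L f p) (m≤n+m _ (f y))

  ∑-product : (L : List I) (M : List J) (f : I → ℕ) (g : J → ℕ) →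
    ∑[ x ∈ L ] ∑[ y ∈ M ] (f x * g y) ≡ ∑ L f * ∑ M g
  ∑-product L M f g = trans (∑-cong L (λ x → ∑-*ˡ M (f x) g)) (∑-*ʳ L f (∑ M g))

  length-allFin : ∀ n → length (allFin n) ≡ n
  length-allFin n = length-tabulate {n = n} id

  ∑-constFin : ∀ n c → ∑[ x ∈ allFin n ] c ≡ n * c
  ∑-constFin n c = trans (∑-const (allFin n) c) (cong (_* c) (length-allFin n))

  module _ {P : I → Set ℓ} (P? : ∀ x → Dec (P x)) where

    # : List I → ℕ
    # L = ∑[ x ∈ L ] 𝟙 (P? x)

    ∑-filter : (L : List I) (f : I → ℕ) → ∑ (filter P? L) f ≡ ∑[ x ∈ L ] (𝟙 (P? x) * f x)
    ∑-filter []      f = refl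
    ∑-filter (x ∷ L) f with P? x
    ... | yes _ = cong₂ _+_ (sym (+-identityʳ (f x))) (∑-filter L f)
    ... | no  _ = ∑-filter L f

    length-filter-# : (L : List I) → length (filter P? L) ≡ # L
    length-filter-# []      = refl
    length-filter-# (x ∷ L) with P? x
    ... | yes _ = cong suc (length-filter-# L)
    ... | no  _ = length-filter-# L

    #-¬ : (L : List I) → # L + ∑[ x ∈ L ] 𝟙 (¬? (P? x)) ≡ length L
    #-¬ L = trans (sym (∑-+ L _ _)) (trans (∑-cong L (λ x → 𝟙-¬ (P? x))) (∑-1 L))

    #-atMostOne : (L : List I) → Unique L → (∀ {x y} → x ∈ L → y ∈ L → P x → P y → x ≡ y) → # L ≤ 1
    #-atMostOne []      u h = z≤n
    #-atMostOne (x ∷ L) (x∉ ∷ u) h with P? x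
    ... | yes px = s≤s (≤-trans (∑-mono∈ L (λ {y} y∈ → ≤-reflexive (𝟙-no (P? y)
            (λ py → All.lookup x∉ y∈ (h (here refl) (there y∈) px py)))))
            (≤-reflexive (∑-0 L (λ _ → refl))))
    ... | no _   = #-atMostOne L u (λ p q → h (there p) (there q))

    #-≤-rel : {J : Set ℓ₂} {Q : J → Set ℓ′} (Q? : ∀ y → Dec (Q y)) {r : Level} (R : I → J → Set r)
      (L : List I) (M : List J) → Unique L →
      (∀ {x} → x ∈ L → P x → ∃ λ y → y ∈ M × Q y × R x y) →
      (∀ {x x′ y} → x ∈ L → x′ ∈ L → R x y → R x′ y → x ≡ x′) →
      # L ≤ ∑[ y ∈ M ] 𝟙 (Q? y)
    #-≤-rel Q? R []      M u tot inj = z≤n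
    #-≤-rel Q? R (x ∷ L) M (x∉ ∷ u) tot inj with P? x
    ... | no _ = #-≤-rel Q? R L M u (tot ∘ there) (λ p q → inj (there p) (there q))
    ... | yes px with tot (here refl) px
    -- The witness of `x` is removed from `M`; since `R` determines its left argument, the witnesses
    -- of the other elements survive in what remains. Using a relation spares the construction of an
    -- injective function.
    ...   | y , y∈ , qy , rxy with ∈-∃++ y∈
    ...     | ys , zs , refl = ≤-trans (s≤s (#-≤-rel Q? R L (ys ++ zs) u tot′ (λ p q → inj (there p) (there q))))
                (≤-reflexive (sym split))
      where
      remove : ∀ {y′} ys → y′ ∈ ys ++ y ∷ zs → y′ ≢ y → y′ ∈ ys ++ zs
      remove []       (here e)  ne = ⊥-elim (ne e)
      remove []       (there p) ne = p
      remove (_ ∷ ys) (here e)  ne = here e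
      remove (_ ∷ ys) (there p) ne = there (remove ys p ne)
      tot′ : ∀ {x′} → x′ ∈ L → P x′ → ∃ λ y′ → y′ ∈ ys ++ zs × _ × R x′ y′
      tot′ {x′} x′∈ px′ with tot (there x′∈) px′
      ... | y′ , y′∈ , qy′ , r = y′ , remove ys y′∈
              (λ { refl → All.lookup x∉ x′∈ (inj (here refl) (there x′∈) rxy r) }) , qy′ , r
      split : ∑[ y ∈ ys ++ y ∷ zs ] 𝟙 (Q? y) ≡ suc (∑[ y ∈ ys ++ zs ] 𝟙 (Q? y))
      split = begin
        ∑ (ys ++ y ∷ zs) w         ≡⟨ ∑-++ ys (y ∷ zs) w ⟩
        ∑ ys w + (w y + ∑ zs w)    ≡⟨ cong (λ v → ∑ ys w + (v + ∑ zs w)) (𝟙-yes (Q? y) qy) ⟩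
        ∑ ys w + suc (∑ zs w)      ≡⟨ +-suc _ _ ⟩
        suc (∑ ys w + ∑ zs w)      ≡⟨ cong suc (sym (∑-++ ys zs w)) ⟩
        suc (∑ (ys ++ zs) w)       ∎
        where
        open ≡-Reasoning
        w : _ → ℕ
        w y = 𝟙 (Q? y)

  ∑≤length : (L : List I) {f : I → ℕ} → (∀ {x} → x ∈ L → f x ≤ 1) → ∑ L f ≤ length L
  ∑≤length L h = ≤-trans (∑-mono∈ L h) (≤-reflexive (∑-1 L))

  ∑-atMost : (L : List I) {f : I → ℕ} {c : ℕ} → (∀ {x} → x ∈ L → f x ≤ c) → ∑ L f ≤ length L * c
  ∑-atMost L h = ≤-trans (∑-mono∈ L h) (≤-reflexive (∑-const L _))

  ∑-avg : (x : I) (L : List I) (f g : I → ℕ) → ∑ (x ∷ L) f ≤ ∑ (x ∷ L) g → ∃ λ z → z ∈ x ∷ L × f z ≤ g z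
  ∑-avg x []      f g h = x , here refl , +-cancelʳ-≤ 0 (f x) (g x) h
  ∑-avg x (y ∷ L) f g h with f x ≤? g x
  ... | yes p = x , here refl , p
  ... | no ¬p with ∑-avg y L f g (+-cancelˡ-≤ (f x) _ _ (≤-trans h (+-monoˡ-≤ (∑ (y ∷ L) g) (<⇒≤ (≰⇒> ¬p)))))
  ...   | z , z∈ , q = z , there z∈ , q

  ∑-avg′ : (L : List I) → 1 ≤ length L → (f g : I → ℕ) → ∑ L f ≤ ∑ L g → ∃ λ z → z ∈ L × f z ≤ g z
  ∑-avg′ (x ∷ L) _ = ∑-avg x L

  -- The common summand `c` is exposed by two ring identities and cancelled, so that long linear
  -- estimates never subtract.
  linear : ∀ {x y} a b c → x ≤ y → x ≡ c + a → y ≡ c + b → a ≤ b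
  linear a b c h e f = +-cancelˡ-≤ c a b (subst₂ _≤_ e f h)

  ∑-δ : (_≟_ : (x y : I) → Dec (x ≡ y)) (L : List I) (w : I → ℕ) {x : I} → Unique L → x ∈ L →
    ∑[ y ∈ L ] 𝟙 (x ≟ y) * w y ≡ w x
  ∑-δ _≟_ (x ∷ L) w (x∉ ∷ _) (here refl) = begin
    𝟙 (x ≟ x) * w x + ∑[ y ∈ L ] 𝟙 (x ≟ y) * w y  ≡⟨ cong₂ _+_ (cong (_* w x) (𝟙-yes (x ≟ x) refl)) (vanish L x∉) ⟩
    1 * w x + 0                                    ≡⟨ +-identityʳ (1 * w x) ⟩
    1 * w x                                        ≡⟨ *-identityˡ (w x) ⟩
    w x                                            ∎
    where
    open ≡-Reasoning
    vanish : ∀ M → All (x ≢_) M → ∑[ y ∈ M ] 𝟙 (x ≟ y) * w y ≡ 0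
    vanish []      []        = refl
    vanish (y ∷ M) (ne ∷ nes) rewrite 𝟙-no (x ≟ y) ne = vanish M nes
  ∑-δ _≟_ (y ∷ L) w {x} (y∉ ∷ u) (there p)
    rewrite 𝟙-no (x ≟ y) (λ { refl → All.lookup y∉ p refl }) = ∑-δ _≟_ L w u p

  ∑-δFin : ∀ {n} (w : Fin n → ℕ) (i : Fin n) → ∑[ j ∈ allFin n ] 𝟙 (i ≟ᶠ j) * w j ≡ w i
  ∑-δFin {n} w i = ∑-δ _≟ᶠ_ (allFin n) w (allFin⁺ n) (∈-allFin i)

  ∑₂ : ∀ {n m} → (Fin n → Fin m → ℕ) → ℕ
  ∑₂ {n} {m} h = ∑[ x ∈ allFin n ] ∑[ y ∈ allFin m ] h x y

  module _ {n m : ℕ} where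

    ∑₂-cong : {f g : Fin n → Fin m → ℕ} → (∀ x y → f x y ≡ g x y) → ∑₂ f ≡ ∑₂ g
    ∑₂-cong h = ∑-cong (allFin n) (λ x → ∑-cong (allFin m) (h x))

    ∑₂-mono : {f g : Fin n → Fin m → ℕ} → (∀ x y → f x y ≤ g x y) → ∑₂ f ≤ ∑₂ g
    ∑₂-mono h = ∑-mono (allFin n) (λ x → ∑-mono (allFin m) (h x))

    ∑₂-+ : (f g : Fin n → Fin m → ℕ) → ∑₂ (λ x y → f x y + g x y) ≡ ∑₂ f + ∑₂ g
    ∑₂-+ f g = trans (∑-cong (allFin n) (λ x → ∑-+ (allFin m) (f x) (g x))) (∑-+ (allFin n) _ _)

    ∑₂-*ˡ : (c : ℕ) (f : Fin n → Fin m → ℕ) → ∑₂ (λ x y → c * f x y) ≡ c * ∑₂ f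
    ∑₂-*ˡ c f = trans (∑-cong (allFin n) (λ x → ∑-*ˡ (allFin m) c (f x))) (∑-*ˡ (allFin n) c _)

    ∑₂-const : (c : ℕ) → ∑₂ {n} {m} (λ _ _ → c) ≡ n * m * c
    ∑₂-const c = trans (∑-cong (allFin n) (λ _ → ∑-constFin m c)) (trans (∑-constFin n (m * c)) (sym (*-assoc n m c)))

    ∑₂-product : (f : Fin n → ℕ) (g : Fin m → ℕ) → ∑₂ (λ x y → f x * g y) ≡ ∑ (allFin n) f * ∑ (allFin m) g
    ∑₂-product f g = ∑-product (allFin n) (allFin m) f g

    ∑-∑₂-swap : (L : List I) (f : I → Fin n → Fin m → ℕ) →
      ∑₂ (λ x y → ∑[ i ∈ L ] f i x y) ≡ ∑[ i ∈ L ] ∑₂ (f i)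
    ∑-∑₂-swap L f = trans (∑-cong (allFin n) (λ x → ∑-swap (allFin m) L (λ y i → f i x y)))
      (∑-swap (allFin n) L (λ x i → ∑[ y ∈ allFin m ] f i x y))

  -- Triangle removal

  toBit : Bool → Fin 2
  toBit true  = fsuc fzero
  toBit false = fzero

  fromBit : Fin 2 → Bool
  fromBit fzero    = false
  fromBit (fsuc _) = true

  fromBit-toBit : ∀ b → fromBit (toBit b) ≡ b
  fromBit-toBit true  = refl
  fromBit-toBit false = refl

  -- A tripartite graph on three copies of Fin n, with edge sets f (x–y), u (x–z), v (y–z).  The xy-edges are
  -- approximated by a height function g / Q that is constant on the cells of a pair of colourings.
  module Graph {n : ℕ} (f u v : Fin n → Fin n → Bool) (E Q : ℕ) where

    -- The inner product of `f` with `G`. Together with the squared norm below it gives 2 Q energy -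
    -- norm = Q² |f|² - |Q f - G|², so raising this potential means bringing `G` closer to Q f in
    -- mean square.
    energy : (Fin n → Fin n → ℕ) → ℕ
    energy G = ∑₂ (λ x y → ι (f x y) * G x y)

    norm : (Fin n → Fin n → ℕ) → ℕ
    norm G = ∑₂ (λ x y → G x y * G x y)

    trianglesAt : Fin n → ℕ
    trianglesAt z = ∑₂ (λ x y → ι (u x z) * ι (v y z) * ι (f x y))

    module Cells {κ : ℕ} (cX cY : Fin n → Fin κ) (g : Fin κ → Fin κ → ℕ) where

      X Y : Fin κ → Fin n → ℕ
      X α x = 𝟙 (cX x ≟ᶠ α)
      Y β y = 𝟙 (cY y ≟ᶠ β)

      a b : Fin κ → ℕ
      a α = ∑ (allFin n) (X α)
      b β = ∑ (allFin n) (Y β)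

      cell : Fin κ → Fin κ → (Fin n → Fin n → ℕ) → ℕ
      cell α β H = ∑₂ (λ x y → X α x * Y β y * H x y)

      Nx Ny : Fin κ → Fin n → ℕ
      Nx α z = ∑[ x ∈ allFin n ] X α x * ι (u x z)
      Ny β z = ∑[ y ∈ allFin n ] Y β y * ι (v y z)

      edges : Fin κ → Fin κ → ℕ
      edges α β = cell α β (λ x y → ι (f x y))

      edgesAt : Fin κ → Fin κ → Fin n → ℕ
      edgesAt α β z = cell α β (λ x y → ι (u x z) * ι (v y z) * ι (f x y))

      -- The height moves by one unit where the edge density is off by at least a unit; the potential
      -- 2 Q energy - norm then grows by the area moved.
      Up : Fin κ → Fin κ → Set
      Up α β = suc (g α β) * (a α * b β) ≤ Q * edges α β

      -- The neighbourhoods of `z` fill at least a proportion 1/E of each side of the cell, yet the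
      -- edge density between them is at most (g - 1)/Q. Only this rectangle is lowered, and it has
      -- at least 1/E² of the area of the cell.
      Down : Fin κ → Fin κ → Fin n → Set
      Down α β z = a α ≤ E * Nx α z × b β ≤ E * Ny β z ×
        Q * edgesAt α β z + Nx α z * Ny β z ≤ g α β * (Nx α z * Ny β z) × 1 ≤ g α β

      data Move (α β : Fin κ) : Set where
        up   : Up α β → Move α β
        down : ∀ z → Down α β z → Move α β
        keep : ¬ Up α β → (∀ z → ¬ Down α β z) → Move α β

      abstract
        move : ∀ α β → Move α β
        move α β with suc (g α β) * (a α * b β) ≤? Q * edges α β
        ... | yes p = up p
        ... | no ¬p with any? (λ z → (a α ≤? E * Nx α z) ×-dec (b β ≤? E * Ny β z) ×-dec
                          (Q * edgesAt α β z + Nx α z * Ny β z ≤? g α β * (Nx α z * Ny β z)) ×-dec (1 ≤? g α β))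
        ...   | yes (z , d) = down z d
        ...   | no ¬d       = keep ¬p (λ z d → ¬d (z , d))

      moves : ∀ {α β} → Move α β → Bool
      moves (up _)     = true
      moves (down _ _) = true
      moves (keep _ _) = false

      near : ∀ {α β} → Move α β → (Fin n → Fin n → Bool) → Fin n → Bool
      near (down z _) w x = w x z
      near _          w x = false

      newHeight : ∀ {α β} → Move α β → Bool → Bool → ℕ
      newHeight {α} {β} (up _)     s r = suc (g α β)
      newHeight {α} {β} (down _ _) s r = if s ∧ r then pred (g α β) else g α β
      newHeight {α} {β} (keep _ _) s r = g α β

      height′ : ∀ {α β} → Move α β → Fin n → Fin n → ℕ
      height′ m x y = newHeight m (near m u x) (near m v y)

      G G′ : Fin n → Fin n → ℕ
      G x y  = g (cX x) (cY y)
      G′ x y = height′ (move (cX x) (cY y)) x y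

      -- Marks the whole cell even when only a rectangle in it is lowered; the factor E² in `Gain`
      -- pays for the difference.
      Moved : Fin n → Fin n → ℕ
      Moved x y = ι (moves (move (cX x) (cY y)))

      -- One bit is added for each class of the other side: whether the vertex is adjacent to the
      -- witness of the cell formed with that class. The new height is then again constant on cells.
      cX′ cY′ : Fin n → Fin (κ * 2 ^ κ)
      cX′ x = combine (cX x) (funToFin (λ β → toBit (near (move (cX x) β) u x)))
      cY′ y = combine (cY y) (funToFin (λ α → toBit (near (move α (cY y)) v y)))

      newHeight-at : Fin κ × Fin (2 ^ κ) → Fin κ × Fin (2 ^ κ) → ℕ
      newHeight-at (α , s) (β , r) = newHeight (move α β) (fromBit (finToFun s β)) (fromBit (finToFun r α))

      g′ : Fin (κ * 2 ^ κ) → Fin (κ * 2 ^ κ) → ℕ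
      g′ i j = newHeight-at (remQuot (2 ^ κ) i) (remQuot (2 ^ κ) j)

      g′-colours : ∀ x y → g′ (cX′ x) (cY′ y) ≡ G′ x y
      g′-colours x y = trans
        (cong₂ newHeight-at (remQuot-combine (cX x) _) (remQuot-combine (cY y) _))
        (cong₂ (newHeight (move (cX x) (cY y)))
          (trans (cong fromBit (finToFun-funToFin _ (cY y))) (fromBit-toBit _))
          (trans (cong fromBit (finToFun-funToFin _ (cX x))) (fromBit-toBit _)))

      ∑₂-cells : (H : Fin n → Fin n → ℕ) → ∑₂ H ≡ ∑₂ (λ α β → cell α β H)
      ∑₂-cells H = begin
        ∑₂ H
          ≡⟨ ∑₂-cong {n} {n} (λ x y → sym (pointwise x y)) ⟩
        ∑₂ (λ x y → ∑[ α ∈ allFin κ ] ∑[ β ∈ allFin κ ] X α x * Y β y * H x y)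
          ≡⟨ ∑-∑₂-swap {n} {n} (allFin κ) (λ α x y → ∑[ β ∈ allFin κ ] X α x * Y β y * H x y) ⟩
        (∑[ α ∈ allFin κ ] ∑₂ (λ x y → ∑[ β ∈ allFin κ ] X α x * Y β y * H x y))
          ≡⟨ ∑-cong (allFin κ) (λ α → ∑-∑₂-swap {n} {n} (allFin κ) (λ β x y → X α x * Y β y * H x y)) ⟩
        ∑₂ (λ α β → cell α β H) ∎
        where
        open ≡-Reasoning
        pointwise : ∀ x y → ∑[ α ∈ allFin κ ] ∑[ β ∈ allFin κ ] X α x * Y β y * H x y ≡ H x y
        pointwise x y = begin
          (∑[ α ∈ allFin κ ] ∑[ β ∈ allFin κ ] X α x * Y β y * H x y)
            ≡⟨ ∑-cong (allFin κ) (λ α → trans (∑-cong (allFin κ) (λ β → *-assoc (X α x) _ _)) (∑-*ˡ (allFin κ) (X α x) _)) ⟩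
          (∑[ α ∈ allFin κ ] X α x * ∑ (allFin κ) (λ β → Y β y * H x y))
            ≡⟨ ∑-δFin (λ α → ∑ (allFin κ) (λ β → Y β y * H x y)) (cX x) ⟩
          (∑[ β ∈ allFin κ ] Y β y * H x y)
            ≡⟨ ∑-δFin (λ _ → H x y) (cY y) ⟩
          H x y ∎

      cell-cong : ∀ {α β H H′} → (∀ x y → cX x ≡ α → cY y ≡ β → H x y ≡ H′ x y) → cell α β H ≡ cell α β H′
      cell-cong {α} {β} {H} {H′} h = ∑₂-cong {n} {n} pointwise
        where
        pointwise : ∀ x y → X α x * Y β y * H x y ≡ X α x * Y β y * H′ x y
        pointwise x y with cX x ≟ᶠ α | cY y ≟ᶠ β
        ... | yes p | yes q = cong (_+ 0) (h x y p q)
        ... | yes _ | no _  = refl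
        ... | no _  | _     = refl

      cell-+ : ∀ α β H H′ → cell α β (λ x y → H x y + H′ x y) ≡ cell α β H + cell α β H′
      cell-+ α β H H′ = trans (∑₂-cong {n} {n} (λ x y → *-distribˡ-+ (X α x * Y β y) (H x y) (H′ x y))) (∑₂-+ {n} {n} _ _)

      cell-*ˡ : ∀ α β k H → cell α β (λ x y → k * H x y) ≡ k * cell α β H
      cell-*ˡ α β k H = trans (∑₂-cong {n} {n} (λ x y → move-out (X α x * Y β y) k (H x y))) (∑₂-*ˡ {n} {n} k _)
        where
        move-out : ∀ p k h → p * (k * h) ≡ k * (p * h)
        move-out = solve-∀

      cell-product : ∀ α β (p q : Fin n → ℕ) → cell α β (λ x y → p x * q y) ≡
        (∑[ x ∈ allFin n ] X α x * p x) * (∑[ y ∈ allFin n ] Y β y * q y)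
      cell-product α β p q = trans (∑₂-cong {n} {n} (λ x y → shuffle (X α x) (Y β y) (p x) (q y)))
        (∑₂-product {n} {n} (λ x → X α x * p x) (λ y → Y β y * q y))
        where
        shuffle : ∀ x y p q → x * y * (p * q) ≡ x * p * (y * q)
        shuffle = solve-∀

      cell-const : ∀ α β k → cell α β (λ _ _ → k) ≡ k * (a α * b β)
      cell-const α β k = trans (∑₂-cong {n} {n} (λ x y → *-comm (X α x * Y β y) k))
        (trans (∑₂-*ˡ {n} {n} k _) (cong (k *_) (∑₂-product {n} {n} (X α) (Y β))))

      area : ∀ α β z → cell α β (λ x y → ι (u x z) * ι (v y z)) ≡ Nx α z * Ny β z
      area α β z = cell-product α β (λ x → ι (u x z)) (λ y → ι (v y z))

      -- On one cell, E² times the growth of the potential is at least the area marked by `Moved`,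
      -- with negative terms brought to the other side.
      Gain : Fin κ → Fin κ → Set
      Gain α β = E * E * (2 * Q * cell α β (λ x y → ι (f x y) * G x y) + cell α β (λ x y → G′ x y * G′ x y))
          + cell α β Moved
        ≤ E * E * (2 * Q * cell α β (λ x y → ι (f x y) * G′ x y) + cell α β (λ x y → G x y * G x y))

      module _ (1≤E : 1 ≤ E) (α β : Fin κ) where

        private
          s e : ℕ
          s = a α * b β
          e = edges α β

          Gain-from : (m : Move α β) → move α β ≡ m →
            E * E * (2 * Q * (g α β * e) + cell α β (λ x y → height′ m x y * height′ m x y)) + ι (moves m) * s
            ≤ E * E * (2 * Q * cell α β (λ x y → ι (f x y) * height′ m x y) + g α β * g α β * s) → Gain α β
          Gain-from m eq h = subst₂ _≤_
            (cong₂ _+_ (cong (E * E *_) (cong₂ _+_ (cong (2 * Q *_) fG) (cell-cong (λ { x y refl refl → cong (λ m → height′ m x y * height′ m x y) (sym eq) }))))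
              (trans (sym (cell-const α β (ι (moves m)))) (cell-cong (λ { x y refl refl → cong (ι ∘ moves) (sym eq) }))))
            (cong (E * E *_) (cong₂ _+_ (cong (2 * Q *_) (cell-cong (λ { x y refl refl → cong (λ m → ι (f x y) * height′ m x y) (sym eq) })))
              (trans (sym (cell-const α β (g α β * g α β))) (cell-cong (λ { x y refl refl → refl }))))) h
            where
            fG : g α β * e ≡ cell α β (λ x y → ι (f x y) * G x y)
            fG = trans (sym (cell-*ˡ α β (g α β) _)) (cell-cong (λ { x y refl refl → *-comm (g α β) (ι (f x y)) }))

          E²≥1 : 1 ≤ E * E
          E²≥1 = *-mono-≤ 1≤E 1≤E

          -- Raising height c on area s with e edges changes the potential by 2 Q e - (2c + 1) s,
          -- and Q e is at least (c + 1) s, which leaves at least s.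
          up-gain : (p : Up α β) → move α β ≡ up p → Gain α β
          up-gain p eq = Gain-from (up p) eq (begin
            E * E * (2 * Q * (c * e) + cell α β (λ _ _ → suc c * suc c)) + 1 * s
              ≡⟨ cong (λ w → E * E * (2 * Q * (c * e) + w) + 1 * s) (cell-const α β (suc c * suc c)) ⟩
            E * E * (2 * Q * (c * e) + suc c * suc c * s) + 1 * s
              ≤⟨ +-monoʳ-≤ (E * E * (2 * Q * (c * e) + suc c * suc c * s)) (*-monoˡ-≤ s E²≥1) ⟩
            E * E * (2 * Q * (c * e) + suc c * suc c * s) + E * E * s
              ≡⟨ expand (E * E) Q c e s ⟩
            E * E * (2 * Q * (c * e) + c * c * s) + 2 * (E * E) * (suc c * s)
              ≤⟨ +-monoʳ-≤ (E * E * (2 * Q * (c * e) + c * c * s)) (*-monoʳ-≤ (2 * (E * E)) p) ⟩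
            E * E * (2 * Q * (c * e) + c * c * s) + 2 * (E * E) * (Q * e)
              ≡⟨ collect (E * E) Q c e s ⟩
            E * E * (2 * Q * (suc c * e) + c * c * s)
              ≡⟨ cong (λ w → E * E * (2 * Q * w + c * c * s)) (sym fsuc-c) ⟩
            E * E * (2 * Q * cell α β (λ x y → ι (f x y) * suc c) + c * c * s) ∎)
            where
            open ≤-Reasoning
            c = g α β
            fsuc-c : cell α β (λ x y → ι (f x y) * suc c) ≡ suc c * e
            fsuc-c = trans (cell-cong (λ x y _ _ → *-comm (ι (f x y)) (suc c))) (cell-*ˡ α β (suc c) _)
            expand : ∀ E Q c e s → E * (2 * Q * (c * e) + suc c * suc c * s) + E * s
              ≡ E * (2 * Q * (c * e) + c * c * s) + 2 * E * (suc c * s)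
            expand = solve-∀
            collect : ∀ E Q c e s → E * (2 * Q * (c * e) + c * c * s) + 2 * E * (Q * e)
              ≡ E * (2 * Q * (suc c * e) + c * c * s)
            collect = solve-∀

          -- Lowering height c′ + 1 on a rectangle of area R with eR edges changes the potential by
          -- (2c′ + 1) R - 2 Q eR. As Q eR is at most c′ R, at least R is gained, and E² R covers
          -- the cell area s.
          down-arith : ∀ c′ R eR S (P : Fin n → Fin n → ℕ) → cell α β (λ x y → (P x y) * (P x y)) + (suc (2 * c′)) * R ≡ suc c′ * suc c′ * s →
            cell α β (λ x y → ι (f x y) * P x y) + eR ≡ suc c′ * e →
            Q * eR + R ≤ suc c′ * R → s ≤ E * E * R → S ≡ cell α β (λ x y → (P x y) * (P x y)) →
            E * E * (2 * Q * (suc c′ * e) + S) + 1 * s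
            ≤ E * E * (2 * Q * cell α β (λ x y → ι (f x y) * P x y) + suc c′ * suc c′ * s)
          down-arith c′ R eR S P sq lin low big refl = begin
            E * E * (2 * Q * (suc c′ * e) + S) + 1 * s
              ≤⟨ +-monoʳ-≤ (E * E * (2 * Q * (suc c′ * e) + S)) (+-monoˡ-≤ 0 big) ⟩
            E * E * (2 * Q * (suc c′ * e) + S) + 1 * (E * E * R)
              ≡⟨ cong (λ w → E * E * (2 * Q * w + S) + 1 * (E * E * R)) (sym lin) ⟩
            E * E * (2 * Q * (F + eR) + S) + 1 * (E * E * R)
              ≡⟨ regroup (E * E) Q F eR S R ⟩
            E * E * (2 * Q * F + S) + E * E * (2 * (Q * eR) + R)
              ≤⟨ +-monoʳ-≤ (E * E * (2 * Q * F + S)) (*-monoʳ-≤ (E * E) (+-monoˡ-≤ R (*-monoʳ-≤ 2 low′))) ⟩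
            E * E * (2 * Q * F + S) + E * E * (2 * (c′ * R) + R)
              ≡⟨ regroup′ (E * E) Q F S c′ R ⟩
            E * E * (2 * Q * F + (S + suc (2 * c′) * R))
              ≡⟨ cong (λ w → E * E * (2 * Q * F + w)) sq ⟩
            E * E * (2 * Q * F + suc c′ * suc c′ * s) ∎
            where
            open ≤-Reasoning
            F = cell α β (λ x y → ι (f x y) * P x y)
            low′ : Q * eR ≤ c′ * R
            low′ = linear (Q * eR) (c′ * R) R low (+-comm (Q * eR) R) refl
            regroup : ∀ E Q F eR S R → E * (2 * Q * (F + eR) + S) + 1 * (E * R) ≡ E * (2 * Q * F + S) + E * (2 * (Q * eR) + R)
            regroup = solve-∀
            regroup′ : ∀ E Q F S c R → E * (2 * Q * F + S) + E * (2 * (c * R) + R) ≡ E * (2 * Q * F + (S + suc (2 * c) * R))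
            regroup′ = solve-∀

          down-gain : ∀ z (d : Down α β z) → move α β ≡ down z d → Gain α β
          down-gain z d@(aN , bN , low , 1≤g) eq with g α β in geq | Gain-from (down z d) eq
          ... | zero   | _      = ⊥-elim (n≮0 (subst (1 ≤_) geq 1≤g))
          ... | suc c′ | finish = finish (down-arith c′ (Nx α z * Ny β z) (edgesAt α β z) _ P sq lin
              (subst (λ w → Q * edgesAt α β z + Nx α z * Ny β z ≤ w * (Nx α z * Ny β z)) geq low) big refl)
            where
            P : Fin n → Fin n → ℕ
            P x y = if u x z ∧ v y z then c′ else suc c′
            sq : cell α β (λ x y → P x y * P x y) + suc (2 * c′) * (Nx α z * Ny β z) ≡ suc c′ * suc c′ * s
            sq = trans (cong (λ w → cell α β (λ x y → P x y * P x y) + w)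
                   (trans (cong (suc (2 * c′) *_) (sym (area α β z))) (sym (cell-*ˡ α β (suc (2 * c′)) (λ x y → ι (u x z) * ι (v y z))))))
                 (trans (sym (cell-+ α β (λ x y → P x y * P x y) (λ x y → suc (2 * c′) * (ι (u x z) * ι (v y z)))))
                   (trans (cell-cong (λ x y _ _ → point x y)) (cell-const α β (suc c′ * suc c′))))
              where
              square : ∀ c → c * c + suc (2 * c) * 1 ≡ suc c * suc c
              square = solve-∀
              rest : ∀ c → suc c * suc c + suc (2 * c) * 0 ≡ suc c * suc c
              rest = solve-∀
              point : ∀ x y → P x y * P x y + suc (2 * c′) * (ι (u x z) * ι (v y z)) ≡ suc c′ * suc c′
              point x y with u x z | v y z
              ... | true  | true  = square c′
              ... | true  | false = rest c′
              ... | false | true  = rest c′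
              ... | false | false = rest c′
            lin : cell α β (λ x y → ι (f x y) * P x y) + edgesAt α β z ≡ suc c′ * e
            lin = trans (sym (cell-+ α β (λ x y → ι (f x y) * P x y) (λ x y → ι (u x z) * ι (v y z) * ι (f x y)))) (trans (cell-cong (λ x y _ _ → point x y)) (cell-*ˡ α β (suc c′) _))
              where
              inR : ∀ c w → w * c + 1 * w ≡ suc c * w
              inR = solve-∀
              outR : ∀ c w → w * suc c + 0 ≡ suc c * w
              outR = solve-∀
              point : ∀ x y → ι (f x y) * P x y + ι (u x z) * ι (v y z) * ι (f x y) ≡ suc c′ * ι (f x y)
              point x y with u x z | v y z
              ... | true  | true  = inR c′ (ι (f x y))
              ... | true  | false = outR c′ (ι (f x y))
              ... | false | true  = outR c′ (ι (f x y))
              ... | false | false = outR c′ (ι (f x y))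
            big : s ≤ E * E * (Nx α z * Ny β z)
            big = ≤-trans (*-mono-≤ aN bN) (≤-reflexive (shuffle E (Nx α z) (Ny β z)))
              where
              shuffle : ∀ E x y → E * x * (E * y) ≡ E * E * (x * y)
              shuffle = solve-∀

          keep-gain : ∀ p q → move α β ≡ keep p q → Gain α β
          keep-gain p q eq = Gain-from (keep p q) eq (≤-reflexive (trans (+-identityʳ _)
            (cong (E * E *_) (cong₂ _+_ (cong (2 * Q *_) (sym (trans (cell-cong (λ x y _ _ → *-comm (ι (f x y)) (g α β)))
              (cell-*ˡ α β (g α β) _)))) (cell-const α β (g α β * g α β))))))

          gain-by : (m : Move α β) → move α β ≡ m → Gain α β
          gain-by (up p)     = up-gain p
          gain-by (down z d) = down-gain z d
          gain-by (keep p q) = keep-gain p q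

        gain-cell : Gain α β
        gain-cell = gain-by (move α β) refl

      gain : 1 ≤ E → E * E * (2 * Q * energy G + norm G′) + ∑₂ Moved ≤ E * E * (2 * Q * energy G′ + norm G)
      gain 1≤E = subst₂ _≤_ left right (∑₂-mono {κ} {κ} (gain-cell 1≤E))
        where
        lin : (P R : Fin κ → Fin κ → ℕ) → ∑₂ (λ α β → E * E * (2 * Q * P α β + R α β)) ≡ E * E * (2 * Q * ∑₂ P + ∑₂ R)
        lin P R = trans (∑₂-*ˡ {κ} {κ} (E * E) (λ α β → 2 * Q * P α β + R α β))
          (cong (E * E *_) (trans (∑₂-+ {κ} {κ} (λ α β → 2 * Q * P α β) R) (cong (_+ ∑₂ R) (∑₂-*ˡ {κ} {κ} (2 * Q) P))))
        left = trans (∑₂-+ {κ} {κ} _ _) (cong₂ _+_ (trans (lin _ _)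
          (cong (E * E *_) (cong₂ _+_ (cong (2 * Q *_) (sym (∑₂-cells (λ x y → ι (f x y) * G x y))))
            (sym (∑₂-cells (λ x y → G′ x y * G′ x y)))))) (sym (∑₂-cells Moved)))
        right = trans (lin _ _) (cong (E * E *_) (cong₂ _+_ (cong (2 * Q *_) (sym (∑₂-cells (λ x y → ι (f x y) * G′ x y))))
            (sym (∑₂-cells (λ x y → G x y * G x y)))))

  -- Edge-disjoint triangles: each of the three injectivity fields says that one kind of edge
  -- determines the member. A set of pairs thus catches at most as many members as it has pairs.
  record Matching {n : ℕ} (f u v : Fin n → Fin n → Bool) {ℓ} (I : Set ℓ) : Set ℓ where
    field
      members   : List I
      unique    : Unique members
      mx my mz  : I → Fin n
      on-f      : ∀ {i} → i ∈ members → f (mx i) (my i) ≡ true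
      on-u      : ∀ {i} → i ∈ members → u (mx i) (mz i) ≡ true
      on-v      : ∀ {i} → i ∈ members → v (my i) (mz i) ≡ true
      xy-inj    : ∀ {i j} → i ∈ members → j ∈ members → mx i ≡ mx j → my i ≡ my j → i ≡ j
      xz-inj    : ∀ {i j} → i ∈ members → j ∈ members → mx i ≡ mx j → mz i ≡ mz j → i ≡ j
      yz-inj    : ∀ {i j} → i ∈ members → j ∈ members → my i ≡ my j → mz i ≡ mz j → i ≡ j

  count-pairs : ∀ {ℓ} {I : Set ℓ} {n} (L : List I) → Unique L → (c d : I → Fin n) →
    (∀ {i j} → i ∈ L → j ∈ L → c i ≡ c j → d i ≡ d j → i ≡ j) →
    (w : Fin n → Fin n → Bool) → ∑[ i ∈ L ] ι (w (c i) (d i)) ≤ ∑₂ (λ x y → ι (w x y))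
  count-pairs {n = n} L uniq c d inj w = ≤-trans
    (#-≤-rel (λ i → T? (w (c i) (d i))) (λ (xy : Fin n × Fin n) → T? (w (proj₁ xy) (proj₂ xy)))
      (λ i xy → c i ≡ proj₁ xy × d i ≡ proj₂ xy) L (cartesianProduct (allFin n) (allFin n)) uniq
      (λ {i} _ p → (c i , d i) , ∈-cartesianProduct⁺ (∈-allFin (c i)) (∈-allFin (d i)) , p , refl , refl)
      (λ { p q (refl , refl) (e , e′) → inj p q (sym e) (sym e′) }))
    (≤-reflexive (∑-cartesianProduct (allFin n) (allFin n) (λ xy → ι (w (proj₁ xy) (proj₂ xy)))))

  module Colouring {n κ : ℕ} (c : Fin n → Fin κ) where

    private
      X : Fin κ → Fin n → ℕ
      X α x = 𝟙 (c x ≟ᶠ α)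

      a : Fin κ → ℕ
      a α = ∑ (allFin n) (X α)

    ∑-classes : (H : Fin n → ℕ) → ∑ (allFin n) H ≡ ∑[ α ∈ allFin κ ] ∑[ x ∈ allFin n ] X α x * H x
    ∑-classes H = trans (∑-cong (allFin n) (λ x → sym (∑-δFin (λ _ → H x) (c x)))) (∑-swap (allFin n) (allFin κ) _)

    ∑-sizes : ∑ (allFin κ) a ≡ n
    ∑-sizes = trans (∑-cong (allFin κ) (λ α → ∑-cong (allFin n) (λ x → sym (*-identityʳ (X α x)))))
      (trans (sym (∑-classes (λ _ → 1))) (trans (∑-constFin n 1) (*-identityʳ n)))

    ∑-classes-≤ : (E : ℕ) (H : Fin n → ℕ) (B : Fin κ → ℕ) →
      (∀ α → E * (∑[ x ∈ allFin n ] X α x * H x) ≤ B α) → E * ∑ (allFin n) H ≤ ∑ (allFin κ) B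
    ∑-classes-≤ E H B h = ≤-trans (≤-reflexive (trans (cong (E *_) (∑-classes H)) (sym (∑-*ˡ (allFin κ) E _))))
      (∑-mono (allFin κ) h)

    class-cong : ∀ α {H H′ : Fin n → ℕ} → (∀ x → c x ≡ α → H x ≡ H′ x) →
      ∑[ x ∈ allFin n ] X α x * H x ≡ ∑[ x ∈ allFin n ] X α x * H′ x
    class-cong α h = ∑-cong (allFin n) λ x → pointwise x (h x)
      where
      pointwise : ∀ x {p q} → (c x ≡ α → p ≡ q) → X α x * p ≡ X α x * q
      pointwise x e with c x ≟ᶠ α
      ... | yes p = cong (_+ 0) (e p)
      ... | no _  = refl

    -- A class counted here meets `s` in fewer than a 1/E proportion of its vertices, and the class
    -- sizes add up to `n`.
    sparse-bound : (E : ℕ) (s : Fin n → Bool) (N : Fin κ → ℕ) → (∀ α → N α ≡ ∑[ x ∈ allFin n ] X α x * ι (s x)) →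
      E * (∑[ x ∈ allFin n ] ι (s x ∧ does (E * N (c x) <? a (c x)))) ≤ n
    sparse-bound E s N N≡ = ≤-trans (∑-classes-≤ E _ a per-class) (≤-reflexive ∑-sizes)
      where
      ∧-true : ∀ b → b ∧ true ≡ b
      ∧-true true  = refl
      ∧-true false = refl
      ∧-false : ∀ b → b ∧ false ≡ false
      ∧-false true  = refl
      ∧-false false = refl
      per-class : ∀ α → E * (∑[ x ∈ allFin n ] X α x * ι (s x ∧ does (E * N (c x) <? a (c x)))) ≤ a α
      per-class α with E * N α <? a α
      ... | yes p = ≤-trans (≤-reflexive (cong (E *_) (trans
              (class-cong α (λ { x refl → cong ι (trans (cong (s x ∧_) (dec-true (_ <? _) p)) (∧-true (s x))) })) (sym (N≡ α)))))
              (<⇒≤ p)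
      ... | no ¬p = ≤-trans (≤-reflexive (trans (cong (E *_) (trans
              (class-cong α (λ { x refl → cong ι (trans (cong (s x ∧_) (dec-false (_ <? _) ¬p)) (∧-false (s x))) }))
              (∑-0 (allFin n) (λ x → *-zeroʳ (X α x))))) (*-zeroʳ E))) z≤n

    -- There are `κ` classes, and each one counted has fewer than n/(κ E) vertices.
    small-bound : (E : ℕ) → 1 ≤ κ → E * (∑[ x ∈ allFin n ] ι (does (κ * (E * a (c x)) <? n))) ≤ n
    small-bound E 1≤κ = *-cancelˡ-≤ κ {{>-nonZero 1≤κ}} (≤-trans
      (≤-reflexive (sym (*-assoc κ E _)))
      (≤-trans (∑-classes-≤ (κ * E) _ (λ _ → n) per-class) (≤-reflexive (∑-constFin κ n))))
      where
      per-class : ∀ α → κ * E * (∑[ x ∈ allFin n ] X α x * ι (does (κ * (E * a (c x)) <? n))) ≤ n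
      per-class α with κ * (E * a α) <? n
      ... | yes p = ≤-trans (≤-reflexive (trans (cong (κ * E *_) (trans
              (class-cong α {H′ = λ _ → 1} (λ { x refl → cong ι (dec-true (_ <? _) p) }))
              (∑-cong (allFin n) (λ x → *-identityʳ (X α x))))) (*-assoc κ E _))) (<⇒≤ p)
      ... | no ¬p = ≤-trans (≤-reflexive (trans (cong (κ * E *_) (trans
              (class-cong α {H′ = λ _ → 0} (λ { x refl → cong ι (dec-false (_ <? _) ¬p) }))
              (∑-0 (allFin n) (λ x → *-zeroʳ (X α x))))) (*-zeroʳ (κ * E)))) z≤n

  does-false : ∀ {p} {P : Set p} (d : Dec P) → does d ≡ false → ¬ P
  does-false (no ¬p) _ = ¬p

  ∑₂-fst : ∀ {n} (w : Fin n → ℕ) → ∑₂ {n} {n} (λ x _ → w x) ≡ n * ∑ (allFin n) w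
  ∑₂-fst {n} w = trans (∑-cong (allFin n) (λ x → ∑-constFin n (w x))) (∑-*ˡ (allFin n) n w)

  ∑₂-snd : ∀ {n} (w : Fin n → ℕ) → ∑₂ {n} {n} (λ _ y → w y) ≡ n * ∑ (allFin n) w
  ∑₂-snd {n} w = ∑-constFin n _

  ∑₂-columns : ∀ {n} (E : ℕ) (w : Fin n → Fin n → ℕ) → (∀ z → E * (∑[ x ∈ allFin n ] w x z) ≤ n) → E * ∑₂ w ≤ n * n
  ∑₂-columns {n} E w h = ≤-trans (≤-reflexive (trans (cong (E *_) (∑-swap (allFin n) (allFin n) w)) (sym (∑-*ˡ (allFin n) E _))))
    (≤-trans (∑-mono (allFin n) h) (≤-reflexive (∑-constFin n n)))

  module Stuck {n : ℕ} (f u v : Fin n → Fin n → Bool) (E : ℕ) (1≤E : 1 ≤ E)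
    {κ : ℕ} (1≤κ : 1 ≤ κ) (cX cY : Fin n → Fin κ) (g : Fin κ → Fin κ → ℕ)
    {ℓ : Level} {I : Set ℓ} (M : Matching f u v I) where

    Q : ℕ
    Q = 2 * E

    open Graph f u v E Q
    open Cells cX cY g
    open Matching M

    c : ℕ
    c = κ * E * E

    -- Reasons why a triangle may escape the density argument. Each is phrased as a set of pairs on
    -- one side of the triangle so that edge-disjointness applies, even where only one vertex
    -- matters (`smallX`, `smallY`, `richY`).
    moved low sparseX sparseY smallX smallY richY : Fin n → Fin n → Bool
    rich : Fin n → Bool
    moved x y   = moves (move (cX x) (cY y))
    low x y     = f x y ∧ (not (moved x y) ∧ does (g (cX x) (cY y) ≤? 1))
    sparseX x z = u x z ∧ does (E * Nx (cX x) z <? a (cX x))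
    sparseY y z = v y z ∧ does (E * Ny (cY y) z <? b (cY y))
    smallX x _  = does (κ * (E * a (cX x)) <? n)
    smallY _ y  = does (κ * (E * b (cY y)) <? n)
    rich z      = does (n * n ≤? c * c * (Q * trianglesAt z))
    richY _ z   = rich z

    kept : ∀ {α β} (m : Move α β) → moves m ≡ false → ¬ Up α β × (∀ z → ¬ Down α β z)
    kept (keep p q) _ = p , q

    edgesAt≤trianglesAt : ∀ α β z → edgesAt α β z ≤ trianglesAt z
    edgesAt≤trianglesAt α β z = ∑₂-mono {n} {n} λ x y →
      ≤-trans (*-monoˡ-≤ _ (*-mono-≤ (𝟙≤1 (cX x ≟ᶠ α)) (𝟙≤1 (cY y ≟ᶠ β)))) (≤-reflexive (+-identityʳ _))

    -- In a cell of height at least 2 the failure of `Down` gives edge density above (g - 1)/Q,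
    -- hence at least 1/Q, between the neighbourhoods of `z`. Since neither the classes are small
    -- nor the neighbourhoods sparse, both neighbourhoods have at least n/(κ E²) = n/c elements.
    rich-if : ∀ α β z → (∀ z → ¬ Down α β z) → ¬ g α β ≤ 1 → ¬ E * Nx α z < a α → ¬ E * Ny β z < b β →
      ¬ κ * (E * a α) < n → ¬ κ * (E * b β) < n → n * n ≤ c * c * (Q * trianglesAt z)
    rich-if α β z ¬down ¬low ¬sx ¬sy ¬tx ¬ty = begin
      n * n                                        ≤⟨ *-mono-≤ (size (a α) (Nx α z) ¬sx ¬tx) (size (b β) (Ny β z) ¬sy ¬ty) ⟩
      (c * Nx α z) * (c * Ny β z)                  ≡⟨ shuffle c (Nx α z) (Ny β z) ⟩
      c * c * R                                    ≤⟨ *-monoʳ-≤ (c * c) R≤ ⟩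
      c * c * (Q * trianglesAt z)                  ∎
      where
      open ≤-Reasoning
      shuffle : ∀ c x y → c * x * (c * y) ≡ c * c * (x * y)
      shuffle = solve-∀
      R = Nx α z * Ny β z
      size : ∀ s N → ¬ E * N < s → ¬ κ * (E * s) < n → n ≤ c * N
      size s N p q = ≤-trans (≮⇒≥ q) (≤-trans (*-monoʳ-≤ κ (*-monoʳ-≤ E (≮⇒≥ p))) (≤-reflexive (assoc κ E N)))
        where
        assoc : ∀ κ E N → κ * (E * (E * N)) ≡ κ * E * E * N
        assoc = solve-∀
      2≤g : 2 ≤ g α β
      2≤g = ≰⇒> ¬low
      R≤ : R ≤ Q * trianglesAt z
      R≤ = ≤-trans (<⇒≤ (+-cancelʳ-< R R (Q * edgesAt α β z) (≤-<-trans
          (≤-trans (≤-reflexive (cong (R +_) (sym (+-identityʳ R)))) (*-monoˡ-≤ R 2≤g))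
          (≰⇒> (λ h → ¬down z (≮⇒≥ ¬sx , ≮⇒≥ ¬sy , h , ≤-trans (s≤s z≤n) 2≤g))))))
        (*-monoʳ-≤ Q (edgesAt≤trianglesAt α β z))

    one-of : ∀ b₁ b₂ b₃ b₄ b₅ b₆ b₇ →
      (b₁ ≡ false → b₂ ≡ false → b₃ ≡ false → b₄ ≡ false → b₅ ≡ false → b₆ ≡ false → b₇ ≡ true) →
      1 ≤ ι b₁ + (ι b₂ + (ι b₃ + (ι b₄ + (ι b₅ + (ι b₆ + ι b₇)))))
    one-of true  _     _     _     _     _     _ h = s≤s z≤n
    one-of false true  _     _     _     _     _ h = s≤s z≤n
    one-of false false true  _     _     _     _ h = s≤s z≤n
    one-of false false false true  _     _     _ h = s≤s z≤n
    one-of false false false false true  _     _ h = s≤s z≤n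
    one-of false false false false false true  _ h = s≤s z≤n
    one-of false false false false false false _ h rewrite h refl refl refl refl refl refl = s≤s z≤n

    cover : ∀ x y z → f x y ≡ true → u x z ≡ true → v y z ≡ true →
      1 ≤ ι (moved x y) + (ι (low x y) + (ι (sparseX x z) + (ι (sparseY y z) +
        (ι (smallX x y) + (ι (smallY x y) + ι (richY y z))))))
    cover x y z fxy uxz vyz = one-of (moved x y) (low x y) (sparseX x z) (sparseY y z) (smallX x y) (smallY x y) (richY y z)
      λ ¬m ¬l ¬sx ¬sy ¬tx ¬ty → dec-true (_ ≤? _) (rich-if (cX x) (cY y) z
        (proj₂ (kept (move (cX x) (cY y)) ¬m))
        (does-false (_ ≤? _) (trans (sym (cong₂ (λ p q → p ∧ (not q ∧ does (g (cX x) (cY y) ≤? 1))) fxy ¬m)) ¬l))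
        (does-false (_ <? _) (trans (sym (cong (_∧ does (E * Nx (cX x) z <? a (cX x))) uxz)) ¬sx))
        (does-false (_ <? _) (trans (sym (cong (_∧ does (E * Ny (cY y) z <? b (cY y))) vyz)) ¬sy))
        (does-false (_ <? _) ¬tx) (does-false (_ <? _) ¬ty))

    -- Where the height is at most 1, the failure of `Up` bounds the edge density by 2/Q, which is
    -- 1/E; this fixes Q = 2E.
    low-bound : E * ∑₂ (λ x y → ι (low x y)) ≤ n * n
    low-bound = *-cancelˡ-≤ 2 (begin
      2 * (E * ∑₂ (λ x y → ι (low x y)))
        ≡⟨ sym (*-assoc 2 E _) ⟩
      Q * ∑₂ (λ x y → ι (low x y))
        ≡⟨ trans (cong (Q *_) (∑₂-cells (λ x y → ι (low x y)))) (sym (∑₂-*ˡ {κ} {κ} Q (λ α β → cell α β (λ x y → ι (low x y))))) ⟩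
      ∑₂ (λ α β → Q * cell α β (λ x y → ι (low x y)))
        ≤⟨ ∑₂-mono {κ} {κ} per-cell ⟩
      ∑₂ (λ α β → cell α β (λ _ _ → 2))
        ≡⟨ sym (∑₂-cells (λ _ _ → 2)) ⟩
      ∑₂ {n} {n} (λ _ _ → 2)
        ≡⟨ trans (∑₂-const {n} {n} 2) (*-comm (n * n) 2) ⟩
      2 * (n * n) ∎)
      where
      open ≤-Reasoning
      none : ∀ α β → (∀ x y → cX x ≡ α → cY y ≡ β → ι (low x y) ≡ 0) → Q * cell α β (λ x y → ι (low x y)) ≤ cell α β (λ _ _ → 2)
      none α β h = ≤-trans (≤-reflexive (trans (cong (Q *_) (trans (cell-cong h) (cell-const α β 0))) (*-zeroʳ Q))) z≤n
      ∧-falseʳ : ∀ p → ι (p ∧ false) ≡ 0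
      ∧-falseʳ true  = refl
      ∧-falseʳ false = refl
      ∧-falseʳʳ : ∀ p q → ι (p ∧ (q ∧ false)) ≡ 0
      ∧-falseʳʳ p true  = ∧-falseʳ p
      ∧-falseʳʳ p false = ∧-falseʳ p
      ι-∧ : ∀ p q → ι (p ∧ q) ≤ ι p
      ι-∧ true  true  = ≤-refl
      ι-∧ true  false = z≤n
      ι-∧ false q     = z≤n
      by-move : ∀ α β (m : Move α β) → move α β ≡ m → Q * cell α β (λ x y → ι (low x y)) ≤ cell α β (λ _ _ → 2)
      by-move α β (up p) eq = none α β (λ { x y refl refl → trans (cong (λ m → ι (f x y ∧ (not (moves m) ∧ _))) eq) (∧-falseʳ (f x y)) })
      by-move α β (down z d) eq = none α β (λ { x y refl refl → trans (cong (λ m → ι (f x y ∧ (not (moves m) ∧ _))) eq) (∧-falseʳ (f x y)) })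
      by-move α β (keep ¬p _) eq with g α β ≤? 1
      ... | no ¬q = none α β (λ { x y refl refl → trans (cong (λ t → ι (f x y ∧ (not (moved x y) ∧ t))) (dec-false (_ ≤? _) ¬q)) (∧-falseʳʳ (f x y) (not (moved x y))) })
      ... | yes q = begin
        Q * cell α β (λ x y → ι (low x y))
          ≤⟨ *-monoʳ-≤ Q (∑₂-mono {n} {n} (λ x y → *-monoʳ-≤ (X α x * Y β y) (ι-∧ (f x y) _))) ⟩
        Q * edges α β
          ≤⟨ <⇒≤ (≰⇒> ¬p) ⟩
        suc (g α β) * (a α * b β)
          ≤⟨ *-monoˡ-≤ (a α * b β) (s≤s q) ⟩
        2 * (a α * b β)
          ≡⟨ sym (cell-const α β 2) ⟩
        cell α β (λ _ _ → 2) ∎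
      per-cell : ∀ α β → Q * cell α β (λ x y → ι (low x y)) ≤ cell α β (λ _ _ → 2)
      per-cell α β = by-move α β (move α β) refl

    row-bound : (w : Fin n → ℕ) → E * ∑ (allFin n) w ≤ n → E * (n * ∑ (allFin n) w) ≤ n * n
    row-bound w h = ≤-trans (≤-reflexive (swap E n _)) (*-monoʳ-≤ n h)
      where
      swap : ∀ E n s → E * (n * s) ≡ n * (E * s)
      swap = solve-∀

    rich-bound : 1 ≤ n → E * (c * c * (Q * ∑ (allFin n) trianglesAt)) ≤ n * (n * n) → E * (∑[ z ∈ allFin n ] ι (rich z)) ≤ n
    rich-bound 1≤n few = *-cancelʳ-≤ _ n (n * n) {{>-nonZero (*-mono-≤ 1≤n 1≤n)}} (begin
      E * (∑[ z ∈ allFin n ] ι (rich z)) * (n * n)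
        ≡⟨ trans (*-assoc E _ (n * n)) (cong (E *_) (sym (∑-*ʳ (allFin n) (λ z → ι (rich z)) (n * n)))) ⟩
      E * ∑ (allFin n) (λ z → ι (rich z) * (n * n))
        ≤⟨ *-monoʳ-≤ E (∑-mono (allFin n) λ z → ≤-trans (𝟙-*≤ (n * n ≤? c * c * (Q * trianglesAt z)) id)
             (≤-trans (*-monoˡ-≤ _ (𝟙≤1 (n * n ≤? c * c * (Q * trianglesAt z)))) (≤-reflexive (+-identityʳ _)))) ⟩
      E * ∑ (allFin n) (λ z → c * c * (Q * trianglesAt z))
        ≡⟨ cong (E *_) (trans (∑-*ˡ (allFin n) (c * c) _) (cong (c * c *_) (∑-*ˡ (allFin n) Q trianglesAt))) ⟩
      E * (c * c * (Q * ∑ (allFin n) trianglesAt))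
        ≤⟨ few ⟩
      n * (n * n) ∎)
      where open ≤-Reasoning

    -- By `cover` every member falls into one of seven sets of pairs, and each set has at most n²/E
    -- elements.
    matching-bound : 1 ≤ n → E * (c * c * (Q * ∑ (allFin n) trianglesAt)) ≤ n * (n * n) →
      E * ∑₂ Moved ≤ n * n → E * length members ≤ 7 * (n * n)
    matching-bound 1≤n few unmoved = begin
      E * length members
        ≡⟨ cong (E *_) (sym (trans (∑-const members 1) (*-identityʳ _))) ⟩
      E * ∑ members (λ _ → 1)
        ≤⟨ *-monoʳ-≤ E (∑-mono∈ members (λ {i} i∈ → cover (mx i) (my i) (mz i) (on-f i∈) (on-u i∈) (on-v i∈))) ⟩
      E * (∑[ i ∈ members ] (w₁ i + (w₂ i + (w₃ i + (w₄ i + (w₅ i + (w₆ i + w₇ i)))))))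
        ≡⟨ cong (E *_) (trans (∑-+ members w₁ _) (cong (∑ members w₁ +_) (trans (∑-+ members w₂ _) (cong (∑ members w₂ +_)
           (trans (∑-+ members w₃ _) (cong (∑ members w₃ +_) (trans (∑-+ members w₄ _) (cong (∑ members w₄ +_)
           (trans (∑-+ members w₅ _) (cong (∑ members w₅ +_) (∑-+ members w₆ w₇))))))))))) ⟩
      E * (∑ members w₁ + (∑ members w₂ + (∑ members w₃ + (∑ members w₄ + (∑ members w₅ + (∑ members w₆ + ∑ members w₇))))))
        ≡⟨ spread E (∑ members w₁) (∑ members w₂) (∑ members w₃) (∑ members w₄) (∑ members w₅) (∑ members w₆) (∑ members w₇) ⟩
      E * ∑ members w₁ + (E * ∑ members w₂ + (E * ∑ members w₃ + (E * ∑ members w₄ + (E * ∑ members w₅ + (E * ∑ members w₆ + E * ∑ members w₇)))))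
        ≤⟨ +-mono-≤ (bound mx my xy-inj moved unmoved)
          (+-mono-≤ (bound mx my xy-inj low low-bound)
          (+-mono-≤ (bound mx mz xz-inj sparseX (∑₂-columns {n} E (λ x z → ι (sparseX x z)) (λ z → Colouring.sparse-bound cX E (λ x → u x z) (λ α → Nx α z) (λ α → refl))))
          (+-mono-≤ (bound my mz yz-inj sparseY (∑₂-columns {n} E (λ y z → ι (sparseY y z)) (λ z → Colouring.sparse-bound cY E (λ y → v y z) (λ β → Ny β z) (λ β → refl))))
          (+-mono-≤ (bound mx my xy-inj smallX (≤-trans (≤-reflexive (cong (E *_) (∑₂-fst {n} (λ x → ι (smallX x x))))) (row-bound (λ x → ι (smallX x x)) (Colouring.small-bound cX E 1≤κ))))
          (+-mono-≤ (bound mx my xy-inj smallY (≤-trans (≤-reflexive (cong (E *_) (∑₂-snd {n} (λ y → ι (smallY y y))))) (row-bound (λ y → ι (smallY y y)) (Colouring.small-bound cY E 1≤κ))))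
            (bound my mz yz-inj richY (≤-trans (≤-reflexive (cong (E *_) (∑₂-snd {n} (λ z → ι (rich z))))) (row-bound (λ z → ι (rich z)) (rich-bound 1≤n few))))))))) ⟩
      n * n + (n * n + (n * n + (n * n + (n * n + (n * n + n * n)))))
        ≡⟨ seven (n * n) ⟩
      7 * (n * n) ∎
      where
      open ≤-Reasoning
      w₁ w₂ w₃ w₄ w₅ w₆ w₇ : I → ℕ
      w₁ i = ι (moved (mx i) (my i))
      w₂ i = ι (low (mx i) (my i))
      w₃ i = ι (sparseX (mx i) (mz i))
      w₄ i = ι (sparseY (my i) (mz i))
      w₅ i = ι (smallX (mx i) (my i))
      w₆ i = ι (smallY (mx i) (my i))
      w₇ i = ι (richY (my i) (mz i))
      seven : ∀ s → s + (s + (s + (s + (s + (s + s))))) ≡ 7 * s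
      seven = solve-∀
      spread : ∀ E a b c d e f g → E * (a + (b + (c + (d + (e + (f + g)))))) ≡ E * a + (E * b + (E * c + (E * d + (E * e + (E * f + E * g)))))
      spread = solve-∀
      bound : (p q : I → Fin n) → (∀ {i j} → i ∈ members → j ∈ members → p i ≡ p j → q i ≡ q j → i ≡ j) →
        (w : Fin n → Fin n → Bool) → E * ∑₂ (λ x y → ι (w x y)) ≤ n * n → E * (∑[ i ∈ members ] ι (w (p i) (q i))) ≤ n * n
      bound p q inj w h = ≤-trans (*-monoʳ-≤ E (count-pairs members unique p q inj w)) h

  2ab≤a²+b² : ∀ a b → 2 * a * b ≤ a * a + b * b
  2ab≤a²+b² a b with ≤-total a b
  ... | inj₁ a≤b = subst (λ b → 2 * a * b ≤ a * a + b * b) (m+[n∸m]≡n a≤b)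
          (≤-trans (m≤m+n _ ((b ∸ a) * (b ∸ a))) (≤-reflexive (sym (expand a (b ∸ a)))))
    where
    expand : ∀ a d → a * a + (a + d) * (a + d) ≡ 2 * a * (a + d) + d * d
    expand = solve-∀
  ... | inj₂ b≤a = subst (λ a → 2 * a * b ≤ a * a + b * b) (m+[n∸m]≡n b≤a)
          (≤-trans (m≤m+n _ ((a ∸ b) * (a ∸ b))) (≤-reflexive (sym (expand b (a ∸ b)))))
    where
    expand : ∀ b d → (b + d) * (b + d) + b * b ≡ 2 * (b + d) * b + d * d
    expand = solve-∀

  -- With at most n³ / threshold triangles, no stage of the refinement gets stuck.
  threshold : (E fuel κ : ℕ) → ℕ
  threshold E zero       κ = 0
  threshold E (suc fuel) κ = E * (κ * E * E * (κ * E * E) * (2 * E)) + threshold E fuel (κ * 2 ^ κ)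

  module Iterate {n : ℕ} (f u v : Fin n → Fin n → Bool) {ℓ} {I : Set ℓ} (M : Matching f u v I)
    (E : ℕ) (1≤E : 1 ≤ E) (1≤n : 1 ≤ n) (large : 8 * (n * n) ≤ E * length (Matching.members M)) where

    private
      Q : ℕ
      Q = 2 * E

    open Graph f u v E Q

    -- Nonnegativity of the squared distance from Q f to G, pair by pair: the potential never
    -- exceeds Q² n².
    energy-bound : ∀ G → 2 * Q * energy G ≤ norm G + n * n * (Q * Q)
    energy-bound G = ≤-trans (≤-reflexive (sym (∑₂-*ˡ {n} {n} (2 * Q) (λ x y → ι (f x y) * G x y))))
      (≤-trans (∑₂-mono {n} {n} pointwise)
        (≤-reflexive (trans (∑₂-+ {n} {n} (λ x y → G x y * G x y) (λ _ _ → Q * Q)) (cong (norm G +_) (∑₂-const {n} {n} (Q * Q))))))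
      where
      pointwise : ∀ x y → 2 * Q * (ι (f x y) * G x y) ≤ G x y * G x y + Q * Q
      pointwise x y with f x y
      ... | true  = ≤-trans (≤-reflexive (cong (2 * Q *_) (+-identityʳ (G x y))))
                      (≤-trans (2ab≤a²+b² Q (G x y)) (≤-reflexive (+-comm (Q * Q) _)))
      ... | false = ≤-trans (≤-reflexive (*-zeroʳ (2 * Q))) z≤n

    -- The potential times E³ is bounded by E³ Q² n² and grows by at least n² in a step that is not
    -- stuck, so one step more than E³ Q² is impossible.
    steps : ℕ
    steps = suc (E * E * E * (Q * Q))

    -- Invariant: after `t` refinements E³ times the potential is at least t n². If more than n²/E
    -- of the area moves, `gain` multiplied by E supplies the next n²; otherwise
    -- `Stuck.matching-bound` contradicts the size of the matching.
    iterate : ∀ fuel t {κ} → 1 ≤ κ → (cX cY : Fin n → Fin κ) (g : Fin κ → Fin κ → ℕ) → steps ≤ fuel + t →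
      E * E * E * norm (Cells.G cX cY g) + t * (n * n) ≤ E * E * E * (2 * Q * energy (Cells.G cX cY g)) →
      threshold E fuel κ * ∑ (allFin n) trianglesAt ≤ n * (n * n) → ⊥
    iterate zero t 1≤κ cX cY g steps≤ inv few = <⇒≱ (*-mono-≤ 1≤n 1≤n)
      (linear (n * n) 0 (E * E * E * S + e * (n * n)) (≤-trans (+-monoʳ-≤ (E * E * E * S) (*-monoˡ-≤ (n * n) steps≤))
        (≤-trans inv (*-monoʳ-≤ (E * E * E) (energy-bound (Cells.G cX cY g)))))
        (left (E * E * E * S) e (n * n)) (right (E * E * E) S (n * n) (Q * Q)))
      where
      S = norm (Cells.G cX cY g)
      e = E * E * E * (Q * Q)
      left : ∀ s e n → s + suc e * n ≡ s + e * n + n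
      left = solve-∀
      right : ∀ E S n Q → E * (S + n * Q) ≡ E * S + E * Q * n + 0
      right = solve-∀
    iterate (suc fuel) t {κ} 1≤κ cX cY g steps≤ inv few with E * ∑₂ (Cells.Moved cX cY g) ≤? n * n
    -- The matching was assumed to have at least 8 n²/E members, one n²/E more than the seven
    -- exceptional sets can hold.
    ... | yes stuck = <⇒≱ (*-mono-≤ 1≤n 1≤n) (linear (n * n) 0 (7 * (n * n))
            (≤-trans large (Stuck.matching-bound f u v E 1≤E 1≤κ cX cY g M 1≤n
              (≤-trans (≤-trans (≤-reflexive (assoc E (κ * E * E * (κ * E * E)) (2 * E) T))
                 (*-monoˡ-≤ T (m≤m+n (E * (κ * E * E * (κ * E * E) * (2 * E))) (threshold E fuel (κ * 2 ^ κ))))) few) stuck))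
            (eight (n * n)) (sym (+-identityʳ _)))
      where
      T = ∑ (allFin n) trianglesAt
      assoc : ∀ E c Q T → E * (c * (Q * T)) ≡ E * (c * Q) * T
      assoc = solve-∀
      eight : ∀ s → 8 * s ≡ 7 * s + s
      eight = solve-∀
    ... | no ¬stuck = iterate fuel (suc t) (*-mono-≤ 1≤κ (m^n>0 2 κ)) cX′ cY′ g′ (≤-trans steps≤ (≤-reflexive (sym (+-suc fuel t))))
            (subst₂ _≤_ (cong (λ s → E * E * E * s + suc t * (n * n)) (∑₂-cong {n} {n} (λ x y → sym (cong₂ _*_ (g′-colours x y) (g′-colours x y)))))
              (cong (λ s → E * E * E * (2 * Q * s)) (∑₂-cong {n} {n} (λ x y → sym (cong (ι (f x y) *_) (g′-colours x y))))) inv′)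
            (≤-trans (*-monoˡ-≤ (∑ (allFin n) trianglesAt) (m≤n+m (threshold E fuel (κ * 2 ^ κ)) (E * (κ * E * E * (κ * E * E) * (2 * E))))) few)
      where
      open Cells cX cY g
      inv′ : E * E * E * norm G′ + suc t * (n * n) ≤ E * E * E * (2 * Q * energy G′)
      inv′ = linear _ _ (E * E * E * (2 * Q * energy G) + E * E * E * norm G)
        (+-mono-≤ inv (≤-trans (+-monoʳ-≤ _ (<⇒≤ (≰⇒> ¬stuck))) (≤-trans (≤-reflexive (sym (*-distribˡ-+ E _ _))) (*-monoʳ-≤ E (gain 1≤E)))))
        (left E (norm G) (t * (n * n)) (2 * Q * energy G) (norm G′) (n * n))
        (right E (2 * Q * energy G) (2 * Q * energy G′) (norm G))
        where
        left : ∀ E S t P S′ n → E * E * E * S + t + (E * (E * E * (P + S′)) + n) ≡ E * E * E * P + E * E * E * S + (E * E * E * S′ + (n + t))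
        left = solve-∀
        right : ∀ E P P′ S → E * E * E * P + E * (E * E * (P′ + S)) ≡ E * E * E * P + E * E * E * S + E * E * E * P′
        right = solve-∀

  -- The removal lemma in contrapositive form: a dense edge-disjoint family forces more than n³/D
  -- triangles. `D` iterates κ ↦ κ 2^κ about E⁵ times, hence is of tower type in `k`. The refinement
  -- starts from one class on each side and height 0.
  triangle-removal : ∀ (k : ℕ) → ∃ λ D → ∀ {n} (f u v : Fin n → Fin n → Bool) {I : Set} (M : Matching f u v I) →
    1 ≤ n → n * n ≤ k * length (Matching.members M) →
    D * (∑[ z ∈ allFin n ] ∑₂ (λ x y → ι (u x z) * ι (v y z) * ι (f x y))) ≤ n * (n * n) → ⊥
  triangle-removal k = threshold E steps 1 , main
    where
    E steps : ℕ
    E = 8 * suc k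
    steps = suc (E * E * E * (2 * E * (2 * E)))
    main : ∀ {n} (f u v : Fin n → Fin n → Bool) {I : Set} (M : Matching f u v I) →
      1 ≤ n → n * n ≤ k * length (Matching.members M) →
      threshold E steps 1 * (∑[ z ∈ allFin n ] ∑₂ (λ x y → ι (u x z) * ι (v y z) * ι (f x y))) ≤ n * (n * n) → ⊥
    main {n} f u v M 1≤n large few = Iterate.iterate f u v M E (s≤s z≤n) 1≤n large′ steps 0 ≤-refl
      (λ _ → fzero) (λ _ → fzero) (λ _ _ → 0) (≤-reflexive (sym (+-identityʳ steps)))
      (≤-trans (≤-reflexive (trans (+-identityʳ _) (trans (cong (E * E * E *_) (trans (∑₂-const {n} {n} 0) (*-zeroʳ (n * n)))) (*-zeroʳ (E * E * E))))) z≤n)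
      few
      where
      large′ : 8 * (n * n) ≤ E * length (Matching.members M)
      large′ = ≤-trans (*-monoʳ-≤ 8 (≤-trans large (*-monoˡ-≤ _ (n≤1+n k)))) (≤-reflexive (sym (*-assoc 8 (suc k) _)))

  -- Maximal families of unrelated pairs

  -- A maximal independent set for a conflict relation that need not be transitive. It serves both
  -- for the family of pairs and for representatives of differences.
  record Selection {a ℓ} {A : Set a} (conf : A → A → Set ℓ) (L : List A) : Set (a ⊔ ℓ) where
    field
      chosen  : List A
      ⊆-L     : ∀ {x} → x ∈ chosen → x ∈ L
      unique  : Unique chosen
      no-conf : ∀ {x y} → x ∈ chosen → y ∈ chosen → conf x y → x ≡ y
      covers  : ∀ {x} → x ∈ L → ∃ λ y → y ∈ chosen × conf x y

  module _ {a ℓ} {A : Set a} {conf : A → A → Set ℓ} (conf? : ∀ x y → Dec (conf x y))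
    (conf-refl : ∀ x → conf x x) (conf-sym : ∀ {x y} → conf x y → conf y x) where

    select : (L : List A) → Selection conf L
    select [] = record { chosen = [] ; ⊆-L = λ () ; unique = [] ; no-conf = λ () ; covers = λ () }
    select (x ∷ L) with select L
    ... | S with Any.any? (conf? x) (Selection.chosen S)
    ...   | yes p = record { Selection S ; ⊆-L = there ∘ Selection.⊆-L S ; covers = covers′ }
      where
      covers′ : ∀ {y} → y ∈ x ∷ L → ∃ λ z → z ∈ Selection.chosen S × conf y z
      covers′ (here refl) = find p
      covers′ (there q)   = Selection.covers S q
    ...   | no ¬p = record
      { chosen  = x ∷ chosen
      ; ⊆-L     = λ { (here e) → here e ; (there q) → there (⊆-L q) }
      ; unique  = All.tabulate (λ y∈ e → ¬p (Any.map (λ { refl → subst (conf x) e (conf-refl x) }) y∈)) ∷ unique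
      ; no-conf = λ { (here refl) (here refl) _ → refl
                    ; (here refl) (there q) c → ⊥-elim (¬p (Any.map (λ { refl → c }) q))
                    ; (there q) (here refl) c → ⊥-elim (¬p (Any.map (λ { refl → conf-sym c }) q))
                    ; (there q) (there r) c → no-conf q r c }
      ; covers  = λ { (here refl) → x , here refl , conf-refl x
                    ; (there q) → let y , y∈ , c = covers q in y , there y∈ , c } }
      where open Selection S

  ∑-allFin-suc : ∀ {n} (f : Fin (suc n) → ℕ) → ∑ (allFin (suc n)) f ≡ f fzero + ∑ (allFin n) (f ∘ fsuc)
  ∑-allFin-suc {n} f = cong (f fzero +_) (trans (cong (λ L → ∑ L f) (sym (map-tabulate {n = n} id fsuc))) (∑-map fsuc (allFin n) f))

  ∣∣-∑ : ∀ {n} (p : Subset n) → ∣ p ∣ ≡ ∑[ i ∈ allFin n ] ι (Vec.lookup p i)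
  ∣∣-∑ Vec.[]            = refl
  ∣∣-∑ {suc n} (true Vec.∷ p)  = trans (cong suc (∣∣-∑ p)) (sym (∑-allFin-suc (λ i → ι (Vec.lookup (true Vec.∷ p) i))))
  ∣∣-∑ {suc n} (false Vec.∷ p) = trans (∣∣-∑ p) (sym (∑-allFin-suc (λ i → ι (Vec.lookup (false Vec.∷ p) i))))

  module _ {n ℓ} {P : Fin n → Set ℓ} (P? : ∀ i → Dec (P i)) where

    ⟪_⟫ : Subset n
    ⟪_⟫ = Vec.tabulate (λ i → does (P? i))

    ∈-⟪⟫ : ∀ {i} → i ∈ˢ ⟪_⟫ → P i
    ∈-⟪⟫ {i} i∈ with P? i | trans (sym (lookup∘tabulate (λ i → does (P? i)) i)) ([]=⇒lookup i∈)
    ... | yes p | _ = p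

    ∣⟪⟫∣ : ∣ ⟪_⟫ ∣ ≡ # P? (allFin n)
    ∣⟪⟫∣ = trans (∣∣-∑ ⟪_⟫) (∑-cong (allFin n) (λ i → cong ι (lookup∘tabulate (λ i → does (P? i)) i)))

  module _ {c ℓ} {G : Set c} (_≈_ : G → G → Set ℓ) (_∙_ : G → G → G) where

    Conclusion : ∀ {N} (a b : Fin N → G) (s q : ℕ) → Set (c ⊔ ℓ)
    Conclusion {N} a b s q = ∃₂ λ (A′ B′ : Subset N) →
      (q * N ≤ q * ∣ A′ ∣ + N) × (q * N ≤ q * ∣ B′ ∣ + N) ×
      (∃ λ m → (q * m ≤ q * s + N) × CardAtMost _≈_ _∙_ (Sumset _≈_ _∙_ a b A′ B′) m)

    -- The statement with K = q, ε = 1/q and δ = 1/D.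
    WorksNat : (q D : ℕ) → Set (c ⊔ ℓ)
    WorksNat q D = ∀ (N : ℕ) (a b : Fin N → G) → InjectiveEnum _≈_ _∙_ a → InjectiveEnum _≈_ _∙_ b →
      (Γ : Rel₂ N) (s : ℕ) → HasCard _≈_ _∙_ (RestrictedSumset _≈_ _∙_ a b Γ) s →
      D * (N * N) ≤ D * cardΓ Γ + N * N → s ≤ q * N → Conclusion a b s q

  non : ∀ {N} → Rel₂ N → Fin N → Fin N → ℕ
  non Γ i j = 𝟙 (¬? (j ∈? Γ i))

  nonΓ : ∀ {N} → Rel₂ N → ℕ
  nonΓ Γ = ∑₂ (non Γ)

  ∈?-ι : ∀ {N} (p : Subset N) j → 𝟙 (j ∈? p) ≡ ι (Vec.lookup p j)
  ∈?-ι (true  Vec.∷ p) fzero    = refl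
  ∈?-ι (false Vec.∷ p) fzero    = refl
  ∈?-ι (_     Vec.∷ p) (fsuc j) = ∈?-ι p j

  sum-map : ∀ {a} {A : Set a} (L : List A) (f : A → ℕ) → sum (map f L) ≡ ∑ L f
  sum-map []      f = refl
  sum-map (x ∷ L) f = cong (f x +_) (sum-map L f)

  cardΓ+nonΓ : ∀ {N} (Γ : Rel₂ N) → cardΓ Γ + nonΓ Γ ≡ N * N
  cardΓ+nonΓ {N} Γ = begin
    cardΓ Γ + nonΓ Γ
      ≡⟨ cong (_+ nonΓ Γ) (trans (sum-map (allFin N) _) (∑-cong (allFin N) (λ i → trans (∣∣-∑ (Γ i))
           (∑-cong (allFin N) (λ j → sym (∈?-ι (Γ i) j)))))) ⟩
    ∑₂ (λ i j → 𝟙 (j ∈? Γ i)) + nonΓ Γ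
      ≡⟨ sym (∑₂-+ {N} {N} (λ i j → 𝟙 (j ∈? Γ i)) (non Γ)) ⟩
    ∑₂ (λ i j → 𝟙 (j ∈? Γ i) + non Γ i j)
      ≡⟨ ∑₂-cong {N} {N} (λ i j → 𝟙-¬ (j ∈? Γ i)) ⟩
    ∑₂ {N} {N} (λ _ _ → 1)
      ≡⟨ trans (∑₂-const {N} {N} 1) (*-identityʳ (N * N)) ⟩
    N * N ∎
    where open ≡-Reasoning

  few-non : ∀ {N} (Γ : Rel₂ N) D → D * (N * N) ≤ D * cardΓ Γ + N * N → D * nonΓ Γ ≤ N * N
  few-non {N} Γ D h = +-cancelˡ-≤ (D * cardΓ Γ) _ _ (≤-trans
    (≤-reflexive (trans (sym (*-distribˡ-+ D _ _)) (cong (D *_) (cardΓ+nonΓ Γ)))) h)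

  -- _~_ is a decidable certificate that two sums are equal: equality in the group itself need not be decidable.
  record Family {N : ℕ} (Γ : Rel₂ N) (A₁ B₁ : Fin N → Set) (_~_ : Fin N × Fin N → Fin N × Fin N → Set) : Set where
    field
      pairs   : List (Fin N × Fin N)
      unique  : Unique pairs
      in-A₁   : ∀ {φ} → φ ∈ pairs → A₁ (proj₁ φ)
      in-B₁   : ∀ {φ} → φ ∈ pairs → B₁ (proj₂ φ)
      avoids  : ∀ {φ i j} → φ ∈ pairs → j ∈ˢ Γ i → ¬ φ ~ (i , j)
      inj₁ᶠ   : ∀ {φ ψ} → φ ∈ pairs → ψ ∈ pairs → proj₁ φ ≡ proj₁ ψ → φ ≡ ψ
      inj₂ᶠ   : ∀ {φ ψ} → φ ∈ pairs → ψ ∈ pairs → proj₂ φ ≡ proj₂ ψ → φ ≡ ψ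
      inj~    : ∀ {φ ψ} → φ ∈ pairs → ψ ∈ pairs → φ ~ ψ → φ ≡ ψ

  module _ {c ℓ} {G : Set c} (_≈_ : G → G → Set ℓ) (_∙_ : G → G → G) (≈-equiv : IsEquivalence _≈_)
    {N : ℕ} (a b : Fin N → G) (Γ : Rel₂ N) (s q : ℕ) (hc : HasCard _≈_ _∙_ (RestrictedSumset _≈_ _∙_ a b Γ) s)
    {A₁ B₁ : Fin N → Set} (A₁? : ∀ i → Dec (A₁ i)) (B₁? : ∀ i → Dec (B₁ i))
    {_~_ : Fin N × Fin N → Fin N × Fin N → Set} (_~?_ : ∀ φ ψ → Dec (φ ~ ψ)) (~-sym : ∀ {φ ψ} → φ ~ ψ → ψ ~ φ)
    (~-sound : ∀ {i j i′ j′} → (i , j) ~ (i′ , j′) → (a i ∙ b j) ≈ (a i′ ∙ b j′)) where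

    private
      open IsEquivalence ≈-equiv renaming (refl to ≈-refl; sym to ≈-sym; trans to ≈-trans)

      Pair : Set
      Pair = Fin N × Fin N

      Hit : Pair → Set
      Hit φ = ∃ λ i → ∃ λ j → j ∈ˢ Γ i × φ ~ (i , j)

      hit? : ∀ φ → Dec (Hit φ)
      hit? φ = any? λ i → any? λ j → (j ∈? Γ i) ×-dec (φ ~? (i , j))

      Ok : Pair → Set
      Ok φ = A₁ (proj₁ φ) × B₁ (proj₂ φ) × ¬ Hit φ

      ok? : ∀ φ → Dec (Ok φ)
      ok? φ = A₁? (proj₁ φ) ×-dec B₁? (proj₂ φ) ×-dec ¬? (hit? φ)

      conf : Pair → Pair → Set
      conf φ ψ = proj₁ φ ≡ proj₁ ψ ⊎ proj₂ φ ≡ proj₂ ψ ⊎ φ ~ ψ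

      conf? : ∀ φ ψ → Dec (conf φ ψ)
      conf? φ ψ = (proj₁ φ ≟ᶠ proj₁ ψ) ⊎-dec (proj₂ φ ≟ᶠ proj₂ ψ) ⊎-dec (φ ~? ψ)

      conf-sym : ∀ {φ ψ} → conf φ ψ → conf ψ φ
      conf-sym (inj₁ e)        = inj₁ (sym e)
      conf-sym (inj₂ (inj₁ e)) = inj₂ (inj₁ (sym e))
      conf-sym (inj₂ (inj₂ r)) = inj₂ (inj₂ (~-sym r))

      S : Selection conf (filter ok? (cartesianProduct (allFin N) (allFin N)))
      S = select conf? (λ _ → inj₁ refl) conf-sym _
      open Selection S

      is-ok : ∀ {φ} → φ ∈ chosen → Ok φ
      is-ok φ∈ = proj₂ (∈-filter⁻ ok? {xs = cartesianProduct (allFin N) (allFin N)} (⊆-L φ∈))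

    maximal-family : Family Γ A₁ B₁ _~_
    maximal-family = record
      { pairs = chosen ; unique = unique
      ; in-A₁ = λ φ∈ → proj₁ (is-ok φ∈) ; in-B₁ = λ φ∈ → proj₁ (proj₂ (is-ok φ∈))
      ; avoids = λ φ∈ j∈ r → proj₂ (proj₂ (is-ok φ∈)) (_ , _ , j∈ , r)
      ; inj₁ᶠ = λ p q e → no-conf p q (inj₁ e)
      ; inj₂ᶠ = λ p q e → no-conf p q (inj₂ (inj₁ e))
      ; inj~ = λ p q r → no-conf p q (inj₂ (inj₂ r)) }

    private
      used? : (pr : Pair → Fin N) → ∀ i → Dec (Any (λ φ → i ≡ pr φ) chosen)
      used? pr i = Any.any? (λ φ → i ≟ᶠ pr φ) chosen

      module Side (pr : Pair → Fin N) {P : Fin N → Set} (P? : ∀ i → Dec (P i)) where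

        Kept : Fin N → Set
        Kept i = P i × ¬ Any (λ φ → i ≡ pr φ) chosen

        kept? : ∀ i → Dec (Kept i)
        kept? i = P? i ×-dec ¬? (used? pr i)

        used-count : ∑[ i ∈ allFin N ] 𝟙 (used? pr i) ≤ length chosen
        used-count = ≤-trans (#-≤-rel (used? pr) {Q = λ (φ : Pair) → ⊤} (λ _ → yes tt) (λ i φ → i ≡ pr φ) (allFin N) chosen (allFin⁺ N)
            (λ {i} _ p → let φ , φ∈ , e = find p in φ , φ∈ , tt , e)
            (λ _ _ e e′ → trans e (sym e′)))
          (≤-reflexive (trans (∑-const chosen 1) (*-identityʳ _)))

        size : N ≤ ∣ ⟪ kept? ⟫ ∣ + (∑[ i ∈ allFin N ] 𝟙 (¬? (P? i)) + length chosen)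
        size = begin
          N                                      ≡⟨ sym (trans (∑-constFin N 1) (*-identityʳ N)) ⟩
          ∑ (allFin N) (λ _ → 1)                 ≤⟨ ∑-mono (allFin N) pointwise ⟩
          ∑ (allFin N) (λ i → 𝟙 (kept? i) + (𝟙 (¬? (P? i)) + 𝟙 (used? pr i)))
            ≡⟨ trans (∑-+ (allFin N) _ _) (cong (# kept? (allFin N) +_) (∑-+ (allFin N) _ _)) ⟩
          # kept? (allFin N) + (∑ (allFin N) (λ i → 𝟙 (¬? (P? i))) + ∑ (allFin N) (λ i → 𝟙 (used? pr i)))
            ≤⟨ +-mono-≤ (≤-reflexive (sym (∣⟪⟫∣ kept?))) (+-monoʳ-≤ _ used-count) ⟩
          ∣ ⟪ kept? ⟫ ∣ + (∑ (allFin N) (λ i → 𝟙 (¬? (P? i))) + length chosen) ∎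
          where
          open ≤-Reasoning
          pointwise : ∀ i → 1 ≤ 𝟙 (kept? i) + (𝟙 (¬? (P? i)) + 𝟙 (used? pr i))
          pointwise i with P? i | used? pr i
          ... | yes _ | yes _ = s≤s z≤n
          ... | yes _ | no _  = s≤s z≤n
          ... | no _  | _     = s≤s z≤n

        -- The allowance N/q for lost indices is split evenly between indices outside `P` and
        -- indices used by the family.
        size-q : 2 * q * length chosen ≤ N → 2 * q * (∑[ i ∈ allFin N ] 𝟙 (¬? (P? i))) ≤ N → q * N ≤ q * ∣ ⟪ kept? ⟫ ∣ + N
        size-q few few′ = ≤-trans (*-monoʳ-≤ q size) (≤-trans (≤-reflexive (*-distribˡ-+ q _ _)) (+-monoʳ-≤ _ half))
          where
          half : q * (∑[ i ∈ allFin N ] 𝟙 (¬? (P? i)) + length chosen) ≤ N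
          half = *-cancelˡ-≤ 2 (≤-trans (≤-reflexive (split q _ _)) (≤-trans (+-mono-≤ few′ few) (≤-reflexive (cong (N +_) (sym (+-identityʳ N))))))
            where
            split : ∀ q x y → 2 * (q * (x + y)) ≡ 2 * q * x + 2 * q * y
            split = solve-∀

    assemble : 2 * q * (∑[ i ∈ allFin N ] 𝟙 (¬? (A₁? i))) ≤ N → 2 * q * (∑[ i ∈ allFin N ] 𝟙 (¬? (B₁? i))) ≤ N →
      2 * q * length (Family.pairs maximal-family) ≤ N → Conclusion _≈_ _∙_ a b s q
    assemble fewA fewB fewF = ⟪ SA.kept? ⟫ , ⟪ SB.kept? ⟫ , SA.size-q fewF fewA , SB.size-q fewF fewB ,
      s + length chosen ,
      ≤-trans (≤-reflexive (*-distribˡ-+ q s _)) (+-monoʳ-≤ (q * s) (≤-trans (*-monoˡ-≤ (length chosen) (m≤m+n q (q + 0))) fewF)) ,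
      [ proj₁ hc , representative ]′ ∘ splitAt s , cover
      where
      module SA = Side proj₁ A₁?
      module SB = Side proj₂ B₁?
      representative : Fin (length chosen) → G
      representative k = let φ = lookup chosen k in a (proj₁ φ) ∙ b (proj₂ φ)
      cover : ∀ x → Sumset _≈_ _∙_ a b ⟪ SA.kept? ⟫ ⟪ SB.kept? ⟫ x → ∃ λ k → x ≈ [ proj₁ hc , representative ]′ (splitAt s k)
      cover x (i , j , i∈ , j∈ , x≈) with hit? (i , j)
      ... | yes (i′ , j′ , j′∈ , r) with proj₂ (proj₂ (proj₂ hc)) (a i′ ∙ b j′) (i′ , j′ , j′∈ , ≈-refl)
      ...   | k , e = k ↑ˡ length chosen , subst (λ w → x ≈ [ proj₁ hc , representative ]′ w) (sym (splitAt-↑ˡ s k (length chosen)))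
                (≈-trans x≈ (≈-trans (~-sound r) e))
      cover x (i , j , i∈ , j∈ , x≈) | no ¬hit
        with ∈-⟪⟫ SA.kept? i∈ | ∈-⟪⟫ SB.kept? j∈
      ... | Ai , ¬usedA | Bj , ¬usedB
        with covers (∈-filter⁺ ok? (∈-cartesianProduct⁺ (∈-allFin i) (∈-allFin j)) (Ai , Bj , ¬hit))
      ... | φ , φ∈ , inj₁ e        = ⊥-elim (¬usedA (lose φ∈ e))
      ... | φ , φ∈ , inj₂ (inj₁ e) = ⊥-elim (¬usedB (lose φ∈ e))
      ... | φ , φ∈ , inj₂ (inj₂ r) = s ↑ʳ Any.index φ∈ ,
            subst (λ w → x ≈ [ proj₁ hc , representative ]′ w) (sym (splitAt-↑ʳ s (length chosen) (Any.index φ∈)))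
              (≈-trans x≈ (subst (λ ψ → (a i ∙ b j) ≈ (a (proj₁ ψ) ∙ b (proj₂ ψ))) (AnyP.lookup-index φ∈) (~-sound r)))

  -- Arbitrary abelian groups

  module Shadow {n : ℕ} {I : Set} (L : List I) (uniq : Unique L) (mx my mz : I → Fin n)
    (xy-inj : ∀ {i j} → i ∈ L → j ∈ L → mx i ≡ mx j → my i ≡ my j → i ≡ j)
    (xz-inj : ∀ {i j} → i ∈ L → j ∈ L → mx i ≡ mx j → mz i ≡ mz j → i ≡ j)
    (yz-inj : ∀ {i j} → i ∈ L → j ∈ L → my i ≡ my j → mz i ≡ mz j → i ≡ j) where

    -- Only edges of members enter the graph, but a triangle may take its three edges from three
    -- different members; those mixed triangles are what has to be bounded.
    Edge : (p q : I → Fin n) → Fin n → Fin n → Set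
    Edge p q x y = Any (λ i → p i ≡ x × q i ≡ y) L

    edge? : ∀ p q x y → Dec (Edge p q x y)
    edge? p q x y = Any.any? (λ i → (p i ≟ᶠ x) ×-dec (q i ≟ᶠ y)) L

    Triangle : Fin n × Fin n × Fin n → Set
    Triangle (z , x , y) = Edge mx mz x z × Edge my mz y z × Edge mx my x y

    triangle? : ∀ t → Dec (Triangle t)
    triangle? (z , x , y) = edge? mx mz x z ×-dec edge? my mz y z ×-dec edge? mx my x y

    triples : List (Fin n × Fin n × Fin n)
    triples = cartesianProduct (allFin n) (cartesianProduct (allFin n) (allFin n))

    private
      f u v : Fin n → Fin n → Bool
      f x y = does (edge? mx my x y)
      u x z = does (edge? mx mz x z)
      v y z = does (edge? my mz y z)

      M : Matching f u v I
      M = record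
        { members = L ; unique = uniq ; mx = mx ; my = my ; mz = mz
        ; on-f = λ i∈ → dec-true (edge? mx my _ _) (lose i∈ (refl , refl))
        ; on-u = λ i∈ → dec-true (edge? mx mz _ _) (lose i∈ (refl , refl))
        ; on-v = λ i∈ → dec-true (edge? my mz _ _) (lose i∈ (refl , refl))
        ; xy-inj = xy-inj ; xz-inj = xz-inj ; yz-inj = yz-inj }

      ι-∧ : ∀ a b c → ι (a ∧ b ∧ c) ≡ ι a * ι b * ι c
      ι-∧ true  true  c = sym (+-identityʳ (ι c))
      ι-∧ true  false c = refl
      ι-∧ false b     c = refl

    many-triangles : ∀ k → 1 ≤ n → n * n ≤ k * length L → ¬ proj₁ (triangle-removal k) * # triangle? triples ≤ n * (n * n)
    many-triangles k 1≤n large few = proj₂ (triangle-removal k) f u v M 1≤n large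
      (subst (λ t → proj₁ (triangle-removal k) * t ≤ n * (n * n)) count few)
      where
      count : # triangle? triples ≡ ∑[ z ∈ allFin n ] ∑₂ (λ x y → ι (u x z) * ι (v y z) * ι (f x y))
      count = trans (∑-cartesianProduct (allFin n) _ _) (∑-cong (allFin n) (λ z →
        trans (∑-cartesianProduct (allFin n) (allFin n) _) (∑₂-cong {n} {n} (λ x y → ι-∧ (u x z) (v y z) (f x y)))))

  module GroupSums {c ℓ} (𝔾 : AbelianGroup c ℓ) where
    open AbelianGroup 𝔾 renaming (refl to ≈-refl; sym to ≈-sym; trans to ≈-trans; setoid to 𝔾-setoid)
    open import Relation.Binary.Reasoning.Setoid 𝔾-setoid

    diff-cancel : ∀ a x y → ((a ∙ x) ∙ (a ∙ y) ⁻¹) ≈ (x ∙ y ⁻¹)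
    diff-cancel a x y = begin
      (a ∙ x) ∙ (a ∙ y) ⁻¹        ≈⟨ ∙-cong (comm a x) (≈-trans (⁻¹-cong (comm a y)) (⁻¹-anti-homo-∙ y a)) ⟩
      (x ∙ a) ∙ (a ⁻¹ ∙ y ⁻¹)     ≈⟨ assoc x a _ ⟩
      x ∙ (a ∙ (a ⁻¹ ∙ y ⁻¹))     ≈⟨ ∙-congˡ (≈-trans (≈-sym (assoc a _ _)) (≈-trans (∙-congʳ (inverseʳ a)) (identityˡ _))) ⟩
      x ∙ y ⁻¹                    ∎
      where open import Algebra.Properties.Group group using (⁻¹-anti-homo-∙)

    through : ∀ a x y → ((a ∙ y) ∙ (x ∙ y ⁻¹)) ≈ (a ∙ x)
    through a x y = begin
      (a ∙ y) ∙ (x ∙ y ⁻¹)        ≈⟨ ∙-congˡ (comm x _) ⟩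
      (a ∙ y) ∙ (y ⁻¹ ∙ x)        ≈⟨ assoc a y _ ⟩
      a ∙ (y ∙ (y ⁻¹ ∙ x))        ≈⟨ ∙-congˡ (≈-trans (≈-sym (assoc y _ _)) (≈-trans (∙-congʳ (inverseʳ y)) (identityˡ x))) ⟩
      a ∙ x                       ∎

    cancelˡ : ∀ a x y → (a ∙ x) ≈ (a ∙ y) → x ≈ y
    cancelˡ a x y = ∙-cancelˡ a x y
      where open import Algebra.Properties.Group group using (∙-cancelˡ)

    cancelʳ : ∀ a x y → (x ∙ a) ≈ (y ∙ a) → x ≈ y
    cancelʳ a x y = ∙-cancelʳ a x y
      where open import Algebra.Properties.Group group using (∙-cancelʳ)

  -- Dense rows and columns of Γ, and the graph of sums and differences

  module Dense {N : ℕ} (Γ : Rel₂ N) where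

    -- With at most a quarter missing, two columns have at least N/2 common neighbours, and a dense
    -- row has at least N/2 neighbours among dense columns.
    A₁ B₁ : Fin N → Set
    A₁ i = 4 * ∑ (allFin N) (non Γ i) ≤ N
    B₁ j = 4 * (∑[ i ∈ allFin N ] non Γ i j) ≤ N

    A₁? : ∀ i → Dec (A₁ i)
    A₁? i = 4 * ∑ (allFin N) (non Γ i) ≤? N

    B₁? : ∀ j → Dec (B₁ j)
    B₁? j = 4 * (∑[ i ∈ allFin N ] non Γ i j) ≤? N

    -- Markov's inequality; the case of empty `N` is separated because the estimate is divided by
    -- `N`.
    few-bad : (w : Fin N → ℕ) (m D : ℕ) → m * 4 ≤ D → D * ∑ (allFin N) w ≤ N * N →
      m * (∑[ i ∈ allFin N ] 𝟙 (¬? (4 * w i ≤? N))) ≤ N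
    few-bad w m D 4m≤D h with 1 ≤? N
    ... | no N≡0 = ≤-trans (≤-reflexive (trans (cong (m *_) none) (*-zeroʳ m))) z≤n
      where
      none : ∑[ i ∈ allFin N ] 𝟙 (¬? (4 * w i ≤? N)) ≡ 0
      none = n≤0⇒n≡0 (≤-trans (∑-mono (allFin N) (λ i → 𝟙≤1 (¬? (4 * w i ≤? N)))) (≤-reflexive
        (trans (∑-constFin N 1) (trans (*-identityʳ N) (n<1⇒n≡0 (≰⇒> N≡0))))))
    ... | yes 1≤N = *-cancelʳ-≤ _ N N {{>-nonZero 1≤N}} (begin
      m * ∑ (allFin N) (λ i → 𝟙 (¬? (4 * w i ≤? N))) * N
        ≡⟨ trans (*-assoc m _ N) (cong (m *_) (sym (∑-*ʳ (allFin N) _ N))) ⟩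
      m * ∑ (allFin N) (λ i → 𝟙 (¬? (4 * w i ≤? N)) * N)
        ≤⟨ *-monoʳ-≤ m (∑-mono (allFin N) (λ i → ≤-trans (𝟙-*≤ (¬? (4 * w i ≤? N)) (λ ¬p → <⇒≤ (≰⇒> ¬p)))
             (≤-trans (*-monoˡ-≤ (4 * w i) (𝟙≤1 (¬? (4 * w i ≤? N)))) (≤-reflexive (+-identityʳ _))))) ⟩
      m * ∑ (allFin N) (λ i → 4 * w i)
        ≡⟨ trans (cong (m *_) (∑-*ˡ (allFin N) 4 w)) (sym (*-assoc m 4 _)) ⟩
      m * 4 * ∑ (allFin N) w
        ≤⟨ *-monoˡ-≤ _ 4m≤D ⟩
      D * ∑ (allFin N) w
        ≤⟨ h ⟩
      N * N ∎)
      where open ≤-Reasoning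

    few-bad-rows : ∀ m D → m * 4 ≤ D → D * nonΓ Γ ≤ N * N → m * (∑[ i ∈ allFin N ] 𝟙 (¬? (A₁? i))) ≤ N
    few-bad-rows m D = few-bad (λ i → ∑ (allFin N) (non Γ i)) m D

    few-bad-columns : ∀ m D → m * 4 ≤ D → D * nonΓ Γ ≤ N * N → m * (∑[ j ∈ allFin N ] 𝟙 (¬? (B₁? j))) ≤ N
    few-bad-columns m D 4m≤D h = few-bad (λ j → ∑[ i ∈ allFin N ] non Γ i j) m D 4m≤D
      (subst (λ t → D * t ≤ N * N) (∑-swap (allFin N) (allFin N) (non Γ)) h)

    half : {P Q : Fin N → Set} (P? : ∀ i → Dec (P i)) (Q? : ∀ i → Dec (Q i)) →
      4 * (∑[ i ∈ allFin N ] 𝟙 (¬? (P? i))) ≤ N → 4 * (∑[ i ∈ allFin N ] 𝟙 (¬? (Q? i))) ≤ N →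
      N ≤ 2 * (∑[ i ∈ allFin N ] 𝟙 (P? i ×-dec Q? i))
    half P? Q? hp hq = *-cancelˡ-≤ 2 (linear (2 * N) (2 * (2 * t)) (2 * N) (begin
      2 * N + 2 * N         ≡⟨ four N ⟩
      4 * N                 ≤⟨ *-monoʳ-≤ 4 covered ⟩
      4 * (t + (p + r))     ≡⟨ split t p r ⟩
      4 * t + (4 * p + 4 * r) ≤⟨ +-monoʳ-≤ (4 * t) (+-mono-≤ hp hq) ⟩
      4 * t + (N + N)       ≡⟨ join t N ⟩
      2 * N + 2 * (2 * t)   ∎) refl refl)
      where
      open ≤-Reasoning
      t = ∑[ i ∈ allFin N ] 𝟙 (P? i ×-dec Q? i)
      p = ∑[ i ∈ allFin N ] 𝟙 (¬? (P? i))
      r = ∑[ i ∈ allFin N ] 𝟙 (¬? (Q? i))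
      four : ∀ N → 2 * N + 2 * N ≡ 4 * N
      four = solve-∀
      split : ∀ t p r → 4 * (t + (p + r)) ≡ 4 * t + (4 * p + 4 * r)
      split = solve-∀
      join : ∀ t N → 4 * t + (N + N) ≡ 2 * N + 2 * (2 * t)
      join = solve-∀
      pointwise : ∀ i → 1 ≤ 𝟙 (P? i ×-dec Q? i) + (𝟙 (¬? (P? i)) + 𝟙 (¬? (Q? i)))
      pointwise i with P? i | Q? i
      ... | yes _ | yes _ = s≤s z≤n
      ... | yes _ | no _  = s≤s z≤n
      ... | no _  | _     = s≤s z≤n
      covered : N ≤ t + (p + r)
      covered = ≤-trans (≤-reflexive (sym (trans (∑-constFin N 1) (*-identityʳ N))))
        (≤-trans (∑-mono (allFin N) pointwise) (≤-reflexive (trans (∑-+ (allFin N) _ _) (cong (t +_) (∑-+ (allFin N) _ _)))))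

  module SumGraph {c ℓ} (𝔾 : AbelianGroup c ℓ) {N : ℕ} (a b : Fin N → AbelianGroup.Carrier 𝔾)
    (a-inj : ∀ i j → AbelianGroup._≈_ 𝔾 (a i) (a j) → i ≡ j) (b-inj : ∀ i j → AbelianGroup._≈_ 𝔾 (b i) (b j) → i ≡ j)
    (Γ : Rel₂ N) (s : ℕ)
    (hc : HasCard (AbelianGroup._≈_ 𝔾) (AbelianGroup._∙_ 𝔾) (RestrictedSumset (AbelianGroup._≈_ 𝔾) (AbelianGroup._∙_ 𝔾) a b Γ) s) where

    open AbelianGroup 𝔾 renaming (refl to ≈-refl; sym to ≈-sym; trans to ≈-trans)
    open GroupSums 𝔾
    open Dense Γ

    private
      σ : Fin s → Carrier
      σ = proj₁ hc

      locate : ∀ i j → j ∈ˢ Γ i → ∃ λ k → (a i ∙ b j) ≈ σ k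
      locate i j p = proj₂ (proj₂ (proj₂ hc)) (a i ∙ b j) (i , j , p , ≈-refl)

    -- The sum as an index into the enumeration of S, defined on Γ only. Comparing indices is
    -- decidable, and equal indices certify equal sums.
    e : Fin N → Fin N → Maybe (Fin s)
    e i j with j ∈? Γ i
    ... | yes p = just (proj₁ (locate i j p))
    ... | no _  = nothing

    e-value : ∀ {i j k} → e i j ≡ just k → (a i ∙ b j) ≈ σ k
    e-value {i} {j} eq with j ∈? Γ i
    e-value {i} {j} refl | yes p = proj₂ (locate i j p)

    e-defined : ∀ {i j} → j ∈ˢ Γ i → ∃ λ k → e i j ≡ just k
    e-defined {i} {j} p with j ∈? Γ i
    ... | yes q = _ , refl
    ... | no ¬q = ⊥-elim (¬q p)

    e-sums : ∀ {i j i′ j′ k} → e i j ≡ just k → e i′ j′ ≡ just k → (a i ∙ b j) ≈ (a i′ ∙ b j′)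
    e-sums p q = ≈-trans (e-value p) (≈-sym (e-value q))

    e-row : ∀ {i i′ j k} → e i j ≡ just k → e i′ j ≡ just k → i ≡ i′
    e-row {i} {i′} {j} p q = a-inj i i′ (cancelʳ (b j) (a i) (a i′) (e-sums p q))

    e-column : ∀ {i j j′ k} → e i j ≡ just k → e i j′ ≡ just k → j ≡ j′
    e-column {i} {j} {j′} p q = b-inj j j′ (cancelˡ (a i) (b j) (b j′) (e-sums p q))

    _≟ᵐ_ : (x y : Maybe (Fin s)) → Dec (x ≡ y)
    _≟ᵐ_ = MaybeP.≡-dec _≟ᶠ_

    Pair : Set
    Pair = Fin N × Fin N

    -- b j - b j′ = σ k - σ k′ through a common neighbour of j and j′.
    R : Pair → Fin s × Fin s → Set
    R (j , j′) (k , k′) = ∃ λ i → e i j ≡ just k × e i j′ ≡ just k′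

    R? : ∀ p t → Dec (R p t)
    R? (j , j′) (k , k′) = any? λ i → (e i j ≟ᵐ just k) ×-dec (e i j′ ≟ᵐ just k′)

    diff : Pair → Carrier
    diff (j , j′) = b j ∙ b j′ ⁻¹

    R-diff : ∀ {p p′ t} → R p t → R p′ t → diff p ≈ diff p′
    R-diff {j , j′} {l , l′} (i , u , v) (i′ , u′ , v′) = ≈-trans (≈-sym (diff-cancel (a i) (b j) (b j′)))
      (≈-trans (∙-cong (e-sums u u′) (⁻¹-cong (e-sums v v′))) (diff-cancel (a i′) (b l) (b l′)))

    -- Two pairs conflict when some pair of elements of S represents both differences. This
    -- certifies equality of the differences, but two equal differences may share no representation.
    conf : Pair → Pair → Set
    conf p p′ = p ≡ p′ ⊎ ∃ λ k → ∃ λ k′ → R p (k , k′) × R p′ (k , k′)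

    _≟ᵖ_ : (p p′ : Pair) → Dec (p ≡ p′)
    (i , j) ≟ᵖ (i′ , j′) with i ≟ᶠ i′ | j ≟ᶠ j′
    ... | yes refl | yes refl = yes refl
    ... | no ne    | _        = no (λ { refl → ne refl })
    ... | yes _    | no ne    = no (λ { refl → ne refl })

    conf? : ∀ p p′ → Dec (conf p p′)
    conf? p p′ = (p ≟ᵖ p′) ⊎-dec any? λ k → any? λ k′ → R? p (k , k′) ×-dec R? p′ (k , k′)

    conf-sym : ∀ {p p′} → conf p p′ → conf p′ p
    conf-sym (inj₁ eq)              = inj₁ (sym eq)
    conf-sym (inj₂ (k , k′ , r , r′)) = inj₂ (k , k′ , r′ , r)

    conf-diff : ∀ {p p′} → conf p p′ → diff p ≈ diff p′
    conf-diff (inj₁ refl)             = ≈-refl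
    conf-diff (inj₂ (k , k′ , r , r′)) = R-diff r r′

    both? : ∀ (p : Pair) → Dec (B₁ (proj₁ p) × B₁ (proj₂ p))
    both? p = B₁? (proj₁ p) ×-dec B₁? (proj₂ p)

    grid : ∀ n → List (Fin n × Fin n)
    grid n = cartesianProduct (allFin n) (allFin n)

    abstract
      classes : Selection conf (filter both? (grid N))
      classes = select conf? (λ _ → inj₁ refl) conf-sym _

    open Selection classes using () renaming (chosen to reps; unique to reps-unique; ⊆-L to reps⊆; no-conf to reps-disjoint; covers to reps-cover)

    many-R : ∀ p → B₁ (proj₁ p) → B₁ (proj₂ p) → N ≤ 2 * # (R? p) (grid s)
    many-R (j , j′) Bj Bj′ = ≤-trans (half (λ i → j ∈? Γ i) (λ i → j′ ∈? Γ i) Bj Bj′)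
      (*-monoʳ-≤ 2 (#-≤-rel (λ i → (j ∈? Γ i) ×-dec (j′ ∈? Γ i)) (R? (j , j′))
        (λ i t → e i j ≡ just (proj₁ t) × e i j′ ≡ just (proj₂ t)) (allFin N) (grid s) (allFin⁺ N)
        (λ {i} _ (p , p′) → let k , u = e-defined p ; k′ , u′ = e-defined p′ in
          (k , k′) , ∈-cartesianProduct⁺ (∈-allFin k) (∈-allFin k′) , (i , u , u′) , u , u′)
        (λ _ _ (u , _) (v , _) → e-row u v)))

    -- Each representative is written in at least N/2 ways as a difference of two elements of S, and
    -- no pair of elements of S serves two representatives. So there are O(s²/N) of them, which is
    -- linear in N when s is.
    few-classes : N * length reps ≤ 2 * (s * s)
    few-classes = begin
      N * length reps                                    ≡⟨ trans (*-comm N _) (sym (∑-const reps N)) ⟩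
      ∑ reps (λ _ → N)                                   ≤⟨ ∑-mono∈ reps (λ {p} p∈ → let q = proj₂ (∈-filter⁻ both? {xs = grid N} (reps⊆ p∈)) in many-R p (proj₁ q) (proj₂ q)) ⟩
      ∑ reps (λ p → 2 * # (R? p) (grid s))               ≡⟨ trans (∑-*ˡ reps 2 _) (cong (2 *_) (∑-swap reps (grid s) (λ p t → 𝟙 (R? p t)))) ⟩
      2 * ∑ (grid s) (λ t → ∑ reps (λ p → 𝟙 (R? p t)))   ≤⟨ *-monoʳ-≤ 2 (∑≤length (grid s) (λ {t} _ → #-atMostOne (λ p → R? p t) reps reps-unique
                                                              (λ p∈ p′∈ r r′ → reps-disjoint p∈ p′∈ (inj₂ (_ , _ , r , r′))))) ⟩
      2 * length (grid s)                                ≡⟨ cong (2 *_) (trans (sym (∑-1 (grid s)))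
                                                              (trans (∑-cartesianProduct (allFin s) (allFin s) (λ _ → 1)) (trans (∑₂-const {s} {s} 1) (*-identityʳ (s * s))))) ⟩
      2 * (s * s)                                        ∎
      where open ≤-Reasoning

    module Into {n : ℕ} (1≤n : 1 ≤ n) (N≤n : N ≤ n) (s≤n : s ≤ n) (reps≤n : length reps ≤ n) where

      o : Fin n
      o = inject≤ fzero 1≤n

      cls : Fin N → Fin N → Fin n
      cls j j′ with both? (j , j′)
      ... | yes p = inject≤ (Any.index (proj₁ (proj₂ (reps-cover (∈-filter⁺ both? (∈-cartesianProduct⁺ (∈-allFin j) (∈-allFin j′)) p))))) reps≤n
      -- The default may coincide with a genuine class; `cls-diff` therefore asks for `B₁` on all
      -- four indices.
      ... | no _  = o

      cls-diff : ∀ {j j′ l l′} → B₁ j → B₁ j′ → B₁ l → B₁ l′ → cls j j′ ≡ cls l l′ → diff (j , j′) ≈ diff (l , l′)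
      cls-diff {j} {j′} {l} {l′} Bj Bj′ Bl Bl′ eq with both? (j , j′) | both? (l , l′)
      ... | no ¬p | _     = ⊥-elim (¬p (Bj , Bj′))
      ... | yes _ | no ¬p = ⊥-elim (¬p (Bl , Bl′))
      ... | yes p | yes p′
        with reps-cover (∈-filter⁺ both? (∈-cartesianProduct⁺ (∈-allFin j) (∈-allFin j′)) p)
           | reps-cover (∈-filter⁺ both? (∈-cartesianProduct⁺ (∈-allFin l) (∈-allFin l′)) p′)
      ... | r , r∈ , cf | r′ , r′∈ , cf′ = ≈-trans (conf-diff cf) (≈-trans (reflexive (cong diff same)) (≈-sym (conf-diff cf′)))
        where
        same : r ≡ r′
        same = trans (AnyP.lookup-index r∈) (trans (cong (lookup reps) (inject≤-injective reps≤n reps≤n _ _ eq)) (sym (AnyP.lookup-index r′∈)))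

      -- A certificate for a i + b j = a i′ + b j′, through a i + b β = a i′ + b β′ and b j - b β = b j′ - b β′.
      _~_ : Pair → Pair → Set
      (i , j) ~ (i′ , j′) = B₁ j × B₁ j′ × ∃ λ β → ∃ λ β′ → B₁ β × B₁ β′ ×
        (∃ λ k → e i β ≡ just k × e i′ β′ ≡ just k) × cls j β ≡ cls j′ β′

      _~?_ : ∀ φ ψ → Dec (φ ~ ψ)
      (i , j) ~? (i′ , j′) = B₁? j ×-dec B₁? j′ ×-dec any? λ β → any? λ β′ → B₁? β ×-dec B₁? β′ ×-dec
        any? (λ k → (e i β ≟ᵐ just k) ×-dec (e i′ β′ ≟ᵐ just k)) ×-dec (cls j β ≟ᶠ cls j′ β′)

      ~-sym : ∀ {φ ψ} → φ ~ ψ → ψ ~ φ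
      ~-sym (Bj , Bj′ , β , β′ , Bβ , Bβ′ , (k , u , u′) , eq) = Bj′ , Bj , β′ , β , Bβ′ , Bβ , (k , u′ , u) , sym eq

      ~-sound : ∀ {i j i′ j′} → (i , j) ~ (i′ , j′) → (a i ∙ b j) ≈ (a i′ ∙ b j′)
      ~-sound {i} {j} {i′} {j′} (Bj , Bj′ , β , β′ , Bβ , Bβ′ , (k , u , u′) , eq) =
        ≈-trans (≈-sym (through (a i) (b j) (b β)))
          (≈-trans (∙-cong (e-sums u u′) (cls-diff Bj Bβ Bj′ Bβ′ eq)) (through (a i′) (b j′) (b β′)))

      module Bound (F : Family Γ A₁ B₁ _~_) (few-B : 4 * (∑[ j ∈ allFin N ] 𝟙 (¬? (B₁? j))) ≤ N) where
        open Family F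

        good? : ∀ (t : Pair × Fin N) → Dec (proj₂ t ∈ˢ Γ (proj₁ (proj₁ t)) × B₁ (proj₂ t))
        good? ((i , j) , β) = (β ∈? Γ i) ×-dec B₁? β

        members : List (Pair × Fin N)
        members = filter good? (cartesianProduct pairs (allFin N))

        members-unique : Unique members
        members-unique = filter⁺ good? (cartesianProduct⁺ unique (allFin⁺ N))

        -- The vertices are a i + b β in S, the index β, and the class of b j - b β. The first two
        -- determine a i, the last two determine b j, and the first and third determine a i + b j.
        mx my mz : Pair × Fin N → Fin n
        mx ((i , j) , β) = maybe′ (λ k → inject≤ k s≤n) o (e i β)
        my ((i , j) , β) = inject≤ β N≤n
        mz ((i , j) , β) = cls j β

        record Member (t : Pair × Fin N) : Set where
          field
            φ∈  : proj₁ t ∈ pairs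
            Bβ  : B₁ (proj₂ t)
            k   : Fin s
            e≡  : e (proj₁ (proj₁ t)) (proj₂ t) ≡ just k
            mx≡ : mx t ≡ inject≤ k s≤n

        member : ∀ {t} → t ∈ members → Member t
        member {φ , β} t∈ = let t∈′ , β∈ , Bβ = ∈-filter⁻ good? {xs = cartesianProduct pairs (allFin N)} t∈
                                k , eq = e-defined β∈ in
          record { φ∈ = proj₁ (∈-cartesianProduct⁻ pairs (allFin N) t∈′) ; Bβ = Bβ ; k = k ; e≡ = eq
                 ; mx≡ = cong (maybe′ (λ k → inject≤ k s≤n) o) eq }

        same-e : ∀ {t t′} (m : Member t) (m′ : Member t′) → mx t ≡ mx t′ → e (proj₁ (proj₁ t′)) (proj₂ t′) ≡ just (Member.k m)
        same-e m m′ eq = trans (Member.e≡ m′) (cong just (sym (inject≤-injective s≤n s≤n _ _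
          (trans (sym (Member.mx≡ m)) (trans eq (Member.mx≡ m′))))))

        related : ∀ {t t′} (m : Member t) (m′ : Member t′) {j} → B₁ j → mx t ≡ mx t′ → cls j (proj₂ t) ≡ mz t′ →
          proj₁ t′ ~ (proj₁ (proj₁ t) , j)
        related {t} {t′} m m′ {j} Bj eqx eqz = in-B₁ (Member.φ∈ m′) , Bj , proj₂ t′ , proj₂ t , Member.Bβ m′ , Member.Bβ m ,
          (Member.k m , same-e m m′ eqx , Member.e≡ m) , sym eqz

        pair≡ : ∀ {t t′ : Pair × Fin N} → proj₁ t ≡ proj₁ t′ → proj₂ t ≡ proj₂ t′ → t ≡ t′
        pair≡ refl refl = refl

        xy-inj : ∀ {t t′} → t ∈ members → t′ ∈ members → mx t ≡ mx t′ → my t ≡ my t′ → t ≡ t′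
        xy-inj {t} {t′} t∈ t′∈ eqx eqy = pair≡ (inj₁ᶠ (Member.φ∈ m) (Member.φ∈ m′)
            (e-row (Member.e≡ m) (subst (λ β → e (proj₁ (proj₁ t′)) β ≡ just (Member.k m)) (sym β≡) (same-e m m′ eqx)))) β≡
          where
          m  = member t∈
          m′ = member t′∈
          β≡ = inject≤-injective N≤n N≤n (proj₂ t) (proj₂ t′) eqy

        yz-inj : ∀ {t t′} → t ∈ members → t′ ∈ members → my t ≡ my t′ → mz t ≡ mz t′ → t ≡ t′
        yz-inj {t} {t′} t∈ t′∈ eqy eqz = pair≡ (inj₂ᶠ (Member.φ∈ m) (Member.φ∈ m′) (b-inj _ _
            (cancelʳ (b (proj₂ t) ⁻¹) _ _ (≈-trans (cls-diff (in-B₁ (Member.φ∈ m)) (Member.Bβ m) (in-B₁ (Member.φ∈ m′)) (Member.Bβ m′) eqz)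
              (reflexive (cong (λ β → b (proj₂ (proj₁ t′)) ∙ b β ⁻¹) (sym β≡))))))) β≡
          where
          m  = member t∈
          m′ = member t′∈
          β≡ = inject≤-injective N≤n N≤n (proj₂ t) (proj₂ t′) eqy

        xz-inj : ∀ {t t′} → t ∈ members → t′ ∈ members → mx t ≡ mx t′ → mz t ≡ mz t′ → t ≡ t′
        xz-inj {t} {t′} t∈ t′∈ eqx eqz = pair≡ φ≡ (e-column (Member.e≡ m) (subst (λ φ → e (proj₁ φ) (proj₂ t′) ≡ just (Member.k m)) (sym φ≡) (same-e m m′ eqx)))
          where
          m  = member t∈
          m′ = member t′∈
          φ≡ = sym (inj~ (Member.φ∈ m′) (Member.φ∈ m) (related m m′ (in-B₁ (Member.φ∈ m)) eqx eqz))

        open Shadow members members-unique mx my mz xy-inj xz-inj yz-inj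

        -- Its xy-edge supplies some i₁, its yz-edge some j₃, with a common β, and its xz-edge
        -- certifies that a i₁ + b j₃ is a sum of the family. Such a sum avoids S, so (i₁, j₃) is
        -- outside Γ, and i₁, j₃, β recover the triangle.
        triangles≤ : # triangle? triples ≤ nonΓ Γ * N
        triangles≤ = ≤-trans
          (#-≤-rel triangle? (λ (w : (Fin N × Fin N) × Fin N) → ¬? (proj₂ (proj₁ w) ∈? Γ (proj₁ (proj₁ w))))
            (λ t w → let ((i , j) , β) = w in t ≡ (cls j β , maybe′ (λ k → inject≤ k s≤n) o (e i β) , inject≤ β N≤n))
            triples (cartesianProduct (grid N) (allFin N)) (cartesianProduct⁺ (allFin⁺ n) (cartesianProduct⁺ (allFin⁺ n) (allFin⁺ n)))
            (λ _ → witness) (λ _ _ p q → trans p (sym q)))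
          (≤-reflexive (trans (∑-cartesianProduct (grid N) (allFin N) (λ w → non Γ (proj₁ (proj₁ w)) (proj₂ (proj₁ w)))) (trans (∑-cong (grid N) (λ p → trans (∑-constFin N (non Γ (proj₁ p) (proj₂ p))) (*-comm N (non Γ (proj₁ p) (proj₂ p)))))
            (trans (∑-*ʳ (grid N) (λ p → non Γ (proj₁ p) (proj₂ p)) N) (cong (_* N) (∑-cartesianProduct (allFin N) (allFin N) (λ p → non Γ (proj₁ p) (proj₂ p))))))))
          where
          witness : ∀ {t} → Triangle t → ∃ λ w → w ∈ cartesianProduct (grid N) (allFin N) × ¬ proj₂ (proj₁ w) ∈ˢ Γ (proj₁ (proj₁ w)) ×
            t ≡ (cls (proj₂ (proj₁ w)) (proj₂ w) , maybe′ (λ k → inject≤ k s≤n) o (e (proj₁ (proj₁ w)) (proj₂ w)) , inject≤ (proj₂ w) N≤n)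
          witness (xz , yz , xy) with find xz | find yz | find xy
          ... | t₂ , t₂∈ , refl , refl | ((i₃ , j₃) , β₃) , t₃∈ , refl , z≡ | ((i₁ , j₁) , β₁) , t₁∈ , x≡ , y≡
            with inject≤-injective N≤n N≤n β₁ β₃ y≡
          ... | refl = ((i₁ , j₃) , β₁) , ∈-cartesianProduct⁺ (∈-cartesianProduct⁺ (∈-allFin i₁) (∈-allFin j₃)) (∈-allFin β₁) ,
                (λ j₃∈ → avoids (Member.φ∈ m₂) j₃∈ (related m₁ m₂ (in-B₁ (Member.φ∈ m₃)) x≡ z≡)) ,
                cong₂ _,_ (sym z≡) (cong (_, _) (sym x≡))
            where
            m₁ = member t₁∈
            m₂ = member t₂∈
            m₃ = member t₃∈

        many-members : (∀ {i} → A₁ i → N ≤ 2 * (∑[ β ∈ allFin N ] 𝟙 ((β ∈? Γ i) ×-dec B₁? β))) → N * length pairs ≤ 2 * length members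
        many-members h = begin
          N * length pairs         ≡⟨ trans (*-comm N _) (sym (∑-const pairs N)) ⟩
          ∑ pairs (λ _ → N)        ≤⟨ ∑-mono∈ pairs (λ φ∈ → h (in-A₁ φ∈)) ⟩
          ∑ pairs (λ φ → 2 * ∑ (allFin N) (λ β → 𝟙 (good? (φ , β))))
                                   ≡⟨ trans (∑-*ˡ pairs 2 _) (cong (2 *_) (sym (∑-cartesianProduct pairs (allFin N) (λ t → 𝟙 (good? t))))) ⟩
          2 * # good? (cartesianProduct pairs (allFin N)) ≡⟨ cong (2 *_) (sym (length-filter-# good? (cartesianProduct pairs (allFin N)))) ⟩
          2 * length members       ∎
          where open ≤-Reasoning

        -- More than N/(2q) pairs would give at least N²/(4q) edge-disjoint triangles, which is
        -- n²/(4 q c²) as n = c N; yet there are at most N · nonΓ triangles, hence at most N³/D.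
        family-small : ∀ q c D → n ≡ c * N → 1 ≤ N → proj₁ (triangle-removal (4 * q * (c * c))) ≤ D → D * nonΓ Γ ≤ N * N →
          2 * q * length pairs ≤ N
        family-small q c D refl 1≤N D≥ few with 2 * q * length pairs ≤? N
        ... | yes p = p
        ... | no ¬p = ⊥-elim (many-triangles (4 * q * (c * c)) 1≤n large (begin
            proj₁ (triangle-removal (4 * q * (c * c))) * # triangle? triples  ≤⟨ *-mono-≤ D≥ triangles≤ ⟩
            D * (nonΓ Γ * N)                   ≡⟨ sym (*-assoc D _ N) ⟩
            D * nonΓ Γ * N                     ≤⟨ *-monoˡ-≤ N few ⟩
            N * N * N                          ≤⟨ *-mono-≤ (*-mono-≤ N≤n N≤n) N≤n ⟩
            n * n * n                          ≡⟨ *-assoc n n n ⟩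
            n * (n * n)                        ∎))
          where
          open ≤-Reasoning
          large : n * n ≤ 4 * q * (c * c) * length members
          large = begin
            c * N * (c * N)                             ≡⟨ shuffle c N N ⟩
            c * c * (N * N)                             ≤⟨ *-monoʳ-≤ (c * c) (*-monoʳ-≤ N (<⇒≤ (≰⇒> ¬p))) ⟩
            c * c * (N * (2 * q * length pairs))        ≡⟨ shuffle′ c N q (length pairs) ⟩
            c * c * (2 * q) * (N * length pairs)        ≤⟨ *-monoʳ-≤ (c * c * (2 * q)) (many-members (λ {i} Ai → half (λ β → β ∈? Γ i) B₁? Ai few-B)) ⟩
            c * c * (2 * q) * (2 * length members)      ≡⟨ shuffle″ c q (length members) ⟩
            4 * q * (c * c) * length members            ∎
            where
            shuffle : ∀ c N M → c * N * (c * M) ≡ c * c * (N * M)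
            shuffle = solve-∀
            shuffle′ : ∀ c N q p → c * c * (N * (2 * q * p)) ≡ c * c * (2 * q) * (N * p)
            shuffle′ = solve-∀
            shuffle″ : ∀ c q m → c * c * (2 * q) * (2 * m) ≡ 4 * q * (c * c) * m
            shuffle″ = solve-∀

  worksNat-general : ∀ {c ℓ} q → ∃ λ D → 1 ≤ D × ((𝔾 : AbelianGroup c ℓ) → WorksNat (AbelianGroup._≈_ 𝔾) (AbelianGroup._∙_ 𝔾) q D)
  worksNat-general {c} {ℓ} q = D , ≤-trans (s≤s z≤n) (m≤n+m 16 (D₀ + 8 * q)) , works
    where
    c₀ D₀ D : ℕ
    -- Room for the three vertex classes: 2 q² N representatives of differences, q N elements of S,
    -- and N indices. In `D`, the term 8 q controls the sparse rows and columns at the allowance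
    -- N/(2q), and 16 keeps three quarters of the columns dense.
    c₀ = 2 * q * q + q + 1
    D₀ = proj₁ (triangle-removal (4 * q * (c₀ * c₀)))
    D  = D₀ + 8 * q + 16
    works : (𝔾 : AbelianGroup c ℓ) → WorksNat (AbelianGroup._≈_ 𝔾) (AbelianGroup._∙_ 𝔾) q D
    works 𝔾 zero    a b a-inj b-inj Γ s hc dense s≤ = Vec.[] , Vec.[] , ≤-trans (≤-reflexive (*-zeroʳ q)) z≤n , ≤-trans (≤-reflexive (*-zeroʳ q)) z≤n ,
      0 , ≤-trans (≤-reflexive (*-zeroʳ q)) z≤n , (λ ()) , (λ { x (() , _) })
    works 𝔾 N@(suc _) a b a-inj b-inj Γ s hc dense s≤ =
      assemble _≈_ _∙_ isEquivalence a b Γ s q hc A₁? B₁? G._~?_ (λ {φ} {ψ} → G.~-sym {φ} {ψ}) (λ {i} {j} {i′} {j′} → G.~-sound {i} {j} {i′} {j′})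
        (few-bad-rows (2 * q) D 8q≤D few) (few-bad-columns (2 * q) D 8q≤D few)
        (G.Bound.family-small (maximal-family _≈_ _∙_ isEquivalence a b Γ s q hc A₁? B₁? G._~?_ (λ {φ} {ψ} → G.~-sym {φ} {ψ}) (λ {i} {j} {i′} {j′} → G.~-sound {i} {j} {i′} {j′}))
          (few-bad-columns 4 D (m≤n+m 16 (D₀ + 8 * q)) few) q c₀ D refl (s≤s z≤n)
          (≤-trans (m≤m+n D₀ (8 * q)) (m≤m+n _ 16)) few)
      where
      open AbelianGroup 𝔾 using (_≈_; _∙_; isEquivalence)
      open Dense Γ
      open SumGraph 𝔾 a b a-inj b-inj Γ s hc
      few : D * nonΓ Γ ≤ N * N
      few = few-non Γ D dense
      8q≤D : 2 * q * 4 ≤ D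
      8q≤D = ≤-trans (≤-reflexive (eight q)) (≤-trans (m≤n+m (8 * q) D₀) (m≤m+n _ 16))
        where
        eight : ∀ q → 2 * q * 4 ≡ 8 * q
        eight = solve-∀
      1≤c₀ : 1 ≤ c₀
      1≤c₀ = m≤n+m 1 (2 * q * q + q)
      N≤n : N ≤ c₀ * N
      N≤n = ≤-trans (≤-reflexive (sym (*-identityˡ N))) (*-monoˡ-≤ N 1≤c₀)
      s≤n : s ≤ c₀ * N
      s≤n = ≤-trans s≤ (*-monoˡ-≤ N (≤-trans (m≤n+m q (2 * q * q)) (m≤m+n _ 1)))
      reps≤n : length (Selection.chosen classes) ≤ c₀ * N
      reps≤n = *-cancelˡ-≤ N (≤-trans few-classes (≤-trans (*-monoʳ-≤ 2 (*-mono-≤ s≤ s≤)) (≤-trans (≤-reflexive (shuffle q N))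
        (*-monoʳ-≤ N (*-monoˡ-≤ N (≤-trans (m≤m+n (2 * q * q) q) (m≤m+n _ 1)))))))
        where
        shuffle : ∀ q N → 2 * (q * N * (q * N)) ≡ N * (2 * q * q * N)
        shuffle = solve-∀
      module G = Into (≤-trans (s≤s z≤n) N≤n) N≤n s≤n reps≤n

  -- Linear algebra modulo a prime

  ∑ᶻ : ∀ {a} {A : Set a} → List A → (A → ℤ) → ℤ
  ∑ᶻ []      f = 0ℤ
  ∑ᶻ (x ∷ L) f = f x +ᶻ ∑ᶻ L f

  infixr 6.5 ∑ᶻ
  syntax ∑ᶻ L (λ x → e) = ∑ᶻ[ x ∈ L ] e

  module _ {a} {A : Set a} where

    ∑ᶻ-cong : (L : List A) {f g : A → ℤ} → (∀ x → f x ≡ g x) → ∑ᶻ L f ≡ ∑ᶻ L g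
    ∑ᶻ-cong []      h = refl
    ∑ᶻ-cong (x ∷ L) h = cong₂ _+ᶻ_ (h x) (∑ᶻ-cong L h)

    ∑ᶻ-+ : (L : List A) (f g : A → ℤ) → ∑ᶻ[ x ∈ L ] (f x +ᶻ g x) ≡ ∑ᶻ L f +ᶻ ∑ᶻ L g
    ∑ᶻ-+ []      f g = refl
    ∑ᶻ-+ (x ∷ L) f g = trans (cong (f x +ᶻ g x +ᶻ_) (∑ᶻ-+ L f g)) (mid (f x) (g x) (∑ᶻ L f) (∑ᶻ L g))
      where
      mid : ∀ p q r s → p +ᶻ q +ᶻ (r +ᶻ s) ≡ p +ᶻ r +ᶻ (q +ᶻ s)
      mid = solve-∀ᶻ

    ∑ᶻ-*ˡ : (L : List A) (c : ℤ) (f : A → ℤ) → ∑ᶻ[ x ∈ L ] c *ᶻ f x ≡ c *ᶻ ∑ᶻ L f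
    ∑ᶻ-*ˡ []      c f = sym (ℤP.*-zeroʳ c)
    ∑ᶻ-*ˡ (x ∷ L) c f = trans (cong (c *ᶻ f x +ᶻ_) (∑ᶻ-*ˡ L c f)) (sym (ℤP.*-distribˡ-+ c (f x) _))

    ∑ᶻ-*ʳ : (L : List A) (f : A → ℤ) (c : ℤ) → ∑ᶻ[ x ∈ L ] f x *ᶻ c ≡ ∑ᶻ L f *ᶻ c
    ∑ᶻ-*ʳ L f c = trans (∑ᶻ-cong L (λ x → ℤP.*-comm (f x) c)) (trans (∑ᶻ-*ˡ L c f) (ℤP.*-comm c _))

    ∑ᶻ-0 : (L : List A) → ∑ᶻ[ x ∈ L ] 0ℤ ≡ 0ℤ
    ∑ᶻ-0 []      = refl
    ∑ᶻ-0 (x ∷ L) = trans (ℤP.+-identityˡ _) (∑ᶻ-0 L)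

    ∑ᶻ-++ : (L M : List A) (f : A → ℤ) → ∑ᶻ (L ++ M) f ≡ ∑ᶻ L f +ᶻ ∑ᶻ M f
    ∑ᶻ-++ []      M f = sym (ℤP.+-identityˡ _)
    ∑ᶻ-++ (x ∷ L) M f = trans (cong (f x +ᶻ_) (∑ᶻ-++ L M f)) (sym (ℤP.+-assoc (f x) _ _))

  ∑ᶻ-swap : ∀ {a b} {A : Set a} {B : Set b} (L : List A) (M : List B) (f : A → B → ℤ) →
    ∑ᶻ[ x ∈ L ] ∑ᶻ[ y ∈ M ] f x y ≡ ∑ᶻ[ y ∈ M ] ∑ᶻ[ x ∈ L ] f x y
  ∑ᶻ-swap []      M f = sym (∑ᶻ-0 M)
  ∑ᶻ-swap (x ∷ L) M f = trans (cong (∑ᶻ M (f x) +ᶻ_) (∑ᶻ-swap L M f)) (sym (∑ᶻ-+ M (f x) (λ y → ∑ᶻ[ x ∈ L ] f x y)))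

  ιᶻ : Bool → ℤ
  ιᶻ true  = 1ℤ
  ιᶻ false = 0ℤ

  ∑ᶻ-map : ∀ {a b} {A : Set a} {B : Set b} (g : A → B) (L : List A) (f : B → ℤ) → ∑ᶻ (map g L) f ≡ ∑ᶻ L (f ∘ g)
  ∑ᶻ-map g []      f = refl
  ∑ᶻ-map g (x ∷ L) f = cong (f (g x) +ᶻ_) (∑ᶻ-map g L f)

  ∑ᶻ-δ : ∀ {a} {A : Set a} (_≟_ : (x y : A) → Dec (x ≡ y)) (L : List A) (w : A → ℤ) {x : A} → Unique L → x ∈ L →
    ∑ᶻ[ y ∈ L ] ιᶻ (does (x ≟ y)) *ᶻ w y ≡ w x
  ∑ᶻ-δ _≟_ (x ∷ L) w (x∉ ∷ _) (here refl) = trans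
    (cong₂ _+ᶻ_ (trans (cong (λ b → ιᶻ b *ᶻ w x) (dec-true (x ≟ x) refl)) (ℤP.*-identityˡ (w x))) (vanish L x∉)) (ℤP.+-identityʳ (w x))
    where
    vanish : ∀ M → All (x ≢_) M → ∑ᶻ[ y ∈ M ] ιᶻ (does (x ≟ y)) *ᶻ w y ≡ 0ℤ
    vanish []      []         = refl
    vanish (y ∷ M) (ne ∷ nes) = trans (cong₂ _+ᶻ_ (cong (λ b → ιᶻ b *ᶻ w y) (dec-false (x ≟ y) ne)) (vanish M nes)) refl
  ∑ᶻ-δ _≟_ (y ∷ L) w {x} (y∉ ∷ u) (there p) = trans
    (cong₂ _+ᶻ_ (cong (λ b → ιᶻ b *ᶻ w y) (dec-false (x ≟ y) (λ { refl → All.lookup y∉ p refl }))) (∑ᶻ-δ _≟_ L w u p)) (ℤP.+-identityˡ (w x))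

  module Mod (p : ℕ) (p-prime : Prime p) where

    -- Elements of the field are integers, and `D` says that one of them vanishes modulo p;
    -- polynomial identities can then be proved over the integers.
    D : ℤ → Set
    D x = pos p ∣ᶻ x

    D? : ∀ x → Dec (D x)
    D? x = pos p ∣ᶻ? x

    D-0 : D 0ℤ
    D-0 = ∣ᵤ⇒∣ (divides 0 refl)

    D-* : ∀ x y → D (x *ᶻ y) → D x ⊎ D y
    D-* x y h with euclidsLemma ∣ x ∣ᶻ ∣ y ∣ᶻ p-prime (subst (p ∣_) (ℤP.abs-* x y) (∣⇒∣ᵤ h))
    ... | inj₁ q = inj₁ (∣ᵤ⇒∣ q)
    ... | inj₂ q = inj₂ (∣ᵤ⇒∣ q)

    1<p : 1 < p
    1<p = nonTrivial⇒n>1 p {{prime⇒nonTrivial p-prime}}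
      where open import Data.Nat using (nonTrivial⇒n>1)

    ¬D-small : ∀ {n} → 0 < n → n < p → ¬ D (pos n)
    ¬D-small 0<n n<p h = >⇒∤ {{>-nonZero 0<n}} n<p (∣⇒∣ᵤ h)

    D-∑ : ∀ {a} {A : Set a} (L : List A) {f : A → ℤ} → (∀ {x} → x ∈ L → D (f x)) → D (∑ᶻ L f)
    D-∑ []      h = D-0
    D-∑ (x ∷ L) h = ∣m∣n⇒∣m+n (h (here refl)) (D-∑ L (h ∘ there))

    -- Fraction-free Gaussian elimination.
    kernel : ∀ M R (fs : List (Fin M → ℤ)) → length fs ≤ R → ∃ λ (h : Fin M → ℤ) →
      (∀ {f} → f ∈ fs → D (∑ᶻ[ i ∈ allFin M ] f i *ᶻ h i)) × # (λ i → D? (h i)) (allFin M) ≤ R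
    kernel M R [] _ = (λ _ → 1ℤ) , (λ ()) , ≤-trans (≤-reflexive (∑-0 (allFin M) (λ _ → 𝟙-no (D? 1ℤ) (¬D-small (s≤s z≤n) 1<p)))) z≤n
    kernel M (suc R) (f ∷ fs) (s≤s len) with any? (λ i → ¬? (D? (f i)))
    ... | no ¬∃ = let h , zero-on , few = kernel M R fs len in h ,
          (λ { (here refl) → D-∑ (allFin M) (λ {i} _ → ∣m⇒∣m*n (h i) (decidable-stable (D? (f i)) (λ n → ¬∃ (i , n)))) ; (there q) → zero-on q }) ,
          ≤-trans few (n≤1+n _)
    ... | yes (i₀ , ¬D₀) with kernel M R (map (λ g i → f i₀ *ᶻ g i -ᶻ g i₀ *ᶻ f i) fs) (≤-trans (≤-reflexive (length-map _ fs)) len)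
    ...   | h′ , zero-on , few = h , zeros , count
      where
      S : (Fin M → ℤ) → ℤ
      S g = ∑ᶻ[ i ∈ allFin M ] g i *ᶻ h′ i
      δ : Fin M → ℤ
      δ i = ιᶻ (does (i₀ ≟ᶠ i))
      -- Multiplying h′ by the pivot f i₀ creates no new zeros modulo p, and the correction at i₀
      -- alone makes f vanish on h. Hence only coordinate i₀ can become an additional zero.
      h : Fin M → ℤ
      h i = f i₀ *ᶻ h′ i +ᶻ δ i *ᶻ -ᶻ S f
      value : ∀ g → ∑ᶻ[ i ∈ allFin M ] g i *ᶻ h i ≡ f i₀ *ᶻ S g +ᶻ g i₀ *ᶻ -ᶻ S f
      value g = trans (∑ᶻ-cong (allFin M) (λ i → rearrange (g i) (f i₀) (h′ i) (δ i) (-ᶻ S f)))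
        (trans (∑ᶻ-+ (allFin M) _ _) (cong₂ _+ᶻ_ (∑ᶻ-*ˡ (allFin M) (f i₀) _)
          (∑ᶻ-δ _≟ᶠ_ (allFin M) (λ i → g i *ᶻ -ᶻ S f) (allFin⁺ M) (∈-allFin i₀))))
        where
        rearrange : ∀ g f h d s → g *ᶻ (f *ᶻ h +ᶻ d *ᶻ s) ≡ f *ᶻ (g *ᶻ h) +ᶻ d *ᶻ (g *ᶻ s)
        rearrange = solve-∀ᶻ
      value′ : ∀ g → S (λ i → f i₀ *ᶻ g i -ᶻ g i₀ *ᶻ f i) ≡ f i₀ *ᶻ S g +ᶻ g i₀ *ᶻ -ᶻ S f
      value′ g = trans (∑ᶻ-cong (allFin M) (λ i → rearrange (f i₀) (g i) (g i₀) (f i) (h′ i)))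
        (trans (∑ᶻ-+ (allFin M) _ _) (trans (cong₂ _+ᶻ_ (∑ᶻ-*ˡ (allFin M) (f i₀) _) (∑ᶻ-*ˡ (allFin M) (-ᶻ g i₀) _)) (sign (f i₀) (S g) (g i₀) (S f))))
        where
        rearrange : ∀ a g b f h → (a *ᶻ g -ᶻ b *ᶻ f) *ᶻ h ≡ a *ᶻ (g *ᶻ h) +ᶻ (-ᶻ b) *ᶻ (f *ᶻ h)
        rearrange = solve-∀ᶻ
        sign : ∀ a s b t → a *ᶻ s +ᶻ (-ᶻ b) *ᶻ t ≡ a *ᶻ s +ᶻ b *ᶻ -ᶻ t
        sign = solve-∀ᶻ
      zeros : ∀ {g} → g ∈ f ∷ fs → D (∑ᶻ[ i ∈ allFin M ] g i *ᶻ h i)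
      zeros {g} (here refl) = subst D (sym (trans (value f) (cancel (f i₀) (S f)))) D-0
        where
        cancel : ∀ a s → a *ᶻ s +ᶻ a *ᶻ -ᶻ s ≡ 0ℤ
        cancel = solve-∀ᶻ
      zeros {g} (there q)   = subst D (trans (value′ g) (sym (value g))) (zero-on (∈-map⁺ _ q))
      count : # (λ i → D? (h i)) (allFin M) ≤ suc R
      count = ≤-trans (∑-mono (allFin M) pointwise) (≤-trans (≤-reflexive (trans (∑-+ (allFin M) _ _)
        (cong (_+ ∑ (allFin M) (λ i → 𝟙 (D? (h′ i)))) (trans (∑-cong (allFin M) (λ i → sym (*-identityʳ (𝟙 (i₀ ≟ᶠ i))))) (∑-δFin (λ _ → 1) i₀)))))
        (s≤s few))
        where
        pointwise : ∀ i → 𝟙 (D? (h i)) ≤ 𝟙 (i₀ ≟ᶠ i) + 𝟙 (D? (h′ i))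
        pointwise i = 𝟙-≤ (D? (h i)) (λ d → by (i₀ ≟ᶠ i) d)
          where
          drop : ∀ a s → a +ᶻ 0ℤ *ᶻ s ≡ a
          drop = solve-∀ᶻ
          by : Dec (i₀ ≡ i) → D (h i) → 1 ≤ 𝟙 (i₀ ≟ᶠ i) + 𝟙 (D? (h′ i))
          by (yes e) d = ≤-trans (≤-reflexive (sym (𝟙-yes (i₀ ≟ᶠ i) e))) (m≤m+n _ _)
          by (no ne) d with D-* (f i₀) (h′ i) (subst D (trans (cong (λ b → f i₀ *ᶻ h′ i +ᶻ ιᶻ b *ᶻ -ᶻ S f) (dec-false (i₀ ≟ᶠ i) ne)) (drop (f i₀ *ᶻ h′ i) (-ᶻ S f))) d)
          ... | inj₁ d₀ = ⊥-elim (¬D₀ d₀)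
          ... | inj₂ d′ = ≤-trans (≤-reflexive (sym (𝟙-yes (D? (h′ i)) d′))) (m≤n+m _ (𝟙 (i₀ ≟ᶠ i)))

  -- The slice rank bound for tri-coloured sum-free sets

  -- Each term of the tensor is a slice in (at least) one of the three directions, along a key from Low.
  module Slices (p : ℕ) (p-prime : Prime p) {w : ℕ} {V Tm : Set} (_≟_ : (u v : V) → Dec (u ≡ v))
    (Low : List V) (Low-unique : Unique Low) (α β γ : V → Fin w → ℤ) (terms : List Tm) (c : Tm → ℤ) (e f g : Tm → V)
    (low : ∀ {t} → t ∈ terms → e t ∈ Low ⊎ f t ∈ Low ⊎ g t ∈ Low) where

    open Mod p p-prime

    tensor : Fin w → Fin w → Fin w → ℤ
    tensor i j k = ∑ᶻ[ t ∈ terms ] c t *ᶻ (α (e t) i *ᶻ β (f t) j *ᶻ γ (g t) k)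

    module _ (diagonal : ∀ i → ¬ D (tensor i i i)) (off-diagonal : ∀ i j k → ¬ (i ≡ j × i ≡ k) → D (tensor i j k)) where

      private
        R : ℕ
        R = length Low

        L : List (Fin w)
        L = allFin w

        abstract
          kerH : ∃ λ (h : Fin w → ℤ) → (∀ {φ} → φ ∈ map γ Low → D (∑ᶻ[ k ∈ L ] φ k *ᶻ h k)) × # (λ k → D? (h k)) L ≤ R
          kerH = kernel w R (map γ Low) (≤-reflexive (length-map γ Low))

        h : Fin w → ℤ
        h = proj₁ kerH

        H : Tm → ℤ
        H t = ∑ᶻ[ k ∈ L ] γ (g t) k *ᶻ h k

        -- The coefficient of β v after contracting the third direction with `h`. If `u` annihilates
        -- it, all terms with second key v disappear together.
        contribution : V → Fin w → ℤ
        contribution v i = ∑ᶻ[ t ∈ terms ] ιᶻ (does (f t ≟ v)) *ᶻ (c t *ᶻ (α (e t) i *ᶻ H t))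

        abstract
          kerU : ∃ λ (u : Fin w → ℤ) → (∀ {φ} → φ ∈ map α Low ++ map contribution Low → D (∑ᶻ[ i ∈ L ] φ i *ᶻ u i)) × # (λ i → D? (u i)) L ≤ R + R
          kerU = kernel w (R + R) (map α Low ++ map contribution Low)
            (≤-reflexive (trans (length-++ (map α Low)) (cong₂ _+_ (length-map α Low) (length-map contribution Low))))

        u : Fin w → ℤ
        u = proj₁ kerU

        U W : Tm → ℤ
        U t = ∑ᶻ[ i ∈ L ] α (e t) i *ᶻ u i
        W t = c t *ᶻ (U t *ᶻ H t)

        contracted : Fin w → ℤ
        contracted j = ∑ᶻ[ i ∈ L ] ∑ᶻ[ k ∈ L ] u i *ᶻ h k *ᶻ tensor i j k

        contracted-terms : ∀ j → contracted j ≡ ∑ᶻ[ t ∈ terms ] β (f t) j *ᶻ W t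
        contracted-terms j = begin
          contracted j
            ≡⟨ ∑ᶻ-cong L (λ i → trans (∑ᶻ-cong L (λ k → sym (∑ᶻ-*ˡ terms (u i *ᶻ h k) (λ t → c t *ᶻ (α (e t) i *ᶻ β (f t) j *ᶻ γ (g t) k)))))
                 (∑ᶻ-swap L terms (λ k t → X i k t))) ⟩
          ∑ᶻ L (λ i → ∑ᶻ terms (λ t → ∑ᶻ L (λ k → X i k t)))
            ≡⟨ ∑ᶻ-swap L terms (λ i t → ∑ᶻ L (λ k → X i k t)) ⟩
          ∑ᶻ terms (λ t → ∑ᶻ L (λ i → ∑ᶻ L (λ k → X i k t)))
            ≡⟨ ∑ᶻ-cong terms per-term ⟩
          ∑ᶻ terms (λ t → β (f t) j *ᶻ W t) ∎
          where
          open ≡-Reasoning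
          X : Fin w → Fin w → Tm → ℤ
          X i k t = u i *ᶻ h k *ᶻ (c t *ᶻ (α (e t) i *ᶻ β (f t) j *ᶻ γ (g t) k))
          split : ∀ u h c a b g → u *ᶻ h *ᶻ (c *ᶻ (a *ᶻ b *ᶻ g)) ≡ b *ᶻ c *ᶻ (a *ᶻ u) *ᶻ (g *ᶻ h)
          split = solve-∀ᶻ
          join : ∀ b c u h → b *ᶻ c *ᶻ u *ᶻ h ≡ b *ᶻ (c *ᶻ (u *ᶻ h))
          join = solve-∀ᶻ
          inner : ∀ t i → ∑ᶻ L (λ k → X i k t) ≡ β (f t) j *ᶻ c t *ᶻ (α (e t) i *ᶻ u i) *ᶻ H t
          inner t i = trans (∑ᶻ-cong L (λ k → split (u i) (h k) (c t) (α (e t) i) (β (f t) j) (γ (g t) k)))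
            (∑ᶻ-*ˡ L (β (f t) j *ᶻ c t *ᶻ (α (e t) i *ᶻ u i)) (λ k → γ (g t) k *ᶻ h k))
          per-term : ∀ t → ∑ᶻ L (λ i → ∑ᶻ L (λ k → X i k t)) ≡ β (f t) j *ᶻ W t
          per-term t = begin
            ∑ᶻ L (λ i → ∑ᶻ L (λ k → X i k t))
              ≡⟨ ∑ᶻ-cong L (inner t) ⟩
            ∑ᶻ L (λ i → β (f t) j *ᶻ c t *ᶻ (α (e t) i *ᶻ u i) *ᶻ H t)
              ≡⟨ ∑ᶻ-*ʳ L (λ i → β (f t) j *ᶻ c t *ᶻ (α (e t) i *ᶻ u i)) (H t) ⟩
            ∑ᶻ L (λ i → β (f t) j *ᶻ c t *ᶻ (α (e t) i *ᶻ u i)) *ᶻ H t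
              ≡⟨ cong (_*ᶻ H t) (∑ᶻ-*ˡ L (β (f t) j *ᶻ c t) (λ i → α (e t) i *ᶻ u i)) ⟩
            β (f t) j *ᶻ c t *ᶻ U t *ᶻ H t
              ≡⟨ join (β (f t) j) (c t) (U t) (H t) ⟩
            β (f t) j *ᶻ W t ∎

        grouped : ∀ v → ∑ᶻ[ i ∈ L ] contribution v i *ᶻ u i ≡ ∑ᶻ[ t ∈ terms ] ιᶻ (does (f t ≟ v)) *ᶻ W t
        grouped v = begin
          ∑ᶻ L (λ i → contribution v i *ᶻ u i)
            ≡⟨ ∑ᶻ-cong L (λ i → sym (∑ᶻ-*ʳ terms (λ t → ιᶻ (does (f t ≟ v)) *ᶻ (c t *ᶻ (α (e t) i *ᶻ H t))) (u i))) ⟩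
          ∑ᶻ L (λ i → ∑ᶻ terms (λ t → X i t))
            ≡⟨ ∑ᶻ-swap L terms X ⟩
          ∑ᶻ terms (λ t → ∑ᶻ L (λ i → X i t))
            ≡⟨ ∑ᶻ-cong terms (λ t → trans (∑ᶻ-cong L (λ i → split (ιᶻ (does (f t ≟ v))) (c t) (α (e t) i) (H t) (u i)))
                 (trans (∑ᶻ-*ˡ L (ιᶻ (does (f t ≟ v)) *ᶻ (c t *ᶻ H t)) (λ i → α (e t) i *ᶻ u i)) (join (ιᶻ (does (f t ≟ v))) (c t) (H t) (U t)))) ⟩
          ∑ᶻ terms (λ t → ιᶻ (does (f t ≟ v)) *ᶻ W t) ∎
          where
          open ≡-Reasoning
          X : Fin w → Tm → ℤ
          X i t = ιᶻ (does (f t ≟ v)) *ᶻ (c t *ᶻ (α (e t) i *ᶻ H t)) *ᶻ u i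
          split : ∀ d c a h u → d *ᶻ (c *ᶻ (a *ᶻ h)) *ᶻ u ≡ d *ᶻ (c *ᶻ h) *ᶻ (a *ᶻ u)
          split = solve-∀ᶻ
          join : ∀ d c h u → d *ᶻ (c *ᶻ h) *ᶻ u ≡ d *ᶻ (c *ᶻ (u *ᶻ h))
          join = solve-∀ᶻ

        -- Some key of the term is low. If it is the first, `u` kills the term; if it is the third,
        -- `h` does.
        D-W : ∀ {t} → t ∈ terms → ¬ f t ∈ Low → D (W t)
        D-W {t} t∈ ¬f = [ (λ e∈ → ∣n⇒∣m*n (c t) (∣m⇒∣m*n (H t) (proj₁ (proj₂ kerU) (∈-++⁺ˡ (∈-map⁺ α e∈))))) ,
          [ (λ f∈ → ⊥-elim (¬f f∈)) , (λ g∈ → ∣n⇒∣m*n (c t) (∣n⇒∣m*n (U t) (proj₁ (proj₂ kerH) (∈-map⁺ γ g∈)))) ]′ ]′ (low t∈)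

        D-contracted : ∀ j → D (contracted j)
        D-contracted j = subst D (sym (contracted-terms j)) (subst D (sym split) (∣m∣n⇒∣m+n (D-∑ terms (λ {t} t∈ → rest t t∈ (Any.any? (f t ≟_) Low))) collected))
          where
          -- The sum over `Low` equals β (f t) j * W t when f t is low and is empty otherwise;
          -- exchanging the sums then groups the terms by their second key.
          slices : Tm → ℤ
          slices t = ∑ᶻ[ v ∈ Low ] ιᶻ (does (f t ≟ v)) *ᶻ (β v j *ᶻ W t)
          split : ∑ᶻ[ t ∈ terms ] β (f t) j *ᶻ W t ≡ ∑ᶻ[ t ∈ terms ] (β (f t) j *ᶻ W t -ᶻ slices t) +ᶻ ∑ᶻ[ t ∈ terms ] slices t
          split = trans (∑ᶻ-cong terms (λ t → cancel (β (f t) j *ᶻ W t) (slices t))) (∑ᶻ-+ terms (λ t → β (f t) j *ᶻ W t -ᶻ slices t) slices)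
            where
            cancel : ∀ a b → a ≡ a -ᶻ b +ᶻ b
            cancel = solve-∀ᶻ
          rest : ∀ t → t ∈ terms → Dec (f t ∈ Low) → D (β (f t) j *ᶻ W t -ᶻ slices t)
          rest t t∈ (yes f∈) = subst D (sym (trans (cong (λ s → β (f t) j *ᶻ W t -ᶻ s) (∑ᶻ-δ _≟_ Low (λ v → β v j *ᶻ W t) Low-unique f∈)) (ℤP.+-inverseʳ (β (f t) j *ᶻ W t)))) D-0
          rest t t∈ (no f∉)  = ∣m∣n⇒∣m-n (∣n⇒∣m*n (β (f t) j) (D-W t∈ f∉))
            (D-∑ Low (λ {v} _ → ∣n⇒∣m*n (ιᶻ (does (f t ≟ v))) (∣n⇒∣m*n (β v j) (D-W t∈ f∉))))
          collected : D (∑ᶻ[ t ∈ terms ] slices t)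
          collected = subst D (sym (trans (∑ᶻ-swap terms Low (λ t v → ιᶻ (does (f t ≟ v)) *ᶻ (β v j *ᶻ W t))) (∑ᶻ-cong Low (λ v → trans (∑ᶻ-cong terms (λ t → swap (ιᶻ (does (f t ≟ v))) (β v j) (W t)))
              (trans (∑ᶻ-*ˡ terms (β v j) (λ t → ιᶻ (does (f t ≟ v)) *ᶻ W t)) (cong (β v j *ᶻ_) (sym (grouped v))))))))
            (D-∑ Low (λ {v} v∈ → ∣n⇒∣m*n (β v j) (proj₁ (proj₂ kerU) (∈-++⁺ʳ (map α Low) (∈-map⁺ contribution v∈)))))
            where
            swap : ∀ d b w → d *ᶻ (b *ᶻ w) ≡ b *ᶻ (d *ᶻ w)
            swap = solve-∀ᶻ

        entry : Fin w → ℤ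
        entry j = u j *ᶻ h j *ᶻ tensor j j j

        δ : Fin w → Fin w → ℤ
        δ j i = ιᶻ (does (j ≟ᶠ i))

        -- Modulo p the contraction retains only i = k = j, because all off-diagonal entries vanish.
        D-entry : ∀ j → D (entry j)
        D-entry j = subst D (trans (cong (λ s → contracted j -ᶻ s) (sym diff)) (cancel (contracted j) (entry j)))
          (∣m∣n⇒∣m-n (D-contracted j) (D-∑ L (λ {i} _ → D-∑ L (λ {k} _ → pointwise i k))))
          where
          cancel : ∀ a b → a -ᶻ (a -ᶻ b) ≡ b
          cancel = solve-∀ᶻ
          term : Fin w → Fin w → ℤ
          term i k = u i *ᶻ h k *ᶻ tensor i j k -ᶻ δ j i *ᶻ (δ j k *ᶻ entry j)
          pointwise : ∀ i k → D (term i k)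
          pointwise i k = by (j ≟ᶠ i) (j ≟ᶠ k)
            where
            by : Dec (j ≡ i) → Dec (j ≡ k) → D (term i k)
            by (yes refl) (yes refl) = subst D (sym (trans (cong (λ b → entry j -ᶻ ιᶻ b *ᶻ (ιᶻ b *ᶻ entry j)) (dec-true (j ≟ᶠ j) refl)) (zero-diff (entry j)))) D-0
              where
              zero-diff : ∀ a → a -ᶻ 1ℤ *ᶻ (1ℤ *ᶻ a) ≡ 0ℤ
              zero-diff = solve-∀ᶻ
            by (no ne) _ = ∣m∣n⇒∣m-n (∣n⇒∣m*n (u i *ᶻ h k) (off-diagonal i j k (λ { (q , _) → ne (sym q) })))
              (subst D (sym (cong (λ b → ιᶻ b *ᶻ (δ j k *ᶻ entry j)) (dec-false (j ≟ᶠ i) ne))) D-0)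
            by (yes q) (no ne) = ∣m∣n⇒∣m-n (∣n⇒∣m*n (u i *ᶻ h k) (off-diagonal i j k (λ { (_ , r) → ne (trans q r) })))
              (∣n⇒∣m*n (δ j i) (subst D (sym (cong (λ b → ιᶻ b *ᶻ entry j) (dec-false (j ≟ᶠ k) ne))) D-0))
          diff : contracted j -ᶻ entry j ≡ ∑ᶻ[ i ∈ L ] ∑ᶻ[ k ∈ L ] term i k
          diff = sym (trans (∑ᶻ-cong L (λ i → minus (λ k → u i *ᶻ h k *ᶻ tensor i j k) (λ k → δ j i *ᶻ (δ j k *ᶻ entry j))))
            (trans (minus (λ i → ∑ᶻ L (λ k → u i *ᶻ h k *ᶻ tensor i j k)) (λ i → ∑ᶻ L (λ k → δ j i *ᶻ (δ j k *ᶻ entry j))))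
              (cong (λ s → contracted j -ᶻ s)
              (trans (∑ᶻ-cong L (λ i → trans (∑ᶻ-*ˡ L (δ j i) (λ k → δ j k *ᶻ entry j))
                  (cong (δ j i *ᶻ_) (∑ᶻ-δ _≟ᶠ_ L (λ _ → entry j) (allFin⁺ w) (∈-allFin j)))))
                (∑ᶻ-δ _≟ᶠ_ L (λ _ → entry j) (allFin⁺ w) (∈-allFin j))))))
            where
            minus : (a b : Fin w → ℤ) → ∑ᶻ[ i ∈ L ] (a i -ᶻ b i) ≡ ∑ᶻ L a -ᶻ ∑ᶻ L b
            minus a b = trans (∑ᶻ-cong L (λ i → neg (a i) (b i))) (trans (∑ᶻ-+ L a (λ i → (-ᶻ 1ℤ) *ᶻ b i))
                (trans (cong (∑ᶻ L a +ᶻ_) (∑ᶻ-*ˡ L (-ᶻ 1ℤ) b)) (sym (neg (∑ᶻ L a) (∑ᶻ L b)))))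
              where
              neg : ∀ a b → a -ᶻ b ≡ a +ᶻ (-ᶻ 1ℤ) *ᶻ b
              neg = solve-∀ᶻ

        nonzero-none : ∀ j → D (u j) ⊎ D (h j)
        nonzero-none j = [ D-* (u j) (h j) , (λ d → ⊥-elim (diagonal j d)) ]′ (D-* (u j *ᶻ h j) (tensor j j j) (D-entry j))

      -- No rank is defined. `h` annihilates the low third keys and has at most R zeros; then `u`
      -- annihilates the low first keys and the grouped second keys and has at most 2R zeros. The
      -- contracted diagonal vanishes although its tensor entries do not, so every index is a zero
      -- of `u` or of `h`.
      slice-bound : w ≤ 3 * length Low
      slice-bound = begin
        w                                  ≡⟨ sym (trans (∑-constFin w 1) (*-identityʳ w)) ⟩
        ∑ L (λ _ → 1)                      ≤⟨ ∑-mono L (λ j → pointwise j (nonzero-none j)) ⟩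
        ∑ L (λ j → 𝟙 (D? (u j)) + 𝟙 (D? (h j)))  ≡⟨ ∑-+ L _ _ ⟩
        # (λ i → D? (u i)) L + # (λ k → D? (h k)) L ≤⟨ +-mono-≤ (proj₂ (proj₂ kerU)) (proj₂ (proj₂ kerH)) ⟩
        R + R + R                          ≡⟨ three R ⟩
        3 * R                              ∎
        where
        open ≤-Reasoning
        three : ∀ R → R + R + R ≡ 3 * R
        three = solve-∀
        pointwise : ∀ j → D (u j) ⊎ D (h j) → 1 ≤ 𝟙 (D? (u j)) + 𝟙 (D? (h j))
        pointwise j (inj₁ d) = ≤-trans (≤-reflexive (sym (𝟙-yes (D? (u j)) d))) (m≤m+n _ _)
        pointwise j (inj₂ d) = ≤-trans (≤-reflexive (sym (𝟙-yes (D? (h j)) d))) (m≤n+m _ (𝟙 (D? (u j))))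

  -- Expanding the indicator of x + y = z into monomials

  Exps : Set
  Exps = ℕ × ℕ × ℕ

  monomial : Exps → ℤ → ℤ → ℤ → ℤ
  monomial (e , f , g) x y z = x ^ᶻ e *ᶻ y ^ᶻ f *ᶻ z ^ᶻ g

  degree : Exps → ℕ
  degree (e , f , g) = e + f + g

  -- For K = p - 1 this is nonzero mod p exactly when p ∣ t; it replaces 1 - t^(p-1).
  rising : ℕ → ℤ → ℤ
  rising zero    t = 1ℤ
  rising (suc K) t = (t +ᶻ pos (suc K)) *ᶻ rising K t

  Poly : Set
  Poly = List (ℤ × Exps)

  eval : Poly → ℤ → ℤ → ℤ → ℤ
  eval P x y z = ∑ᶻ[ t ∈ P ] proj₁ t *ᶻ monomial (proj₂ t) x y z

  expand-rising : ∀ K → ∃ λ (P : Poly) → (∀ {t} → t ∈ P → degree (proj₂ t) ≤ K) × (∀ x y z → eval P x y z ≡ rising K (x +ᶻ y -ᶻ z))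
  expand-rising zero = (1ℤ , 0 , 0 , 0) ∷ [] , (λ { (here refl) → z≤n }) , λ x y z → refl
  expand-rising (suc K) with expand-rising K
  ... | P , deg , val = P′ , deg′ , val′
    where
    byX byY byZ byC : ℤ × Exps → ℤ × Exps
    byX (c , e , f , g) = c , suc e , f , g
    byY (c , e , f , g) = c , e , suc f , g
    byZ (c , e , f , g) = -ᶻ c , e , f , suc g
    byC (c , efg) = pos (suc K) *ᶻ c , efg
    P′ : Poly
    P′ = map byX P ++ (map byY P ++ (map byZ P ++ map byC P))
    deg′ : ∀ {t} → t ∈ P′ → degree (proj₂ t) ≤ suc K
    degX : ∀ t → degree (proj₂ t) ≤ K → degree (proj₂ (byX t)) ≤ suc K
    degX _ = s≤s
    degY : ∀ t → degree (proj₂ t) ≤ K → degree (proj₂ (byY t)) ≤ suc K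
    degY (c , e , f , g) d = ≤-trans (≤-reflexive (cong (_+ g) (+-suc e f))) (s≤s d)
    degZ : ∀ t → degree (proj₂ t) ≤ K → degree (proj₂ (byZ t)) ≤ suc K
    degZ (c , e , f , g) d = ≤-trans (≤-reflexive (+-suc (e + f) g)) (s≤s d)
    mapped : ∀ (by : ℤ × Exps → ℤ × Exps) → (∀ t → degree (proj₂ t) ≤ K → degree (proj₂ (by t)) ≤ suc K) →
      ∀ {t} → t ∈ map by P → degree (proj₂ t) ≤ suc K
    mapped by h t∈ with ∈-map⁻ by t∈
    ... | s , s∈ , refl = h s (deg s∈)
    deg′ t∈ = [ mapped byX degX , (λ t∈₁ → [ mapped byY degY , (λ t∈₂ →
      [ mapped byZ degZ , mapped byC (λ _ → m≤n⇒m≤1+n) ]′ (∈-++⁻ (map byZ P) t∈₂)) ]′ (∈-++⁻ (map byY P) t∈₁)) ]′ (∈-++⁻ (map byX P) t∈)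
    val′ : ∀ x y z → eval P′ x y z ≡ rising (suc K) (x +ᶻ y -ᶻ z)
    val′ x y z = begin
      eval P′ x y z
        ≡⟨ trans (∑ᶻ-++ (map byX P) _ v) (cong (∑ᶻ (map byX P) v +ᶻ_) (trans (∑ᶻ-++ (map byY P) _ v)
             (cong (∑ᶻ (map byY P) v +ᶻ_) (∑ᶻ-++ (map byZ P) _ v)))) ⟩
      ∑ᶻ (map byX P) v +ᶻ (∑ᶻ (map byY P) v +ᶻ (∑ᶻ (map byZ P) v +ᶻ ∑ᶻ (map byC P) v))
        ≡⟨ cong₂ _+ᶻ_ (times byX x (λ { (c , e , f , g) → sX c x (x ^ᶻ e) (y ^ᶻ f) (z ^ᶻ g) }))
          (cong₂ _+ᶻ_ (times byY y (λ { (c , e , f , g) → sY c y (x ^ᶻ e) (y ^ᶻ f) (z ^ᶻ g) }))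
          (cong₂ _+ᶻ_ (times byZ (-ᶻ z) (λ { (c , e , f , g) → sZ c z (x ^ᶻ e) (y ^ᶻ f) (z ^ᶻ g) }))
            (times byC (pos (suc K)) (λ { (c , e , f , g) → ℤP.*-assoc (pos (suc K)) c (monomial (e , f , g) x y z) })))) ⟩
      x *ᶻ E +ᶻ (y *ᶻ E +ᶻ ((-ᶻ z) *ᶻ E +ᶻ pos (suc K) *ᶻ E))
        ≡⟨ collect x y z (pos (suc K)) E ⟩
      (x +ᶻ y -ᶻ z +ᶻ pos (suc K)) *ᶻ E
        ≡⟨ cong ((x +ᶻ y -ᶻ z +ᶻ pos (suc K)) *ᶻ_) (val x y z) ⟩
      rising (suc K) (x +ᶻ y -ᶻ z) ∎
      where
      open ≡-Reasoning
      v : ℤ × Exps → ℤ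
      v t = proj₁ t *ᶻ monomial (proj₂ t) x y z
      E : ℤ
      E = eval P x y z
      sX : ∀ c x a b d → c *ᶻ (x *ᶻ a *ᶻ b *ᶻ d) ≡ x *ᶻ (c *ᶻ (a *ᶻ b *ᶻ d))
      sX = solve-∀ᶻ
      sY : ∀ c y a b d → c *ᶻ (a *ᶻ (y *ᶻ b) *ᶻ d) ≡ y *ᶻ (c *ᶻ (a *ᶻ b *ᶻ d))
      sY = solve-∀ᶻ
      sZ : ∀ c z a b d → (-ᶻ c) *ᶻ (a *ᶻ b *ᶻ (z *ᶻ d)) ≡ (-ᶻ z) *ᶻ (c *ᶻ (a *ᶻ b *ᶻ d))
      sZ = solve-∀ᶻ
      collect : ∀ x y z k e → x *ᶻ e +ᶻ (y *ᶻ e +ᶻ ((-ᶻ z) *ᶻ e +ᶻ k *ᶻ e)) ≡ (x +ᶻ y -ᶻ z +ᶻ k) *ᶻ e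
      collect = solve-∀ᶻ
      times : (by : ℤ × Exps → ℤ × Exps) (k : ℤ) → (∀ t → v (by t) ≡ k *ᶻ v t) → ∑ᶻ (map by P) v ≡ k *ᶻ E
      times by k h = trans (∑ᶻ-map by P v) (trans (∑ᶻ-cong P h) (∑ᶻ-*ˡ P k v))

  ∑ᶻ-cartesianProductWith : ∀ {a b c} {A : Set a} {B : Set b} {C : Set c} (_∙_ : A → B → C) (L : List A) (M : List B) (f : C → ℤ) →
    ∑ᶻ (cartesianProductWith _∙_ L M) f ≡ ∑ᶻ[ x ∈ L ] ∑ᶻ[ y ∈ M ] f (x ∙ y)
  ∑ᶻ-cartesianProductWith _∙_ []      M f = refl
  ∑ᶻ-cartesianProductWith _∙_ (x ∷ L) M f = trans (∑ᶻ-++ (map (x ∙_) M) _ f)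
    (cong₂ _+ᶻ_ (∑ᶻ-map (x ∙_) M f) (∑ᶻ-cartesianProductWith _∙_ L M f))

  powers : ∀ {n} → Vec ℕ n → Vec ℤ n → ℤ
  powers []      []      = 1ℤ
  powers (e ∷ v) (x ∷ X) = x ^ᶻ e *ᶻ powers v X

  VecTerm : ℕ → Set
  VecTerm n = ℤ × Vec Exps n

  firsts seconds thirds : ∀ {n} → VecTerm n → Vec ℕ n
  firsts  (_ , v) = Vec.map proj₁ v
  seconds (_ , v) = Vec.map (proj₁ ∘ proj₂) v
  thirds  (_ , v) = Vec.map (proj₂ ∘ proj₂) v

  tri : ∀ {n} → Vec ℤ n → Vec ℤ n → Vec ℤ n → Vec ℤ n
  tri []      []      []      = []
  tri (x ∷ X) (y ∷ Y) (z ∷ Z) = (x +ᶻ y -ᶻ z) ∷ tri X Y Z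

  product-rising : ∀ {n} → ℕ → Vec ℤ n → ℤ
  product-rising K []      = 1ℤ
  product-rising K (t ∷ T) = rising K t *ᶻ product-rising K T

  evalT : ∀ {n} → VecTerm n → Vec ℤ n → Vec ℤ n → Vec ℤ n → ℤ
  evalT t X Y Z = proj₁ t *ᶻ (powers (firsts t) X *ᶻ powers (seconds t) Y *ᶻ powers (thirds t) Z)

  expand-vec : ∀ K n → ∃ λ (P : List (VecTerm n)) → (∀ {t} → t ∈ P → VAll.All (λ efg → degree efg ≤ K) (proj₂ t)) ×
    (∀ X Y Z → ∑ᶻ[ t ∈ P ] evalT t X Y Z ≡ product-rising K (tri X Y Z))
  expand-vec K zero = (1ℤ , []) ∷ [] , (λ { (here refl) → VAll.[] }) , λ { [] [] [] → refl }
  expand-vec K (suc n) with expand-rising K | expand-vec K n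
  ... | P₁ , deg₁ , val₁ | P , deg , val = cartesianProductWith _∷ᵗ_ P₁ P , deg′ , val′
    where
    _∷ᵗ_ : ℤ × Exps → VecTerm n → VecTerm (suc n)
    (c , efg) ∷ᵗ (d , v) = c *ᶻ d , efg ∷ v
    deg′ : ∀ {t} → t ∈ cartesianProductWith _∷ᵗ_ P₁ P → VAll.All (λ efg → degree efg ≤ K) (proj₂ t)
    deg′ t∈ with ∈-cartesianProductWith⁻ _∷ᵗ_ P₁ P t∈
    ... | _ , _ , p , q , refl = deg₁ p VAll.∷ deg q
    val′ : ∀ X Y Z → ∑ᶻ[ t ∈ cartesianProductWith _∷ᵗ_ P₁ P ] evalT t X Y Z ≡ product-rising K (tri X Y Z)
    val′ (x ∷ X) (y ∷ Y) (z ∷ Z) = begin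
      ∑ᶻ (cartesianProductWith _∷ᵗ_ P₁ P) (λ t → evalT t (x ∷ X) (y ∷ Y) (z ∷ Z))
        ≡⟨ ∑ᶻ-cartesianProductWith _∷ᵗ_ P₁ P (λ t → evalT t (x ∷ X) (y ∷ Y) (z ∷ Z)) ⟩
      ∑ᶻ P₁ (λ t → ∑ᶻ P (λ s → evalT (t ∷ᵗ s) (x ∷ X) (y ∷ Y) (z ∷ Z)))
        ≡⟨ ∑ᶻ-cong P₁ (λ t → trans (∑ᶻ-cong P (split t)) (∑ᶻ-*ˡ P (proj₁ t *ᶻ monomial (proj₂ t) x y z) (λ s → evalT s X Y Z))) ⟩
      ∑ᶻ P₁ (λ t → proj₁ t *ᶻ monomial (proj₂ t) x y z *ᶻ ∑ᶻ P (λ s → evalT s X Y Z))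
        ≡⟨ ∑ᶻ-*ʳ P₁ (λ t → proj₁ t *ᶻ monomial (proj₂ t) x y z) (∑ᶻ P (λ s → evalT s X Y Z)) ⟩
      eval P₁ x y z *ᶻ ∑ᶻ P (λ s → evalT s X Y Z)
        ≡⟨ cong₂ _*ᶻ_ (val₁ x y z) (val X Y Z) ⟩
      rising K (x +ᶻ y -ᶻ z) *ᶻ product-rising K (tri X Y Z) ∎
      where
      open ≡-Reasoning
      shuffle : ∀ c d a b e A B E → c *ᶻ d *ᶻ (a *ᶻ A *ᶻ (b *ᶻ B) *ᶻ (e *ᶻ E)) ≡ c *ᶻ (a *ᶻ b *ᶻ e) *ᶻ (d *ᶻ (A *ᶻ B *ᶻ E))
      shuffle = solve-∀ᶻ
      split : ∀ t s → evalT (t ∷ᵗ s) (x ∷ X) (y ∷ Y) (z ∷ Z) ≡ proj₁ t *ᶻ monomial (proj₂ t) x y z *ᶻ evalT s X Y Z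
      split (c , e , f , g) s = shuffle c (proj₁ s) (x ^ᶻ e) (y ^ᶻ f) (z ^ᶻ g) (powers (firsts s) X) (powers (seconds s) Y) (powers (thirds s) Z)

  vecs : ∀ {a} {A : Set a} → List A → (n : ℕ) → List (Vec A n)
  vecs L zero    = [] ∷ []
  vecs L (suc n) = cartesianProductWith _∷_ L (vecs L n)

  vecs-unique : ∀ {a} {A : Set a} (L : List A) → Unique L → ∀ n → Unique (vecs L n)
  vecs-unique L u zero    = [] ∷ []
  vecs-unique L u (suc n) = cartesianProductWith⁺ _∷_ VecP.∷-injective u (vecs-unique L u n)

  ∈-vecs : ∀ {a} {A : Set a} (L : List A) {n} (v : Vec A n) → VAll.All (_∈ L) v → v ∈ vecs L n
  ∈-vecs L []      VAll.[]         = here refl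
  ∈-vecs L (x ∷ v) (x∈ VAll.∷ v∈) = ∈-cartesianProductWith⁺ _∷_ x∈ (∈-vecs L v v∈)

  module TriColoured (p : ℕ) (p-prime : Prime p) where

    open Mod p p-prime

    -- Truncating exponents e < p to τ e ∈ {0, 1, 2} keeps the sum of three at most 2 while the mean over
    -- e < p is 1; this replaces the degree in the usual argument and makes the final bound uniform in p.
    h₁ h₂ : ℕ
    h₁ = ⌊ p /2⌋
    h₂ = p ∸ h₁

    h₁+h₂≡p : h₁ + h₂ ≡ p
    h₁+h₂≡p = m+[n∸m]≡n (⌊n/2⌋≤n p)

    h₁≤h₂ : h₁ ≤ h₂
    h₁≤h₂ = ≤-trans (⌊n/2⌋≤⌈n/2⌉ p) (≤-reflexive (sym (trans (cong (_∸ h₁) (sym (⌊n/2⌋+⌈n/2⌉≡n p))) (m+n∸m≡n h₁ ⌈ p /2⌉))))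

    h₂≤1+h₁ : h₂ ≤ suc h₁
    h₂≤1+h₁ = +-cancelˡ-≤ h₁ _ _ (≤-trans (≤-reflexive h₁+h₂≡p) (≤-trans (≤-reflexive (sym (⌊n/2⌋+⌈n/2⌉≡n p))) (+-monoʳ-≤ h₁ (up p))))
      where
      up : ∀ n → ⌈ n /2⌉ ≤ suc ⌊ n /2⌋
      up zero          = z≤n
      up (suc zero)    = s≤s z≤n
      up (suc (suc n)) = s≤s (up n)

    p≤3h₁ : p ≤ 3 * h₁
    p≤3h₁ = ≤-trans (≤-reflexive (sym h₁+h₂≡p)) (≤-trans (+-monoʳ-≤ h₁ (≤-trans h₂≤1+h₁ (+-monoˡ-≤ h₁ 1≤h₁))) (≤-reflexive (three h₁)))
      where
      1≤h₁ : 1 ≤ h₁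
      1≤h₁ = ⌊n/2⌋-mono 1<p
      three : ∀ h → h + (h + h) ≡ 3 * h
      three = solve-∀

    τ : ℕ → ℕ
    τ e = 𝟙 (h₁ ≤? e) + 𝟙 (h₂ ≤? e)

    τ-low : ∀ {e} → e < h₁ → τ e ≡ 0
    τ-low {e} e< = cong₂ _+_ (𝟙-no (h₁ ≤? e) (<⇒≱ e<)) (𝟙-no (h₂ ≤? e) (<⇒≱ (<-≤-trans e< h₁≤h₂)))

    τ≤2 : ∀ e → τ e ≤ 2
    τ≤2 e = +-mono-≤ (𝟙≤1 (h₁ ≤? e)) (𝟙≤1 (h₂ ≤? e))

    big⇒others-small : ∀ e s → h₂ ≤ e → e + s < p → s < h₁
    big⇒others-small e s h₂≤e e+s<p = +-cancelʳ-< h₂ s h₁ (≤-<-trans (≤-trans (+-monoʳ-≤ s h₂≤e) (≤-reflexive (+-comm s e))) (subst (e + s <_) (sym h₁+h₂≡p) e+s<p))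

    τ-small : ∀ {e} → ¬ h₂ ≤ e → τ e ≤ 1
    τ-small {e} ¬b = ≤-trans (≤-reflexive (cong (𝟙 (h₁ ≤? e) +_) (𝟙-no (h₂ ≤? e) ¬b))) (≤-trans (≤-reflexive (+-identityʳ _)) (𝟙≤1 (h₁ ≤? e)))

    τ-sum-big : ∀ e f g → h₂ ≤ e → e + (f + g) < p → τ e + (τ f + τ g) ≤ 2
    τ-sum-big e f g b s< = ≤-trans (≤-reflexive (cong (τ e +_) (cong₂ _+_ (τ-low (≤-<-trans (m≤m+n f g) small)) (τ-low (≤-<-trans (m≤n+m g f) small)))))
      (≤-trans (≤-reflexive (+-identityʳ (τ e))) (τ≤2 e))
      where
      small : f + g < h₁
      small = big⇒others-small e (f + g) b s<

    -- An exponent of at least h₂ forces the other two below h₁, where τ is 0. Otherwise each τ is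
    -- at most 1, and the three cannot all be 1, since 3 h₁ ≥ p.
    τ-sum : ∀ e f g → e + f + g < p → τ e + τ f + τ g ≤ 2
    τ-sum e f g s< = by (h₂ ≤? e) (h₂ ≤? f) (h₂ ≤? g)
      where
      r₁ : ∀ a b c → a + b + c ≡ a + (b + c)
      r₁ = solve-∀
      r₂ : ∀ a b c → a + b + c ≡ b + (a + c)
      r₂ = solve-∀
      r₃ : ∀ a b c → a + b + c ≡ c + (a + b)
      r₃ = solve-∀
      none : ¬ h₂ ≤ e → ¬ h₂ ≤ f → ¬ h₂ ≤ g → Dec (h₁ ≤ e) → Dec (h₁ ≤ f) → Dec (h₁ ≤ g) → τ e + τ f + τ g ≤ 2
      none be bf bg (no ¬e) _ _ = +-mono-≤ (≤-trans (≤-reflexive (cong (_+ τ f) (τ-low (≰⇒> ¬e)))) (τ-small bf)) (τ-small bg)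
      none be bf bg (yes _) (no ¬f) _ = +-mono-≤ (≤-trans (≤-reflexive (trans (cong (τ e +_) (τ-low (≰⇒> ¬f))) (+-identityʳ _))) (τ-small be)) (τ-small bg)
      none be bf bg (yes _) (yes _) (no ¬g) = ≤-trans (≤-reflexive (trans (cong (τ e + τ f +_) (τ-low (≰⇒> ¬g))) (+-identityʳ _))) (+-mono-≤ (τ-small be) (τ-small bf))
      none _ _ _ (yes e≥) (yes f≥) (yes g≥) = ⊥-elim (<⇒≱ s< (≤-trans p≤3h₁ (≤-trans (≤-reflexive (three h₁)) (+-mono-≤ (+-mono-≤ e≥ f≥) g≥))))
        where
        three : ∀ h → 3 * h ≡ h + h + h
        three = solve-∀
      by : Dec (h₂ ≤ e) → Dec (h₂ ≤ f) → Dec (h₂ ≤ g) → τ e + τ f + τ g ≤ 2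
      by (yes b) _ _ = ≤-trans (≤-reflexive (r₁ (τ e) (τ f) (τ g))) (τ-sum-big e f g b (subst (_< p) (r₁ e f g) s<))
      by (no _) (yes b) _ = ≤-trans (≤-reflexive (r₂ (τ e) (τ f) (τ g))) (τ-sum-big f e g b (subst (_< p) (r₂ e f g) s<))
      by (no _) (no _) (yes b) = ≤-trans (≤-reflexive (r₃ (τ e) (τ f) (τ g))) (τ-sum-big g e f b (subst (_< p) (r₃ e f g) s<))
      by (no be) (no bf) (no bg) = none be bf bg (h₁ ≤? e) (h₁ ≤? f) (h₁ ≤? g)

    τs : ∀ {n} → Vec ℕ n → ℕ
    τs []      = 0
    τs (e ∷ v) = τ e + τs v

    Low? : ∀ {n} (v : Vec ℕ n) → Dec (3 * τs v ≤ 2 * n)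
    Low? {n} v = 3 * τs v ≤? 2 * n

    Low : ∀ n → List (Vec ℕ n)
    Low n = filter Low? (vecs (upTo p) n)

    τs-sum : ∀ {n c} (v : Vec Exps n) → VAll.All (λ t → degree t < p) v →
      τs (firsts (c , v)) + τs (seconds (c , v)) + τs (thirds (c , v)) ≤ 2 * n
    τs-sum []                VAll.[]      = z≤n
    τs-sum {suc n} {c} ((e , f , g) ∷ v) (d VAll.∷ ds) = ≤-trans (≤-reflexive (regroup (τ e) (τ f) (τ g) (τs (firsts (c , v))) (τs (seconds (c , v))) (τs (thirds (c , v)))))
      (≤-trans (+-mono-≤ (τ-sum e f g d) (τs-sum {c = c} v ds)) (≤-reflexive (sym (*-suc 2 n))))
      where
      regroup : ∀ a b c x y z → a + x + (b + y) + (c + z) ≡ a + b + c + (x + y + z)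
      regroup = solve-∀

    one-low : ∀ a b c n → a + b + c ≤ 2 * n → 3 * a ≤ 2 * n ⊎ 3 * b ≤ 2 * n ⊎ 3 * c ≤ 2 * n
    one-low a b c n h with 3 * a ≤? 2 * n | 3 * b ≤? 2 * n | 3 * c ≤? 2 * n
    ... | yes p | _     | _     = inj₁ p
    ... | no _  | yes p | _     = inj₂ (inj₁ p)
    ... | no _  | no _  | yes p = inj₂ (inj₂ p)
    ... | no ¬a | no ¬b | no ¬c = ⊥-elim (<⇒≱ (+-mono-< (+-mono-< (≰⇒> ¬a) (≰⇒> ¬b)) (≰⇒> ¬c))
            (≤-trans (≤-reflexive (three a b c)) (≤-trans (*-monoʳ-≤ 3 h) (≤-reflexive (three′ (2 * n))))))
      where
      three : ∀ a b c → 3 * a + 3 * b + 3 * c ≡ 3 * (a + b + c)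
      three = solve-∀
      three′ : ∀ m → 3 * m ≡ m + m + m
      three′ = solve-∀

    in-range : ∀ {n} (pr : Exps → ℕ) (v : Vec Exps n) → (∀ t → pr t ≤ degree t) → VAll.All (λ t → degree t < p) v → Vec.map pr v ∈ vecs (upTo p) n
    in-range pr v h ds = ∈-vecs (upTo p) _ (below v ds)
      where
      below : ∀ {n} (v : Vec Exps n) → VAll.All (λ t → degree t < p) v → VAll.All (_∈ upTo p) (Vec.map pr v)
      below []      VAll.[]       = VAll.[]
      below (t ∷ v) (d VAll.∷ ds) = ∈-upTo⁺ (≤-<-trans (h t) d) VAll.∷ below v ds

    term-low : ∀ {n c} (v : Vec Exps n) → VAll.All (λ t → degree t < p) v →
      firsts (c , v) ∈ Low n ⊎ seconds (c , v) ∈ Low n ⊎ thirds (c , v) ∈ Low n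
    term-low {n} {c} v ds with one-low (τs (firsts (c , v))) (τs (seconds (c , v))) (τs (thirds (c , v))) n (τs-sum {c = c} v ds)
    ... | inj₁ l        = inj₁ (∈-filter⁺ Low? (in-range proj₁ v (λ t → ≤-trans (m≤m+n _ (proj₁ (proj₂ t))) (m≤m+n _ (proj₂ (proj₂ t)))) ds) l)
    ... | inj₂ (inj₁ l) = inj₂ (inj₁ (∈-filter⁺ Low? (in-range (proj₁ ∘ proj₂) v (λ t → ≤-trans (m≤n+m _ (proj₁ t)) (m≤m+n _ (proj₂ (proj₂ t)))) ds) l))
    ... | inj₂ (inj₂ l) = inj₂ (inj₂ (∈-filter⁺ Low? (in-range (proj₂ ∘ proj₂) v (λ t → m≤n+m _ (proj₁ t + proj₁ (proj₂ t))) ds) l))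

    Zero : ∀ {n} → Vec ℤ n → Set
    Zero = VAll.All D

    instance
      p-nonZero : NonZero p
      p-nonZero = >-nonZero (<-trans (s≤s z≤n) 1<p)

    -- If p divides t, the product is congruent to K!, a product of numbers below p.
    ¬D-rising : ∀ K t → K < p → D t → ¬ D (rising K t)
    ¬D-rising zero    t K< Dt d = ¬D-small (s≤s z≤n) 1<p d
    ¬D-rising (suc K) t K< Dt d = [ (λ d₁ → ¬D-small (s≤s z≤n) K< (subst D (cancel t (pos (suc K))) (∣m∣n⇒∣m-n d₁ Dt))) ,
        ¬D-rising K t (<-trans (n<1+n K) K<) Dt ]′ (D-* (t +ᶻ pos (suc K)) (rising K t) d)
      where
      cancel : ∀ t k → t +ᶻ k -ᶻ t ≡ k
      cancel = solve-∀ᶻ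

    D-rising : ∀ K t s → 1 ≤ s → s ≤ K → D (t +ᶻ pos s) → D (rising K t)
    D-rising zero    t (suc s) _ () d
    D-rising (suc K) t s 1≤s s≤ d with m≤n⇒m<n∨m≡n s≤
    ... | inj₂ refl      = ∣m⇒∣m*n (rising K t) d
    ... | inj₁ (s≤s s≤K) = ∣n⇒∣m*n (t +ᶻ pos (suc K)) (D-rising K t s 1≤s s≤K d)

    -- If t has remainder r ≠ 0, the factor t + (p - r) vanishes modulo p, and p - r lies between 1
    -- and p - 1.
    D-rising-p : ∀ t → ¬ D t → D (rising (pred p) t)
    D-rising-p t ¬Dt = D-rising (pred p) t (p ∸ r) (m<n⇒0<n∸m r<p) (≤-trans (∸-monoʳ-≤ p 1≤r) (≤-reflexive (sym (pred≡ p))))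
        (subst D (sym shifted) (∣n⇒∣m*n (t /ℕ p +ᶻ 1ℤ) (∣ᵤ⇒∣ (divides 1 (sym (*-identityˡ p))))))
      where
      pred≡ : ∀ n → pred n ≡ n ∸ 1
      pred≡ zero    = refl
      pred≡ (suc n) = refl
      r : ℕ
      r = t %ℕ p
      r<p : r < p
      r<p = n%ℕd<d t p
      division : t ≡ pos r +ᶻ t /ℕ p *ᶻ pos p
      division = a≡a%ℕn+[a/ℕn]*n t p
      1≤r : 1 ≤ r
      1≤r = n≢0⇒n>0 (λ r≡0 → ¬Dt (subst D (sym (trans division (trans (cong (λ s → pos s +ᶻ t /ℕ p *ᶻ pos p) r≡0) (ℤP.+-identityˡ _))))
        (∣n⇒∣m*n (t /ℕ p) (∣ᵤ⇒∣ (divides 1 (sym (*-identityˡ p)))))))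
      shifted : t +ᶻ pos (p ∸ r) ≡ (t /ℕ p +ᶻ 1ℤ) *ᶻ pos p
      shifted = trans (cong (_+ᶻ pos (p ∸ r)) division) (trans (regroup (pos r) (t /ℕ p) (pos p) (pos (p ∸ r)))
        (trans (cong (λ s → t /ℕ p *ᶻ pos p +ᶻ s) (trans (sym (ℤP.pos-+ r (p ∸ r))) (cong pos (m+[n∸m]≡n (<⇒≤ r<p))))) (collect (t /ℕ p) (pos p))))
        where
        regroup : ∀ r q p s → r +ᶻ q *ᶻ p +ᶻ s ≡ q *ᶻ p +ᶻ (r +ᶻ s)
        regroup = solve-∀ᶻ
        collect : ∀ q p → q *ᶻ p +ᶻ p ≡ (q +ᶻ 1ℤ) *ᶻ p
        collect = solve-∀ᶻ

    pred-p<p : pred p < p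
    pred-p<p = ≤-reflexive (suc-pred p)

    ¬D-product : ∀ {n} (T : Vec ℤ n) → Zero T → ¬ D (product-rising (pred p) T)
    ¬D-product []      VAll.[]      d = ¬D-small (s≤s z≤n) 1<p d
    ¬D-product (t ∷ T) (z VAll.∷ Z) d = [ ¬D-rising (pred p) t pred-p<p z , ¬D-product T Z ]′ (D-* (rising (pred p) t) (product-rising (pred p) T) d)

    D-product : ∀ {n} (T : Vec ℤ n) → ¬ Zero T → D (product-rising (pred p) T)
    D-product []      ¬Z = ⊥-elim (¬Z VAll.[])
    D-product (t ∷ T) ¬Z with D? t
    ... | yes d = ∣n⇒∣m*n (rising (pred p) t) (D-product T (λ Z → ¬Z (d VAll.∷ Z)))
    ... | no ¬d = ∣m⇒∣m*n (product-rising (pred p) T) (D-rising-p t ¬d)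

    -- The tensor is `product-rising (pred p)` at x i + y j - z k, which is nonzero modulo p exactly
    -- on solutions, hence on the diagonal only. Each monomial has a low key, because its three
    -- values of `τs` add up to at most 2n.
    tricoloured : ∀ {n w} (x y z : Fin w → Vec ℤ n) → (∀ i → Zero (tri (x i) (y i) (z i))) →
      (∀ i j k → Zero (tri (x i) (y j) (z k)) → i ≡ j × i ≡ k) → w ≤ 3 * length (Low n)
    tricoloured {n} {w} x y z diag off = slice-bound
        (λ i → subst (¬_ ∘ D) (sym (value i i i)) (¬D-product (tri (x i) (y i) (z i)) (diag i)))
        (λ i j k ne → subst D (sym (value i j k)) (D-product (tri (x i) (y j) (z k)) (λ Z → ne (off i j k Z))))
      where
      E : ∃ λ (P : List (VecTerm n)) → (∀ {t} → t ∈ P → VAll.All (λ efg → degree efg ≤ pred p) (proj₂ t)) ×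
        (∀ X Y Z → ∑ᶻ[ t ∈ P ] evalT t X Y Z ≡ product-rising (pred p) (tri X Y Z))
      E = expand-vec (pred p) n
      open Slices p p-prime (VecP.≡-dec _≟_) (Low n) (filter⁺ Low? (vecs-unique (upTo p) (upTo⁺ p) n))
        (λ v i → powers v (x i)) (λ v j → powers v (y j)) (λ v k → powers v (z k)) (proj₁ E) proj₁ firsts seconds thirds
        (λ {t} t∈ → term-low {c = proj₁ t} (proj₂ t) (VAll.map (λ d → ≤-<-trans d pred-p<p) (proj₁ (proj₂ E) t∈)))
      value : ∀ i j k → tensor i j k ≡ product-rising (pred p) (tri (x i) (y j) (z k))
      value i j k = proj₂ (proj₂ E) (x i) (y j) (z k)

  -- Counting low exponent vectors

  ∑-cartesianProductWith : ∀ {a b c} {A : Set a} {B : Set b} {C : Set c} (_∙_ : A → B → C) (L : List A) (M : List B) (f : C → ℕ) →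
    ∑ (cartesianProductWith _∙_ L M) f ≡ ∑[ x ∈ L ] ∑[ y ∈ M ] f (x ∙ y)
  ∑-cartesianProductWith _∙_ []      M f = refl
  ∑-cartesianProductWith _∙_ (x ∷ L) M f = trans (∑-++ (map (x ∙_) M) _ f)
    (cong₂ _+_ (∑-map (x ∙_) M f) (∑-cartesianProductWith _∙_ L M f))

  ∑-applyUpTo : ∀ (g : ℕ → ℕ) n (f : ℕ → ℕ) → ∑ (applyUpTo g n) f ≡ ∑ (upTo n) (f ∘ g)
  ∑-applyUpTo g zero    f = refl
  ∑-applyUpTo g (suc n) f = cong (f (g 0) +_) (trans (∑-applyUpTo (g ∘ suc) n f) (sym (∑-applyUpTo suc n (f ∘ g))))

  ∑-upTo-suc : ∀ n (f : ℕ → ℕ) → ∑ (upTo (suc n)) f ≡ f 0 + ∑ (upTo n) (f ∘ suc)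
  ∑-upTo-suc n f = cong (f 0 +_) (∑-applyUpTo suc n f)

  ∑-upTo-const : ∀ n c → ∑[ e ∈ upTo n ] c ≡ n * c
  ∑-upTo-const zero    c = refl
  ∑-upTo-const (suc n) c = trans (∑-upTo-suc n (λ _ → c)) (cong (c +_) (∑-upTo-const n c))

  ∑-upTo-≥ : ∀ h n → h ≤ n → ∑[ e ∈ upTo n ] 𝟙 (h ≤? e) + h ≡ n
  ∑-upTo-≥ zero    n       h≤n       = trans (+-identityʳ _) (trans (∑-upTo-const n 1) (*-identityʳ n))
  ∑-upTo-≥ (suc h) (suc n) (s≤s h≤n) = trans (cong (_+ suc h) (trans (∑-upTo-suc n (λ e → 𝟙 (suc h ≤? e)))
      (∑-cong (upTo n) (λ e → ≤-antisym (𝟙-mono (suc h ≤? suc e) (h ≤? e) ≤-pred) (𝟙-mono (h ≤? e) (suc h ≤? suc e) s≤s)))))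
    (trans (+-suc _ h) (cong suc (∑-upTo-≥ h n h≤n)))

  cube-mono : ∀ a b → a * a * a ≤ b * b * b → a ≤ b
  cube-mono a b h with a ≤? b
  ... | yes p = p
  ... | no ¬p = ⊥-elim (<⇒≱ (*-mono-< (*-mono-< (≰⇒> ¬p) (≰⇒> ¬p)) (≰⇒> ¬p)) h)

  ^-distrib : ∀ a b n → (a * b) ^ n ≡ a ^ n * b ^ n
  ^-distrib a b zero    = refl
  ^-distrib a b (suc n) = trans (cong (a * b *_) (^-distrib a b n)) (shuffle a b (a ^ n) (b ^ n))
    where
    shuffle : ∀ a b c d → a * b * (c * d) ≡ a * c * (b * d)
    shuffle = solve-∀

  ω : Bool → Bool → ℕ
  ω true  true  = 4
  ω true  false = 6
  ω false _     = 9

  -- As x ≥ y, the worst case is t = 2n/3, where the claim is the (n/3)-th power of the base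
  -- inequality. Comparing cubes avoids the fractional exponent, and the factor (y²)^n avoids a
  -- division.
  exchange : ∀ A B x y n t → 1 ≤ y → y ≤ x → B * B * B * (x * x) ≤ A * A * A * (y * y) → 3 * t ≤ 2 * n → B ^ n * x ^ t ≤ A ^ n * y ^ t
  exchange A B x y n t 1≤y y≤x base 3t≤2n = cube-mono _ _ (*-cancelʳ-≤ _ _ ((y * y) ^ n) {{>-nonZero (m^n>0 (y * y) {{>-nonZero (*-mono-≤ 1≤y 1≤y)}} n)}} (begin
      Bn * X * (Bn * X) * (Bn * X) * (y * y) ^ n
        ≡⟨ regroup Bn X ((y * y) ^ n) ⟩
      Bn * Bn * Bn * (X * X * X * (y * y) ^ n)
        ≤⟨ *-monoʳ-≤ (Bn * Bn * Bn) swap ⟩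
      Bn * Bn * Bn * ((x * x) ^ n * (Y * Y * Y))
        ≡⟨ trans (sym (*-assoc (Bn * Bn * Bn) _ _)) (cong (_* (Y * Y * Y)) (sym (powers3 B (x * x)))) ⟩
      (B * B * B * (x * x)) ^ n * (Y * Y * Y)
        ≤⟨ *-monoˡ-≤ (Y * Y * Y) (^-monoˡ-≤ n base) ⟩
      (A * A * A * (y * y)) ^ n * (Y * Y * Y)
        ≡⟨ cong (_* (Y * Y * Y)) (powers3 A (y * y)) ⟩
      An * An * An * (y * y) ^ n * (Y * Y * Y)
        ≡⟨ regroup′ An Y ((y * y) ^ n) ⟩
      An * Y * (An * Y) * (An * Y) * (y * y) ^ n ∎))
    where
    open ≤-Reasoning
    Bn = B ^ n
    An = A ^ n
    X = x ^ t
    Y = y ^ t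
    r = 2 * n ∸ 3 * t
    regroup : ∀ b x q → b * x * (b * x) * (b * x) * q ≡ b * b * b * (x * x * x * q)
    regroup = solve-∀
    regroup′ : ∀ a y q → a * a * a * q * (y * y * y) ≡ a * y * (a * y) * (a * y) * q
    regroup′ = solve-∀
    powers3 : ∀ B q → (B * B * B * q) ^ n ≡ B ^ n * B ^ n * B ^ n * q ^ n
    powers3 B q = trans (^-distrib (B * B * B) q n) (cong (_* q ^ n) (trans (^-distrib (B * B) B n) (cong (_* B ^ n) (^-distrib B B n))))
    squares : ∀ w → (w * w) ^ n ≡ w ^ t * w ^ t * w ^ t * w ^ r
    squares w = trans (cong (_^ n) (sym (cong (w *_) (*-identityʳ w)))) (trans (^-*-assoc w 2 n)
      (trans (cong (w ^_) (trans (sym (m+[n∸m]≡n 3t≤2n)) (cong (_+ r) (three t)))) (trans (^-distribˡ-+-* w (t + t + t) r)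
        (cong (_* w ^ r) (trans (^-distribˡ-+-* w (t + t) t) (cong (_* w ^ t) (^-distribˡ-+-* w t t)))))))
      where
      three : ∀ t → 3 * t ≡ t + t + t
      three = solve-∀
    swap : X * X * X * (y * y) ^ n ≤ (x * x) ^ n * (Y * Y * Y)
    swap = begin
      X * X * X * (y * y) ^ n             ≡⟨ cong (X * X * X *_) (squares y) ⟩
      X * X * X * (Y * Y * Y * y ^ r)     ≤⟨ *-monoʳ-≤ (X * X * X) (*-monoʳ-≤ (Y * Y * Y) (^-monoˡ-≤ r y≤x)) ⟩
      X * X * X * (Y * Y * Y * x ^ r)     ≡⟨ shuffle (X * X * X) (Y * Y * Y) (x ^ r) ⟩
      X * X * X * x ^ r * (Y * Y * Y)     ≡⟨ cong (_* (Y * Y * Y)) (sym (squares x)) ⟩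
      (x * x) ^ n * (Y * Y * Y)           ∎
      where
      shuffle : ∀ a b c → a * (b * c) ≡ a * c * b
      shuffle = solve-∀

  module LowExponents (p : ℕ) (p-prime : Prime p) where
    open TriColoured p p-prime

    -- Weight 9 (2/3)^{τ e}: an exponential-moment bound for the number of low exponent vectors.
    wt : ℕ → ℕ
    wt e = ω (does (h₁ ≤? e)) (does (h₂ ≤? e))

    total : ℕ
    total = ∑ (upTo p) wt

    -- The weights 9 and 4 occur h₁ times each and average 13/2; the middle weight 6 lies below this
    -- average.
    2total≤13p : 2 * total ≤ 13 * p
    2total≤13p = +-cancelʳ-≤ (2 * (3 * h₂ + 2 * h₁)) _ _ (begin
      2 * total + 2 * (3 * h₂ + 2 * h₁)
        ≡⟨ sym (*-distribˡ-+ 2 total _) ⟩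
      2 * (total + (3 * h₂ + 2 * h₁))
        ≡⟨ cong (2 *_) weighted ⟩
      2 * (9 * p)
        ≡⟨ cong (λ q → 2 * (9 * q)) (sym h₁+h₂≡p) ⟩
      2 * (9 * (h₁ + h₂))
        ≡⟨ expand h₁ h₂ ⟩
      12 * (h₁ + h₂) + h₁ + h₁ + (2 * (3 * h₂ + 2 * h₁))
        ≤⟨ +-monoˡ-≤ (2 * (3 * h₂ + 2 * h₁)) (≤-trans (+-monoʳ-≤ (12 * (h₁ + h₂) + h₁) h₁≤h₂) (≤-reflexive (collect h₁ h₂))) ⟩
      13 * (h₁ + h₂) + (2 * (3 * h₂ + 2 * h₁))
        ≡⟨ cong (λ q → 13 * q + (2 * (3 * h₂ + 2 * h₁))) h₁+h₂≡p ⟩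
      13 * p + (2 * (3 * h₂ + 2 * h₁)) ∎)
      where
      open ≤-Reasoning
      expand : ∀ a b → 2 * (9 * (a + b)) ≡ 12 * (a + b) + a + a + (2 * (3 * b + 2 * a))
      expand = solve-∀
      collect : ∀ a b → 12 * (a + b) + a + b ≡ 13 * (a + b)
      collect = solve-∀
      pointwise : ∀ e → wt e + (3 * 𝟙 (h₁ ≤? e) + 2 * 𝟙 (h₂ ≤? e)) ≡ 9
      pointwise e = by (h₁ ≤? e) (h₂ ≤? e)
        where
        by : (d : Dec (h₁ ≤ e)) (d′ : Dec (h₂ ≤ e)) → ω (does d) (does d′) + (3 * 𝟙 d + 2 * 𝟙 d′) ≡ 9
        by (yes _) (yes _) = refl
        by (yes _) (no _)  = refl
        by (no ¬a) (yes b) = ⊥-elim (¬a (≤-trans h₁≤h₂ b))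
        by (no _)  (no _)  = refl
      c₁ : ∑ (upTo p) (λ e → 𝟙 (h₁ ≤? e)) ≡ h₂
      c₁ = +-cancelʳ-≡ h₁ _ _ (trans (∑-upTo-≥ h₁ p (⌊n/2⌋≤n p)) (trans (sym h₁+h₂≡p) (+-comm h₁ h₂)))
      c₂ : ∑ (upTo p) (λ e → 𝟙 (h₂ ≤? e)) ≡ h₁
      c₂ = +-cancelʳ-≡ h₂ _ _ (trans (∑-upTo-≥ h₂ p (m∸n≤m p h₁)) (sym h₁+h₂≡p))
      weighted : total + (3 * h₂ + 2 * h₁) ≡ 9 * p
      weighted = trans (cong (total +_) (cong₂ _+_ (trans (cong (3 *_) (sym c₁)) (sym (∑-*ˡ (upTo p) 3 _))) (trans (cong (2 *_) (sym c₂)) (sym (∑-*ˡ (upTo p) 2 _)))))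
        (trans (cong (total +_) (sym (∑-+ (upTo p) (λ e → 3 * 𝟙 (h₁ ≤? e)) (λ e → 2 * 𝟙 (h₂ ≤? e)))))
        (trans (sym (∑-+ (upTo p) wt (λ e → 3 * 𝟙 (h₁ ≤? e) + 2 * 𝟙 (h₂ ≤? e)))) (trans (∑-cong (upTo p) pointwise) (trans (∑-upTo-const p 9) (*-comm p 9)))))

    wts : ∀ {n} → Vec ℕ n → ℕ
    wts []      = 1
    wts (e ∷ v) = wt e * wts v

    ∑-wts : ∀ n → ∑ (vecs (upTo p) n) wts ≡ total ^ n
    ∑-wts zero    = refl
    ∑-wts (suc n) = trans (∑-cartesianProductWith _∷_ (upTo p) (vecs (upTo p) n) wts)
      (trans (∑-product (upTo p) (vecs (upTo p) n) wt wts) (cong (total *_) (∑-wts n)))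

    wt-τ : ∀ e → 3 ^ τ e * wt e ≡ 9 * 2 ^ τ e
    wt-τ e = by (h₁ ≤? e) (h₂ ≤? e)
      where
      by : (d : Dec (h₁ ≤ e)) (d′ : Dec (h₂ ≤ e)) → 3 ^ (𝟙 d + 𝟙 d′) * ω (does d) (does d′) ≡ 9 * 2 ^ (𝟙 d + 𝟙 d′)
      by (yes _) (yes _) = refl
      by (yes _) (no _)  = refl
      by (no ¬a) (yes b) = ⊥-elim (¬a (≤-trans h₁≤h₂ b))
      by (no _)  (no _)  = refl

    wts-τs : ∀ {n} (v : Vec ℕ n) → 3 ^ τs v * wts v ≡ 9 ^ n * 2 ^ τs v
    wts-τs []              = refl
    wts-τs {suc n} (e ∷ v) = begin
      3 ^ (τ e + τs v) * (wt e * wts v)          ≡⟨ cong (_* (wt e * wts v)) (^-distribˡ-+-* 3 (τ e) (τs v)) ⟩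
      3 ^ τ e * 3 ^ τs v * (wt e * wts v)        ≡⟨ interchange (3 ^ τ e) (3 ^ τs v) (wt e) (wts v) ⟩
      3 ^ τ e * wt e * (3 ^ τs v * wts v)        ≡⟨ cong₂ _*_ (wt-τ e) (wts-τs v) ⟩
      9 * 2 ^ τ e * (9 ^ n * 2 ^ τs v)           ≡⟨ interchange 9 (2 ^ τ e) (9 ^ n) (2 ^ τs v) ⟩
      9 * 9 ^ n * (2 ^ τ e * 2 ^ τs v)           ≡⟨ cong (9 * 9 ^ n *_) (sym (^-distribˡ-+-* 2 (τ e) (τs v))) ⟩
      9 * 9 ^ n * 2 ^ (τ e + τs v)               ∎
      where
      open ≡-Reasoning
      interchange : ∀ a b c d → a * b * (c * d) ≡ a * c * (b * d)
      interchange = solve-∀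

    -- A low vector has weight at least (9 (2/3)^(2/3))^n, and 130/19 is a rational just below that
    -- base: 130³ · 9 ≤ 171³ · 4 with 171 = 9 · 19.
    low-heavy : ∀ {n} (v : Vec ℕ n) → 3 * τs v ≤ 2 * n → 130 ^ n ≤ 19 ^ n * wts v
    low-heavy {n} v low = *-cancelʳ-≤ _ _ (3 ^ τs v) {{>-nonZero (m^n>0 3 (τs v))}} (begin
      130 ^ n * 3 ^ τs v                ≤⟨ exchange 171 130 3 2 n (τs v) (s≤s z≤n) (s≤s (s≤s z≤n)) (≤ᵇ⇒≤ _ _ _) low ⟩
      171 ^ n * 2 ^ τs v                ≡⟨ trans (cong (_* 2 ^ τs v) (^-distrib 19 9 n)) (*-assoc (19 ^ n) (9 ^ n) _) ⟩
      19 ^ n * (9 ^ n * 2 ^ τs v)       ≡⟨ cong (19 ^ n *_) (sym (wts-τs v)) ⟩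
      19 ^ n * (3 ^ τs v * wts v)       ≡⟨ swap (19 ^ n) (3 ^ τs v) (wts v) ⟩
      19 ^ n * wts v * 3 ^ τs v         ∎)
      where
      open ≤-Reasoning
      swap : ∀ a b c → a * (b * c) ≡ a * c * b
      swap = solve-∀

    -- The total weight is at most (13p/2)^n and each low vector has weight at least (130/19)^n; the
    -- quotient of the bases is (19/20) p, which is the reason for choosing 130/19.
    low-count : ∀ n → length (Low n) * 20 ^ n ≤ 19 ^ n * p ^ n
    low-count n = *-cancelʳ-≤ _ _ (13 ^ n) {{>-nonZero (m^n>0 13 n)}} (begin
      length (Low n) * 20 ^ n * 13 ^ n
        ≡⟨ trans (*-assoc (length (Low n)) (20 ^ n) (13 ^ n)) (cong (length (Low n) *_) (trans (sym (^-distrib 20 13 n)) (^-distrib 2 130 n))) ⟩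
      length (Low n) * (2 ^ n * 130 ^ n)
        ≡⟨ swap (length (Low n)) (2 ^ n) (130 ^ n) ⟩
      2 ^ n * (length (Low n) * 130 ^ n)
        ≤⟨ *-monoʳ-≤ (2 ^ n) count ⟩
      2 ^ n * (19 ^ n * total ^ n)
        ≡⟨ trans (swap (2 ^ n) (19 ^ n) (total ^ n)) (cong (19 ^ n *_) (sym (^-distrib 2 total n))) ⟩
      19 ^ n * (2 * total) ^ n
        ≤⟨ *-monoʳ-≤ (19 ^ n) (^-monoˡ-≤ n 2total≤13p) ⟩
      19 ^ n * (13 * p) ^ n
        ≡⟨ trans (cong (19 ^ n *_) (trans (^-distrib 13 p n) (*-comm (13 ^ n) (p ^ n)))) (sym (*-assoc (19 ^ n) _ _)) ⟩
      19 ^ n * p ^ n * 13 ^ n ∎)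
      where
      open ≤-Reasoning
      swap : ∀ a b c → a * (b * c) ≡ b * (a * c)
      swap = solve-∀
      count : length (Low n) * 130 ^ n ≤ 19 ^ n * total ^ n
      count = begin
        length (Low n) * 130 ^ n                     ≡⟨ sym (∑-const (Low n) (130 ^ n)) ⟩
        ∑ (Low n) (λ _ → 130 ^ n)                    ≤⟨ ∑-mono∈ (Low n) (λ {v} v∈ → low-heavy v (proj₂ (∈-filter⁻ Low? {xs = vecs (upTo p) n} v∈))) ⟩
        ∑ (Low n) (λ v → 19 ^ n * wts v)             ≡⟨ ∑-filter Low? (vecs (upTo p) n) (λ v → 19 ^ n * wts v) ⟩
        ∑ (vecs (upTo p) n) (λ v → 𝟙 (Low? v) * (19 ^ n * wts v))
          ≤⟨ ∑-mono (vecs (upTo p) n) (λ v → ≤-trans (*-monoˡ-≤ (19 ^ n * wts v) (𝟙≤1 (Low? v))) (≤-reflexive (+-identityʳ _))) ⟩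
        ∑ (vecs (upTo p) n) (λ v → 19 ^ n * wts v)   ≡⟨ trans (∑-*ˡ (vecs (upTo p) n) (19 ^ n) wts) (cong (19 ^ n *_) (∑-wts n)) ⟩
        19 ^ n * total ^ n                           ∎

  -- Cutting by random hyperplanes

  sub : ∀ {n} → Vec ℤ n → Vec ℤ n → Vec ℤ n
  sub []      []      = []
  sub (x ∷ X) (y ∷ Y) = (x -ᶻ y) ∷ sub X Y

  dot : ∀ {n} → Vec ℕ n → Vec ℤ n → ℤ
  dot []      []      = 0ℤ
  dot (r ∷ R) (x ∷ X) = pos r *ᶻ x +ᶻ dot R X

  dot-tri : ∀ {n} (r : Vec ℕ n) X Y Z → dot r (tri X Y Z) ≡ dot r X +ᶻ dot r Y -ᶻ dot r Z
  dot-tri []      []      []      []      = refl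
  dot-tri (r ∷ R) (x ∷ X) (y ∷ Y) (z ∷ Z) = trans (cong (pos r *ᶻ (x +ᶻ y -ᶻ z) +ᶻ_) (dot-tri R X Y Z))
    (regroup (pos r) x y z (dot R X) (dot R Y) (dot R Z))
    where
    regroup : ∀ r x y z a b c → r *ᶻ (x +ᶻ y -ᶻ z) +ᶻ (a +ᶻ b -ᶻ c) ≡ r *ᶻ x +ᶻ a +ᶻ (r *ᶻ y +ᶻ b) -ᶻ (r *ᶻ z +ᶻ c)
    regroup = solve-∀ᶻ

  dot-sub : ∀ {n} (r : Vec ℕ n) X Y → dot r (sub X Y) ≡ dot r X -ᶻ dot r Y
  dot-sub []      []      []      = refl
  dot-sub (r ∷ R) (x ∷ X) (y ∷ Y) = trans (cong (pos r *ᶻ (x -ᶻ y) +ᶻ_) (dot-sub R X Y))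
    (regroup (pos r) x y (dot R X) (dot R Y))
    where
    regroup : ∀ r x y a b → r *ᶻ (x -ᶻ y) +ᶻ (a -ᶻ b) ≡ r *ᶻ x +ᶻ a -ᶻ (r *ᶻ y +ᶻ b)
    regroup = solve-∀ᶻ

  module Linear (p : ℕ) (p-prime : Prime p) where

    open Mod p p-prime
    open TriColoured p p-prime using (Zero; p-nonZero)

    Zero? : ∀ {n} (v : Vec ℤ n) → Dec (Zero v)
    Zero? = VAll.all? D?

    D-dot : ∀ {n} (r : Vec ℕ n) v → Zero v → D (dot r v)
    D-dot []      []      VAll.[]      = D-0
    D-dot (r ∷ R) (x ∷ X) (z VAll.∷ Z) = ∣m∣n⇒∣m+n (∣n⇒∣m*n (pos r) z) (D-dot R X Z)

    D-small⇒≡ : ∀ {r s} → r < p → s < p → D (pos r -ᶻ pos s) → r ≡ s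
    D-small⇒≡ {r} {s} r< s< d = ≤-antisym (below r< d) (below s< (subst D (flip (pos r) (pos s)) (∣m⇒∣-m d)))
      where
      flip : ∀ a b → -ᶻ (a -ᶻ b) ≡ b -ᶻ a
      flip = solve-∀ᶻ
      below : ∀ {r s} → r < p → D (pos r -ᶻ pos s) → r ≤ s
      below {r} {s} r< d with r ≤? s
      ... | yes le = le
      ... | no ¬le = ⊥-elim (¬D-small (m<n⇒0<n∸m (≰⇒> ¬le)) (≤-<-trans (m∸n≤m r s) r<)
              (subst D (trans (ℤP.m-n≡m⊖n r s) (ℤP.⊖-≥ (<⇒≤ (≰⇒> ¬le)))) d))

    %-sub : ∀ a → D (a -ᶻ pos (a %ℕ p))
    %-sub a = subst D (sym (trans (cong (_-ᶻ pos (a %ℕ p)) (a≡a%ℕn+[a/ℕn]*n a p)) (cancel (pos (a %ℕ p)) (a /ℕ p *ᶻ pos p))))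
      (∣n⇒∣m*n (a /ℕ p) (∣ᵤ⇒∣ (divides 1 (sym (*-identityˡ p)))))
      where
      cancel : ∀ r q → r +ᶻ q -ᶻ r ≡ q
      cancel = solve-∀ᶻ

    %-≡⇒D : ∀ a b → a %ℕ p ≡ b %ℕ p → D (a -ᶻ b)
    %-≡⇒D a b e = subst D (trans (cong (λ r → a -ᶻ pos (a %ℕ p) -ᶻ (b -ᶻ pos r)) (sym e)) (cancel a b (pos (a %ℕ p)))) (∣m∣n⇒∣m-n (%-sub a) (%-sub b))
      where
      cancel : ∀ a b r → a -ᶻ r -ᶻ (b -ᶻ r) ≡ a -ᶻ b
      cancel = solve-∀ᶻ

    ∑-vecs-suc : ∀ n (f : Vec ℕ (suc n) → ℕ) → ∑ (vecs (upTo p) (suc n)) f ≡ ∑[ ρ ∈ upTo p ] ∑[ r ∈ vecs (upTo p) n ] f (ρ ∷ r)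
    ∑-vecs-suc n f = ∑-cartesianProductWith _∷_ (upTo p) (vecs (upTo p) n) f

    length-vecs : ∀ n → length (vecs (upTo p) n) ≡ p ^ n
    length-vecs zero    = refl
    length-vecs (suc n) = trans (sym (∑-1 (vecs (upTo p) (suc n)))) (trans (∑-vecs-suc n (λ _ → 1))
      (trans (∑-cong (upTo p) (λ _ → trans (∑-1 (vecs (upTo p) n)) (length-vecs n))) (∑-upTo-const p (p ^ n))))

    -- If the tail of the vector is nonzero, induct for each first coefficient, absorbing it into
    -- the constant. Otherwise the head is nonzero, and for fixed remaining coefficients at most one
    -- first coefficient works.
    hyperplane : ∀ {n} (d : Vec ℤ n) → ¬ Zero d → ∀ c → p * (∑[ r ∈ vecs (upTo p) n ] 𝟙 (D? (c +ᶻ dot r d))) ≤ p ^ n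
    hyperplane []          ¬Z c = ⊥-elim (¬Z VAll.[])
    hyperplane {suc n} (δ ∷ d) ¬Z c = *-monoʳ-≤ p (≤-trans (≤-reflexive (∑-vecs-suc n (λ r → 𝟙 (D? (c +ᶻ dot r (δ ∷ d)))))) (by (Zero? d)))
      where
      f : ℕ → Vec ℕ n → ℕ
      f ρ r = 𝟙 (D? (c +ᶻ (pos ρ *ᶻ δ +ᶻ dot r d)))
      by : Dec (Zero d) → ∑ (upTo p) (λ ρ → ∑ (vecs (upTo p) n) (f ρ)) ≤ p ^ n
      by (no ¬Zd) = *-cancelˡ-≤ p (≤-trans (≤-reflexive (sym (∑-*ˡ (upTo p) p (λ ρ → ∑ (vecs (upTo p) n) (f ρ)))))
        (≤-trans (∑-mono (upTo p) (λ ρ → ≤-trans (≤-reflexive (cong (p *_) (∑-cong (vecs (upTo p) n)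
            (λ r → cong (λ w → 𝟙 (D? w)) (sym (ℤP.+-assoc c (pos ρ *ᶻ δ) (dot r d))))))) (hyperplane d ¬Zd (c +ᶻ pos ρ *ᶻ δ))))
          (≤-reflexive (∑-upTo-const p (p ^ n)))))
      by (yes Zd) = ≤-trans (≤-reflexive (∑-swap (upTo p) (vecs (upTo p) n) f))
        (≤-trans (∑≤length (vecs (upTo p) n) (λ {r} _ → #-atMostOne (λ ρ → D? (c +ᶻ (pos ρ *ᶻ δ +ᶻ dot r d))) (upTo p) (upTo⁺ p)
            (λ {ρ} {ρ′} ρ∈ ρ′∈ q q′ → D-small⇒≡ (∈-upTo⁻ ρ∈) (∈-upTo⁻ ρ′∈)
              ([ id , (λ Dδ → ⊥-elim (¬Z (Dδ VAll.∷ Zd))) ]′ (D-* (pos ρ -ᶻ pos ρ′) δ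
                (subst D (cancel c (pos ρ) (pos ρ′) δ (dot r d)) (∣m∣n⇒∣m-n q q′)))))))
          (≤-reflexive (length-vecs n)))
        where
        cancel : ∀ c a b δ x → c +ᶻ (a *ᶻ δ +ᶻ x) -ᶻ (c +ᶻ (b *ᶻ δ +ᶻ x)) ≡ (a -ᶻ b) *ᶻ δ
        cancel = solve-∀ᶻ

    -- The first coordinate has coefficient 1, so it can be dropped on a hyperplane where L r is constant.
    L : ∀ {n} → Vec ℕ n → Vec ℤ (suc n) → ℤ
    L r (x ∷ X) = x +ᶻ dot r X

    L-tri : ∀ {n} (r : Vec ℕ n) X Y Z → L r (tri X Y Z) ≡ L r X +ᶻ L r Y -ᶻ L r Z
    L-tri r (x ∷ X) (y ∷ Y) (z ∷ Z) = trans (cong (x +ᶻ y -ᶻ z +ᶻ_) (dot-tri r X Y Z)) (regroup x y z (dot r X) (dot r Y) (dot r Z))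
      where
      regroup : ∀ x y z a b c → x +ᶻ y -ᶻ z +ᶻ (a +ᶻ b -ᶻ c) ≡ x +ᶻ a +ᶻ (y +ᶻ b) -ᶻ (z +ᶻ c)
      regroup = solve-∀ᶻ

    L-sub : ∀ {n} (r : Vec ℕ n) X Y → L r (sub X Y) ≡ L r X -ᶻ L r Y
    L-sub r (x ∷ X) (y ∷ Y) = trans (cong (x -ᶻ y +ᶻ_) (dot-sub r X Y)) (regroup x y (dot r X) (dot r Y))
      where
      regroup : ∀ x y a b → x -ᶻ y +ᶻ (a -ᶻ b) ≡ x +ᶻ a -ᶻ (y +ᶻ b)
      regroup = solve-∀ᶻ

    L-zero : ∀ {n} (r : Vec ℕ n) v → Zero v → D (L r v)
    L-zero r (x ∷ X) (z VAll.∷ Z) = ∣m∣n⇒∣m+n z (D-dot r X Z)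

    L-recover : ∀ {n} (r : Vec ℕ n) v → D (L r v) → Zero (Vec.tail v) → Zero v
    L-recover r (x ∷ X) d Z = subst D (cancel x (dot r X)) (∣m∣n⇒∣m-n d (D-dot r X Z)) VAll.∷ Z
      where
      cancel : ∀ x a → x +ᶻ a -ᶻ a ≡ x
      cancel = solve-∀ᶻ

    -- Fixing the first coefficient at 1 keeps the probability at most 1/p: if the tail of `d`
    -- vanishes, `L r d` is congruent to its nonzero head for every `r`.
    L-hyperplane : ∀ {n} (d : Vec ℤ (suc n)) → ¬ Zero d → p * (∑[ r ∈ vecs (upTo p) n ] 𝟙 (D? (L r d))) ≤ p ^ n
    L-hyperplane {n} (δ ∷ d) ¬Z with Zero? d
    ... | no ¬Zd = hyperplane d ¬Zd δ
    ... | yes Zd = ≤-trans (≤-reflexive (trans (cong (p *_) (∑-0 (vecs (upTo p) n) (λ r → 𝟙-no (D? (L r (δ ∷ d))) (λ q → ¬Z (L-recover r (δ ∷ d) q Zd))))) (*-zeroʳ p))) z≤n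

    tail-tri : ∀ {n} (X Y Z : Vec ℤ (suc n)) → Vec.tail (tri X Y Z) ≡ tri (Vec.tail X) (Vec.tail Y) (Vec.tail Z)
    tail-tri (_ ∷ _) (_ ∷ _) (_ ∷ _) = refl

    tail-sub : ∀ {n} (X Y : Vec ℤ (suc n)) → Vec.tail (sub X Y) ≡ sub (Vec.tail X) (Vec.tail Y)
    tail-sub (_ ∷ _) (_ ∷ _) = refl

    Zero-tri-sub : ∀ {n} (X Y Z Z′ : Vec ℤ n) → Zero (tri X Y Z) → Zero (tri X Y Z′) → Zero (sub Z Z′)
    Zero-tri-sub []      []      []      []        VAll.[]      VAll.[]      = VAll.[]
    Zero-tri-sub (x ∷ X) (y ∷ Y) (z ∷ Z) (z′ ∷ Z′) (d VAll.∷ ds) (e VAll.∷ es) =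
      subst D (cancel x y z z′) (∣m∣n⇒∣m-n e d) VAll.∷ Zero-tri-sub X Y Z Z′ ds es
      where
      cancel : ∀ x y z z′ → x +ᶻ y -ᶻ z′ -ᶻ (x +ᶻ y -ᶻ z) ≡ z -ᶻ z′
      cancel = solve-∀ᶻ

    tail-zero : ∀ {n} (X : Vec ℤ (suc n)) → Zero X → Zero (Vec.tail X)
    tail-zero (_ ∷ _) (_ VAll.∷ Z) = Z

  lookup-injective : ∀ {a} {A : Set a} (L : List A) → Unique L → ∀ i j → lookup L i ≡ lookup L j → i ≡ j
  lookup-injective (x ∷ L) (x∉ ∷ u) fzero    fzero    e = refl
  lookup-injective (x ∷ L) (x∉ ∷ u) fzero    (fsuc j) e = ⊥-elim (All.lookup x∉ (∈-lookup j) e)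
  lookup-injective (x ∷ L) (x∉ ∷ u) (fsuc i) fzero    e = ⊥-elim (All.lookup x∉ (∈-lookup i) (sym e))
  lookup-injective (x ∷ L) (x∉ ∷ u) (fsuc i) (fsuc j) e = cong fsuc (lookup-injective L u i j e)

  module Configurations (p : ℕ) (p-prime : Prime p) {m : ℕ} where

    open Mod p p-prime
    open TriColoured p p-prime using (Zero; p-nonZero; Low; tricoloured)
    open Linear p p-prime

    Triple : Set
    Triple = Fin m × Fin m × Fin m

    _≟ᵗ_ : (τ σ : Triple) → Dec (τ ≡ σ)
    (i , j , k) ≟ᵗ (i′ , j′ , k′) with i ≟ᶠ i′ | j ≟ᶠ j′ | k ≟ᶠ k′
    ... | yes refl | yes refl | yes refl = yes refl
    ... | no ne    | _        | _        = no (λ { refl → ne refl })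
    ... | yes _    | no ne    | _        = no (λ { refl → ne refl })
    ... | yes _    | yes _    | no ne    = no (λ { refl → ne refl })

    ix iy iz : Triple → Fin m
    ix (i , _ , _) = i
    iy (_ , j , _) = j
    iz (_ , _ , k) = k

    Conflict : Triple → Triple → Set
    Conflict τ σ = τ ≢ σ × (ix τ ≡ ix σ ⊎ iy τ ≡ iy σ ⊎ iz τ ≡ iz σ)

    conflict? : ∀ τ σ → Dec (Conflict τ σ)
    conflict? τ σ = ¬? (τ ≟ᵗ σ) ×-dec ((ix τ ≟ᶠ ix σ) ⊎-dec (iy τ ≟ᶠ iy σ) ⊎-dec (iz τ ≟ᶠ iz σ))

    conflicts : List Triple → ℕ
    conflicts 𝒯 = ∑[ τ ∈ 𝒯 ] ∑[ σ ∈ 𝒯 ] 𝟙 (conflict? τ σ)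

    -- `closed` makes the list contain every solution built from coordinates that occur in it.
    -- Without it, isolation within the list would not exclude solutions mixing several members.
    record Config {n : ℕ} (x y z : Fin m → Vec ℤ n) (𝒯 : List Triple) : Set where
      field
        unique : Unique 𝒯
        solves : ∀ {τ} → τ ∈ 𝒯 → Zero (tri (x (ix τ)) (y (iy τ)) (z (iz τ)))
        closed : ∀ {τ σ υ} → τ ∈ 𝒯 → σ ∈ 𝒯 → υ ∈ 𝒯 → Zero (tri (x (ix τ)) (y (iy σ)) (z (iz υ))) → (ix τ , iy σ , iz υ) ∈ 𝒯
        x-inj  : ∀ {τ σ} → τ ∈ 𝒯 → σ ∈ 𝒯 → Zero (sub (x (ix τ)) (x (ix σ))) → ix τ ≡ ix σ
        y-inj  : ∀ {τ σ} → τ ∈ 𝒯 → σ ∈ 𝒯 → Zero (sub (y (iy τ)) (y (iy σ))) → iy τ ≡ iy σ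
        z-inj  : ∀ {τ σ} → τ ∈ 𝒯 → σ ∈ 𝒯 → Zero (sub (z (iz τ)) (z (iz σ))) → iz τ ≡ iz σ

    module _ {n : ℕ} {x y z : Fin m → Vec ℤ n} {𝒯 : List Triple} (C : Config x y z 𝒯) where
      open Config C

      Isolated : Triple → Set
      Isolated τ = ¬ Any (Conflict τ) 𝒯

      isolated? : ∀ τ → Dec (Isolated τ)
      isolated? τ = ¬? (Any.any? (conflict? τ) 𝒯)

      isolated-≡ : ∀ {τ σ} → τ ∈ 𝒯 → Isolated τ → σ ∈ 𝒯 → (ix τ ≡ ix σ ⊎ iy τ ≡ iy σ ⊎ iz τ ≡ iz σ) → τ ≡ σ
      isolated-≡ {τ} {σ} τ∈ iso σ∈ shared with τ ≟ᵗ σ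
      ... | yes e = e
      ... | no ne = ⊥-elim (iso (lose σ∈ (ne , shared)))

      -- A solution mixing the coordinates of isolated triples belongs to the list by `closed` and
      -- shares an index with each of them, so isolation identifies all of them. This is the
      -- hypothesis of `tricoloured`.
      few-isolated : length (filter isolated? 𝒯) ≤ 3 * length (Low n)
      few-isolated = tricoloured (λ i → x (ix (at i))) (λ i → y (iy (at i))) (λ i → z (iz (at i)))
        (λ i → solves (in𝒯 i)) (λ i j k Z → let c = closed (in𝒯 i) (in𝒯 j) (in𝒯 k) Z in
          at-inj i j (trans (isolated-≡ (in𝒯 i) (iso i) c (inj₁ refl)) (sym (isolated-≡ (in𝒯 j) (iso j) c (inj₂ (inj₁ refl))))) ,
          at-inj i k (trans (isolated-≡ (in𝒯 i) (iso i) c (inj₁ refl)) (sym (isolated-≡ (in𝒯 k) (iso k) c (inj₂ (inj₂ refl))))))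
        where
        at : Fin (length (filter isolated? 𝒯)) → Triple
        at = lookup (filter isolated? 𝒯)
        at-inj : ∀ i j → at i ≡ at j → i ≡ j
        at-inj = lookup-injective (filter isolated? 𝒯) (filter⁺ isolated? unique)
        in𝒯 : ∀ i → at i ∈ 𝒯
        in𝒯 i = proj₁ (∈-filter⁻ isolated? {xs = 𝒯} (∈-lookup i))
        iso : ∀ i → Isolated (at i)
        iso i = proj₂ (∈-filter⁻ isolated? {xs = 𝒯} (∈-lookup i))

      triples-bound : length 𝒯 ≤ conflicts 𝒯 + 3 * length (Low n)
      triples-bound = begin
        length 𝒯                     ≡⟨ sym (∑-1 𝒯) ⟩
        ∑ 𝒯 (λ _ → 1)                ≤⟨ ∑-mono 𝒯 pointwise ⟩
        ∑ 𝒯 (λ τ → ∑ 𝒯 (λ σ → 𝟙 (conflict? τ σ)) + 𝟙 (isolated? τ))  ≡⟨ ∑-+ 𝒯 _ _ ⟩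
        conflicts 𝒯 + # isolated? 𝒯  ≡⟨ cong (conflicts 𝒯 +_) (sym (length-filter-# isolated? 𝒯)) ⟩
        conflicts 𝒯 + length (filter isolated? 𝒯)  ≤⟨ +-monoʳ-≤ (conflicts 𝒯) few-isolated ⟩
        conflicts 𝒯 + 3 * length (Low n) ∎
        where
        open ≤-Reasoning
        pointwise : ∀ τ → 1 ≤ ∑ 𝒯 (λ σ → 𝟙 (conflict? τ σ)) + 𝟙 (isolated? τ)
        pointwise τ with Any.any? (conflict? τ) 𝒯
        ... | no _  = m≤n+m 1 _
        ... | yes c with find c
        ...   | σ , σ∈ , cf = ≤-trans (≤-trans (≤-reflexive (sym (𝟙-yes (conflict? τ σ) cf))) (∑-member 𝒯 (λ σ → 𝟙 (conflict? τ σ)) σ∈)) (m≤m+n _ 0)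

    module Cut {n : ℕ} {x y z : Fin m → Vec ℤ (suc n)} {𝒯 : List Triple} (C : Config x y z 𝒯) where
      open Config C

      -- A random direction r with independent offsets s for the x's and t for the y's; the offset
      -- of the z's is then forced by the equation. For every r a triple is kept by exactly one pair
      -- of offsets, wherever it lies, so it survives with probability p^(-2).
      Choice : Set
      Choice = Vec ℕ n × ℕ × ℕ

      keep : Choice → Triple → Set
      keep (r , s , t) τ = L r (x (ix τ)) %ℕ p ≡ s × L r (y (iy τ)) %ℕ p ≡ t

      keep? : ∀ c τ → Dec (keep c τ)
      keep? (r , s , t) τ = (L r (x (ix τ)) %ℕ p ≟ s) ×-dec (L r (y (iy τ)) %ℕ p ≟ t)

      cut : Choice → List Triple
      cut c = filter (keep? c) 𝒯

      -- On kept triples `L r` is constant on each of the x's, y's and z's, with the third constant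
      -- the sum of the other two. A relation between tails therefore lifts back to the full vectors
      -- by `L-recover`.
      cut-config : ∀ c → Config (Vec.tail ∘ x) (Vec.tail ∘ y) (Vec.tail ∘ z) (cut c)
      cut-config c@(r , s , t) = record
        { unique = filter⁺ (keep? c) unique
        ; solves = λ {τ} τ∈ → subst Zero (tail-tri (x (ix τ)) (y (iy τ)) (z (iz τ))) (tail-zero (tri (x (ix τ)) (y (iy τ)) (z (iz τ))) (solves (in𝒯 τ∈)))
        ; closed = λ {τ} {σ} {υ} τ∈ σ∈ υ∈ Z → ∈-filter⁺ (keep? c) (closed (in𝒯 τ∈) (in𝒯 σ∈) (in𝒯 υ∈) (lift τ σ υ τ∈ σ∈ υ∈ Z)) (proj₁ (kept τ∈) , proj₂ (kept σ∈))
        ; x-inj  = λ {τ} {σ} τ∈ σ∈ Z → x-inj (in𝒯 τ∈) (in𝒯 σ∈) (L-recover r (sub (x (ix τ)) (x (ix σ)))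
            (subst D (sym (L-sub r (x (ix τ)) (x (ix σ)))) (x-same τ σ τ∈ σ∈)) (subst Zero (sym (tail-sub (x (ix τ)) (x (ix σ)))) Z))
        ; y-inj  = λ {τ} {σ} τ∈ σ∈ Z → y-inj (in𝒯 τ∈) (in𝒯 σ∈) (L-recover r (sub (y (iy τ)) (y (iy σ)))
            (subst D (sym (L-sub r (y (iy τ)) (y (iy σ)))) (y-same τ σ τ∈ σ∈)) (subst Zero (sym (tail-sub (y (iy τ)) (y (iy σ)))) Z))
        ; z-inj  = λ {τ} {σ} τ∈ σ∈ Z → z-inj (in𝒯 τ∈) (in𝒯 σ∈) (L-recover r (sub (z (iz τ)) (z (iz σ)))
            (subst D (sym (L-sub r (z (iz τ)) (z (iz σ)))) (z-same τ σ τ∈ σ∈)) (subst Zero (sym (tail-sub (z (iz τ)) (z (iz σ)))) Z)) }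
        where
        in𝒯 : ∀ {τ} → τ ∈ cut c → τ ∈ 𝒯
        in𝒯 τ∈ = proj₁ (∈-filter⁻ (keep? c) {xs = 𝒯} τ∈)
        kept : ∀ {τ} → τ ∈ cut c → L r (x (ix τ)) %ℕ p ≡ s × L r (y (iy τ)) %ℕ p ≡ t
        kept τ∈ = proj₂ (∈-filter⁻ (keep? c) {xs = 𝒯} τ∈)
        x-same : ∀ τ σ → τ ∈ cut c → σ ∈ cut c → D (L r (x (ix τ)) -ᶻ L r (x (ix σ)))
        x-same τ σ τ∈ σ∈ = %-≡⇒D (L r (x (ix τ))) (L r (x (ix σ))) (trans (proj₁ (kept τ∈)) (sym (proj₁ (kept σ∈))))
        y-same : ∀ τ σ → τ ∈ cut c → σ ∈ cut c → D (L r (y (iy τ)) -ᶻ L r (y (iy σ)))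
        y-same τ σ τ∈ σ∈ = %-≡⇒D (L r (y (iy τ))) (L r (y (iy σ))) (trans (proj₂ (kept τ∈)) (sym (proj₂ (kept σ∈))))
        solved : ∀ τ → τ ∈ cut c → D (L r (x (ix τ)) +ᶻ L r (y (iy τ)) -ᶻ L r (z (iz τ)))
        solved τ τ∈ = subst D (L-tri r (x (ix τ)) (y (iy τ)) (z (iz τ))) (L-zero r (tri (x (ix τ)) (y (iy τ)) (z (iz τ))) (solves (in𝒯 τ∈)))
        z-same : ∀ τ σ → τ ∈ cut c → σ ∈ cut c → D (L r (z (iz τ)) -ᶻ L r (z (iz σ)))
        z-same τ σ τ∈ σ∈ = subst D (collect (L r (x (ix τ))) (L r (y (iy τ))) (L r (z (iz τ))) (L r (x (ix σ))) (L r (y (iy σ))) (L r (z (iz σ))))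
          (∣m∣n⇒∣m-n (∣m∣n⇒∣m+n (x-same τ σ τ∈ σ∈) (y-same τ σ τ∈ σ∈)) (∣m∣n⇒∣m-n (solved τ τ∈) (solved σ σ∈)))
          where
          collect : ∀ a b c a′ b′ c′ → a -ᶻ a′ +ᶻ (b -ᶻ b′) -ᶻ (a +ᶻ b -ᶻ c -ᶻ (a′ +ᶻ b′ -ᶻ c′)) ≡ c -ᶻ c′
          collect = solve-∀ᶻ
        lift : ∀ τ σ υ → τ ∈ cut c → σ ∈ cut c → υ ∈ cut c → Zero (tri (Vec.tail (x (ix τ))) (Vec.tail (y (iy σ))) (Vec.tail (z (iz υ)))) →
          Zero (tri (x (ix τ)) (y (iy σ)) (z (iz υ)))
        lift τ σ υ τ∈ σ∈ υ∈ Z = L-recover r (tri (x (ix τ)) (y (iy σ)) (z (iz υ)))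
          (subst D (sym (L-tri r (x (ix τ)) (y (iy σ)) (z (iz υ))))
            (subst D (collect (L r (x (ix τ))) (L r (y (iy σ))) (L r (z (iz υ))) (L r (x (ix υ))) (L r (y (iy υ))))
              (∣m∣n⇒∣m+n (∣m∣n⇒∣m+n (x-same τ υ τ∈ υ∈) (y-same σ υ σ∈ υ∈)) (solved υ υ∈))))
          (subst Zero (sym (tail-tri (x (ix τ)) (y (iy σ)) (z (iz υ)))) Z)
          where
          collect : ∀ a b c a′ b′ → a -ᶻ a′ +ᶻ (b -ᶻ b′) +ᶻ (a′ +ᶻ b′ -ᶻ c) ≡ a +ᶻ b -ᶻ c
          collect = solve-∀ᶻ

      choices : List Choice
      choices = cartesianProduct (vecs (upTo p) n) (cartesianProduct (upTo p) (upTo p))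

      ∑-choices : (f : Choice → ℕ) → ∑ choices f ≡ ∑[ r ∈ vecs (upTo p) n ] ∑[ s ∈ upTo p ] ∑[ t ∈ upTo p ] f (r , s , t)
      ∑-choices f = trans (∑-cartesianProduct (vecs (upTo p) n) (cartesianProduct (upTo p) (upTo p)) f)
        (∑-cong (vecs (upTo p) n) (λ r → ∑-cartesianProduct (upTo p) (upTo p) (λ st → f (r , st))))

      length-choices : length choices ≡ p ^ n * (p * p)
      length-choices = trans (sym (∑-1 choices)) (trans (∑-choices (λ _ → 1))
        (trans (∑-cong (vecs (upTo p) n) (λ _ → trans (∑-cong (upTo p) (λ _ → trans (∑-upTo-const p 1) (*-identityʳ p))) (∑-upTo-const p p)))
          (trans (∑-const (vecs (upTo p) n) (p * p)) (cong (_* (p * p)) (length-vecs n)))))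

      one-residue : ∀ a → ∑[ s ∈ upTo p ] 𝟙 (a %ℕ p ≟ s) ≡ 1
      one-residue a = trans (∑-cong (upTo p) (λ s → sym (*-identityʳ (𝟙 (a %ℕ p ≟ s))))) (∑-δ _≟_ (upTo p) (λ _ → 1) (upTo⁺ p) (∈-upTo⁺ (n%ℕd<d a p)))

      kept-once : ∀ r τ → ∑[ s ∈ upTo p ] ∑[ t ∈ upTo p ] 𝟙 (keep? (r , s , t) τ) ≡ 1
      kept-once r τ = trans (∑-cong (upTo p) (λ s → ∑-cong (upTo p) (λ t → 𝟙-× (a %ℕ p ≟ s) (b %ℕ p ≟ t))))
        (trans (∑-product (upTo p) (upTo p) (λ s → 𝟙 (a %ℕ p ≟ s)) (λ t → 𝟙 (b %ℕ p ≟ t))) (cong₂ _*_ (one-residue a) (one-residue b)))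
        where
        a b : ℤ
        a = L r (x (ix τ))
        b = L r (y (iy τ))

      average-size : ∑[ c ∈ choices ] length (cut c) ≡ p ^ n * length 𝒯
      average-size = trans (∑-cong choices (λ c → length-filter-# (keep? c) 𝒯)) (trans (∑-swap choices 𝒯 (λ c τ → 𝟙 (keep? c τ)))
        (trans (∑-cong 𝒯 (λ τ → trans (∑-choices (λ c → 𝟙 (keep? c τ))) (trans (∑-cong (vecs (upTo p) n) (λ r → kept-once r τ))
          (trans (∑-1 (vecs (upTo p) n)) (length-vecs n))))) (trans (∑-const 𝒯 (p ^ n)) (*-comm (length 𝒯) (p ^ n)))))

      both-kept : Triple → Triple → ℕ
      both-kept τ σ = ∑[ c ∈ choices ] 𝟙 (keep? c τ) * 𝟙 (keep? c σ)

      both-kept-bound : ∀ τ σ (d : Vec ℤ (suc n)) → ¬ Zero d →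
        (∀ c → keep c τ → keep c σ → D (L (proj₁ c) d)) → p * both-kept τ σ ≤ p ^ n
      both-kept-bound τ σ d ¬Z h = ≤-trans (*-monoʳ-≤ p (≤-trans (≤-reflexive (∑-choices (λ c → 𝟙 (keep? c τ) * 𝟙 (keep? c σ))))
          (∑-mono (vecs (upTo p) n) (λ r → per-row r (D? (L r d)))))) (L-hyperplane d ¬Z)
        where
        row : Vec ℕ n → ℕ
        row r = ∑[ s ∈ upTo p ] ∑[ t ∈ upTo p ] 𝟙 (keep? (r , s , t) τ) * 𝟙 (keep? (r , s , t) σ)
        per-row : ∀ r → (e : Dec (D (L r d))) → row r ≤ 𝟙 e
        per-row r (yes _) = ≤-trans (∑-mono (upTo p) (λ s → ∑-mono (upTo p) (λ t →
            ≤-trans (*-monoʳ-≤ (𝟙 (keep? (r , s , t) τ)) (𝟙≤1 (keep? (r , s , t) σ))) (≤-reflexive (*-identityʳ _))))) (≤-reflexive (kept-once r τ))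
        per-row r (no ¬d) = ≤-reflexive (∑-0 (upTo p) (λ s → ∑-0 (upTo p) (λ t → never s t)))
          where
          never : ∀ s t → 𝟙 (keep? (r , s , t) τ) * 𝟙 (keep? (r , s , t) σ) ≡ 0
          never s t = trans (sym (𝟙-× (keep? (r , s , t) τ) (keep? (r , s , t) σ)))
            (𝟙-no (keep? (r , s , t) τ ×-dec keep? (r , s , t) σ) (λ { (kτ , kσ) → ¬d (h (r , s , t) kτ kσ) }))

      -- Distinct triples differ in x or in y, since equal x and y force equal z. The nonzero
      -- difference must be annihilated by `L r`, which costs a further factor p beyond the p² for
      -- keeping one triple.
      both-kept-conflict : ∀ {τ σ} → τ ∈ 𝒯 → σ ∈ 𝒯 → Conflict τ σ → p * both-kept τ σ ≤ p ^ n
      both-kept-conflict {τ} {σ} τ∈ σ∈ (τ≢σ , _) = by (Zero? (sub (x (ix τ)) (x (ix σ)))) (Zero? (sub (y (iy τ)) (y (iy σ))))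
        where
        by : Dec (Zero (sub (x (ix τ)) (x (ix σ)))) → Dec (Zero (sub (y (iy τ)) (y (iy σ)))) → p * both-kept τ σ ≤ p ^ n
        by (no ¬Z) _ = both-kept-bound τ σ (sub (x (ix τ)) (x (ix σ))) ¬Z (λ { (r , s , t) (e , _) (e′ , _) →
          subst D (sym (L-sub r (x (ix τ)) (x (ix σ)))) (%-≡⇒D (L r (x (ix τ))) (L r (x (ix σ))) (trans e (sym e′))) })
        by (yes _) (no ¬Z) = both-kept-bound τ σ (sub (y (iy τ)) (y (iy σ))) ¬Z (λ { (r , s , t) (_ , e) (_ , e′) →
          subst D (sym (L-sub r (y (iy τ)) (y (iy σ)))) (%-≡⇒D (L r (y (iy τ))) (L r (y (iy σ))) (trans e (sym e′))) })
        by (yes Zx) (yes Zy) = ⊥-elim (τ≢σ (equal (x-inj τ∈ σ∈ Zx) (y-inj τ∈ σ∈ Zy)))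
          where
          equal : ix τ ≡ ix σ → iy τ ≡ iy σ → τ ≡ σ
          equal ex ey = cong₂ _,_ ex (cong₂ _,_ ey (z-inj τ∈ σ∈ (Zero-tri-sub (x (ix τ)) (y (iy τ)) (z (iz τ)) (z (iz σ)) (solves τ∈)
            (subst₂ (λ i j → Zero (tri (x i) (y j) (z (iz σ)))) (sym ex) (sym ey) (solves σ∈)))))

      average-conflicts : p * (∑[ c ∈ choices ] conflicts (cut c)) ≤ p ^ n * conflicts 𝒯
      average-conflicts = begin
        p * ∑ choices (λ c → conflicts (cut c))
          ≡⟨ cong (p *_) (trans (∑-cong choices unfiltered) (trans (∑-swap choices 𝒯 (λ c τ → ∑ 𝒯 (λ σ → w c τ σ)))
               (∑-cong 𝒯 (λ τ → ∑-swap choices 𝒯 (λ c σ → w c τ σ))))) ⟩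
        p * ∑ 𝒯 (λ τ → ∑ 𝒯 (λ σ → ∑ choices (λ c → w c τ σ)))
          ≡⟨ trans (sym (∑-*ˡ 𝒯 p _)) (∑-cong 𝒯 (λ τ → sym (∑-*ˡ 𝒯 p _))) ⟩
        ∑ 𝒯 (λ τ → ∑ 𝒯 (λ σ → p * ∑ choices (λ c → w c τ σ)))
          ≤⟨ ∑-mono∈ 𝒯 (λ {τ} τ∈ → ∑-mono∈ 𝒯 (λ {σ} σ∈ → per-pair τ σ τ∈ σ∈)) ⟩
        ∑ 𝒯 (λ τ → ∑ 𝒯 (λ σ → p ^ n * 𝟙 (conflict? τ σ)))
          ≡⟨ trans (∑-cong 𝒯 (λ τ → ∑-*ˡ 𝒯 (p ^ n) _)) (∑-*ˡ 𝒯 (p ^ n) _) ⟩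
        p ^ n * conflicts 𝒯 ∎
        where
        open ≤-Reasoning
        w : Choice → Triple → Triple → ℕ
        w c τ σ = 𝟙 (conflict? τ σ) * (𝟙 (keep? c τ) * 𝟙 (keep? c σ))
        unfiltered : ∀ c → conflicts (cut c) ≡ ∑ 𝒯 (λ τ → ∑ 𝒯 (λ σ → w c τ σ))
        unfiltered c = trans (∑-filter (keep? c) 𝒯 (λ τ → ∑ (cut c) (λ σ → 𝟙 (conflict? τ σ))))
          (∑-cong 𝒯 (λ τ → trans (cong (𝟙 (keep? c τ) *_) (∑-filter (keep? c) 𝒯 (λ σ → 𝟙 (conflict? τ σ))))
            (trans (sym (∑-*ˡ 𝒯 (𝟙 (keep? c τ)) _)) (∑-cong 𝒯 (λ σ → shuffle (𝟙 (keep? c τ)) (𝟙 (keep? c σ)) (𝟙 (conflict? τ σ)))))))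
          where
          shuffle : ∀ a b d → a * (b * d) ≡ d * (a * b)
          shuffle = solve-∀
        per-pair : ∀ τ σ → τ ∈ 𝒯 → σ ∈ 𝒯 → p * ∑ choices (λ c → w c τ σ) ≤ p ^ n * 𝟙 (conflict? τ σ)
        per-pair τ σ τ∈ σ∈ = begin
          p * ∑ choices (λ c → w c τ σ)         ≡⟨ cong (p *_) (∑-*ˡ choices (𝟙 (conflict? τ σ)) _) ⟩
          p * (𝟙 (conflict? τ σ) * both-kept τ σ) ≡⟨ swap p (𝟙 (conflict? τ σ)) (both-kept τ σ) ⟩
          𝟙 (conflict? τ σ) * (p * both-kept τ σ) ≤⟨ 𝟙-*≤ (conflict? τ σ) (both-kept-conflict τ∈ σ∈) ⟩
          𝟙 (conflict? τ σ) * p ^ n             ≡⟨ *-comm (𝟙 (conflict? τ σ)) (p ^ n) ⟩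
          p ^ n * 𝟙 (conflict? τ σ)             ∎
          where
          swap : ∀ a b c → a * (b * c) ≡ b * (a * c)
          swap = solve-∀

      -- A single choice has to serve both size and conflicts, so the averages p^(-2) and p^(-3) are
      -- used on one linear combination of them. Its weights are those for which the conflicts of
      -- the cut cancel in the induction of `sample`.
      good-cut : ∀ j → ∃ λ c → p ^ suc j * length 𝒯 + p * (p * p) * conflicts (cut c) ≤ conflicts 𝒯 + p ^ suc j * (p * p) * length (cut c)
      good-cut j = let c , _ , h = ∑-avg′ choices nonempty
                         (λ c → p ^ suc j * length 𝒯 + p * (p * p) * conflicts (cut c)) (λ c → conflicts 𝒯 + p ^ suc j * (p * p) * length (cut c)) totals
                   in c , h
        where
        open ≤-Reasoning
        nonempty : 1 ≤ length choices
        nonempty = ≤-trans (*-mono-≤ (m^n>0 p n) (*-mono-≤ (<⇒≤ 1<p) (<⇒≤ 1<p))) (≤-reflexive (sym length-choices))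
        totals : ∑ choices (λ c → p ^ suc j * length 𝒯 + p * (p * p) * conflicts (cut c)) ≤ ∑ choices (λ c → conflicts 𝒯 + p ^ suc j * (p * p) * length (cut c))
        totals = begin
          ∑ choices (λ c → p ^ suc j * length 𝒯 + p * (p * p) * conflicts (cut c))
            ≡⟨ trans (∑-+ choices _ _) (cong₂ _+_ (trans (∑-const choices _) (cong (_* (p ^ suc j * length 𝒯)) length-choices)) (∑-*ˡ choices (p * (p * p)) _)) ⟩
          p ^ n * (p * p) * (p ^ suc j * length 𝒯) + p * (p * p) * ∑ choices (λ c → conflicts (cut c))
            ≡⟨ cong (p ^ n * (p * p) * (p ^ suc j * length 𝒯) +_) (shuffle₁ p (∑ choices (λ c → conflicts (cut c)))) ⟩
          p ^ n * (p * p) * (p ^ suc j * length 𝒯) + p * p * (p * ∑ choices (λ c → conflicts (cut c)))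
            ≤⟨ +-monoʳ-≤ (p ^ n * (p * p) * (p ^ suc j * length 𝒯)) (*-monoʳ-≤ (p * p) average-conflicts) ⟩
          p ^ n * (p * p) * (p ^ suc j * length 𝒯) + p * p * (p ^ n * conflicts 𝒯)
            ≡⟨ shuffle₂ (p ^ n) p (p ^ suc j) (length 𝒯) (conflicts 𝒯) ⟩
          p ^ n * (p * p) * conflicts 𝒯 + p ^ suc j * (p * p) * (p ^ n * length 𝒯)
            ≡⟨ sym (trans (∑-+ choices _ _) (cong₂ _+_ (trans (∑-const choices _) (cong (_* conflicts 𝒯) length-choices))
                 (trans (∑-*ˡ choices (p ^ suc j * (p * p)) _) (cong (p ^ suc j * (p * p) *_) average-size)))) ⟩
          ∑ choices (λ c → conflicts 𝒯 + p ^ suc j * (p * p) * length (cut c)) ∎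
          where
          shuffle₁ : ∀ p s → p * (p * p) * s ≡ p * p * (p * s)
          shuffle₁ = solve-∀
          shuffle₂ : ∀ P p J T Q → P * (p * p) * (J * T) + p * p * (P * Q) ≡ P * (p * p) * Q + J * (p * p) * (P * T)
          shuffle₂ = solve-∀

    -- After division by p^(3j): expected size p^(-2j) |𝒯| minus expected conflicts p^(-3j)
    -- conflicts 𝒯, after j cuts, is at most the bound for isolated solutions in dimension e.
    sample : ∀ j e {x y z : Fin m → Vec ℤ (j + e)} {𝒯} → Config x y z 𝒯 →
      p ^ j * length 𝒯 ≤ conflicts 𝒯 + p ^ j * p ^ j * p ^ j * (3 * length (Low e))
    sample zero    e {𝒯 = 𝒯} C = subst₂ _≤_ (sym (+-identityʳ (length 𝒯))) (cong (conflicts 𝒯 +_) (sym (+-identityʳ (3 * length (Low e))))) (triples-bound C)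
    sample (suc j) e {𝒯 = 𝒯} C = continue (Cut.good-cut C j)
      where
      open ≤-Reasoning
      B : ℕ
      B = 3 * length (Low e)
      shuffle : ∀ p J T → p * J * (p * p) * T ≡ p * (p * p) * (J * T)
      shuffle = solve-∀
      collect : ∀ Q p Q′ J B → Q + p * (p * p) * (Q′ + J * J * J * B) ≡ p * (p * p) * Q′ + (Q + p * J * (p * J) * (p * J) * B)
      collect = solve-∀
      continue : (∃ λ c → p ^ suc j * length 𝒯 + p * (p * p) * conflicts (Cut.cut C c) ≤ conflicts 𝒯 + p ^ suc j * (p * p) * length (Cut.cut C c)) →
        p ^ suc j * length 𝒯 ≤ conflicts 𝒯 + p ^ suc j * p ^ suc j * p ^ suc j * B
      continue (c , good) = linear _ _ (p * (p * p) * conflicts (Cut.cut C c)) (begin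
          p * p ^ j * length 𝒯 + p * (p * p) * conflicts 𝒯′
            ≤⟨ good ⟩
          conflicts 𝒯 + p * p ^ j * (p * p) * length 𝒯′
            ≡⟨ cong (conflicts 𝒯 +_) (shuffle p (p ^ j) (length 𝒯′)) ⟩
          conflicts 𝒯 + p * (p * p) * (p ^ j * length 𝒯′)
            ≤⟨ +-monoʳ-≤ (conflicts 𝒯) (*-monoʳ-≤ (p * (p * p)) (sample j e (Cut.cut-config C c))) ⟩
          conflicts 𝒯 + p * (p * p) * (conflicts 𝒯′ + p ^ j * p ^ j * p ^ j * B) ∎)
          (+-comm (p * p ^ j * length 𝒯) _) (collect (conflicts 𝒯) p (conflicts 𝒯′) (p ^ j) B)
        where
        𝒯′ : List Triple
        𝒯′ = Cut.cut C c

  -- Regularising the degrees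

  module Regular (p : ℕ) (p-prime : Prime p) {m d : ℕ} (x y z : Fin m → Vec ℤ d) where

    open Mod p p-prime
    open TriColoured p p-prime using (Zero; p-nonZero; Low)
    open LowExponents p p-prime using (low-count)
    open Linear p p-prime
    open Configurations p p-prime {m}

    solution? : ∀ τ → Dec (Zero (tri (x (ix τ)) (y (iy τ)) (z (iz τ))))
    solution? τ = Zero? (tri (x (ix τ)) (y (iy τ)) (z (iz τ)))

    all-triples : List (Fin m) → List Triple
    all-triples I = cartesianProduct I (cartesianProduct I I)

    solutions : List (Fin m) → List Triple
    solutions I = filter solution? (all-triples I)

    record Admissible (I : List (Fin m)) : Set where
      field
        unique : Unique I
        diag   : ∀ {i} → i ∈ I → Zero (tri (x i) (y i) (z i))
        x-inj  : ∀ {i i′} → i ∈ I → i′ ∈ I → Zero (sub (x i) (x i′)) → i ≡ i′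
        y-inj  : ∀ {i i′} → i ∈ I → i′ ∈ I → Zero (sub (y i) (y i′)) → i ≡ i′
        z-inj  : ∀ {i i′} → i ∈ I → i′ ∈ I → Zero (sub (z i) (z i′)) → i ≡ i′

    filter-admissible : ∀ {I} {P : Fin m → Set} (P? : ∀ i → Dec (P i)) → Admissible I → Admissible (filter P? I)
    filter-admissible {I} P? A = record
      { unique = filter⁺ P? unique ; diag = diag ∘ back
      ; x-inj = λ i∈ j∈ → x-inj (back i∈) (back j∈) ; y-inj = λ i∈ j∈ → y-inj (back i∈) (back j∈) ; z-inj = λ i∈ j∈ → z-inj (back i∈) (back j∈) }
      where
      open Admissible A
      back : ∀ {i} → i ∈ filter P? I → i ∈ I
      back i∈ = proj₁ (∈-filter⁻ P? {xs = I} i∈)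

    ∈-solutions⁻ : ∀ {I τ} → τ ∈ solutions I → (ix τ ∈ I × iy τ ∈ I × iz τ ∈ I) × Zero (tri (x (ix τ)) (y (iy τ)) (z (iz τ)))
    ∈-solutions⁻ {I} τ∈ with ∈-filter⁻ solution? {xs = all-triples I} τ∈
    ... | τ∈′ , Z with ∈-cartesianProduct⁻ I (cartesianProduct I I) τ∈′
    ...   | i∈ , jk∈ with ∈-cartesianProduct⁻ I I jk∈
    ...     | j∈ , k∈ = (i∈ , j∈ , k∈) , Z

    ∈-solutions⁺ : ∀ {I i j k} → i ∈ I → j ∈ I → k ∈ I → Zero (tri (x i) (y j) (z k)) → (i , j , k) ∈ solutions I
    ∈-solutions⁺ i∈ j∈ k∈ Z = ∈-filter⁺ solution? (∈-cartesianProduct⁺ i∈ (∈-cartesianProduct⁺ j∈ k∈)) Z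

    module _ {I : List (Fin m)} (A : Admissible I) where
      open Admissible A

      solutions-unique : Unique (solutions I)
      solutions-unique = filter⁺ solution? (cartesianProduct⁺ unique (cartesianProduct⁺ unique unique))

      config : Config x y z (solutions I)
      config = record
        { unique = solutions-unique
        ; solves = λ τ∈ → proj₂ (∈-solutions⁻ {I} τ∈)
        ; closed = λ τ∈ σ∈ υ∈ Z → ∈-solutions⁺ {I} (proj₁ (proj₁ (∈-solutions⁻ {I} τ∈))) (proj₁ (proj₂ (proj₁ (∈-solutions⁻ {I} σ∈)))) (proj₂ (proj₂ (proj₁ (∈-solutions⁻ {I} υ∈)))) Z
        ; x-inj = λ τ∈ σ∈ → x-inj (proj₁ (proj₁ (∈-solutions⁻ {I} τ∈))) (proj₁ (proj₁ (∈-solutions⁻ {I} σ∈)))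
        ; y-inj = λ τ∈ σ∈ → y-inj (proj₁ (proj₂ (proj₁ (∈-solutions⁻ {I} τ∈)))) (proj₁ (proj₂ (proj₁ (∈-solutions⁻ {I} σ∈))))
        ; z-inj = λ τ∈ σ∈ → z-inj (proj₂ (proj₂ (proj₁ (∈-solutions⁻ {I} τ∈)))) (proj₂ (proj₂ (proj₁ (∈-solutions⁻ {I} σ∈)))) }

    deg : (Triple → Fin m) → List (Fin m) → Fin m → ℕ
    deg pr I i = ∑[ τ ∈ solutions I ] 𝟙 (pr τ ≟ᶠ i)

    -- The factor 6 leaves q/6 for each of three positions, so a triple of light indices has at most
    -- q/2 conflicts.
    Light : ℕ → List (Fin m) → Fin m → Set
    Light q I i = 6 * deg ix I i ≤ q × 6 * deg iy I i ≤ q × 6 * deg iz I i ≤ q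

    light? : ∀ q I i → Dec (Light q I i)
    light? q I i = (6 * deg ix I i ≤? q) ×-dec (6 * deg iy I i ≤? q) ×-dec (6 * deg iz I i ≤? q)

    deg-filter : ∀ {I} {P : Fin m → Set} (P? : ∀ i → Dec (P i)) → Admissible I → ∀ pr i → deg pr (filter P? I) i ≤ deg pr I i
    deg-filter {I} P? A pr i = #-≤-rel (λ τ → pr τ ≟ᶠ i) (λ τ → pr τ ≟ᶠ i) _≡_ (solutions (filter P? I)) (solutions I)
      (solutions-unique (filter-admissible P? A))
      (λ {τ} τ∈ e → let (i∈ , j∈ , k∈) , Z = ∈-solutions⁻ {filter P? I} τ∈ in τ , ∈-solutions⁺ (back i∈) (back j∈) (back k∈) Z , e , refl)
      (λ _ _ e e′ → trans e (sym e′))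
      where
      back : ∀ {i} → i ∈ filter P? I → i ∈ I
      back i∈ = proj₁ (∈-filter⁻ P? {xs = I} i∈)

    deg-total : ∀ {I} → Admissible I → ∀ pr → ∑[ i ∈ I ] deg pr I i ≤ length (solutions I)
    deg-total {I} A pr = ≤-trans (≤-reflexive (∑-swap I (solutions I) (λ i τ → 𝟙 (pr τ ≟ᶠ i))))
      (∑≤length (solutions I) (λ {τ} _ → #-atMostOne (λ i → pr τ ≟ᶠ i) I (Admissible.unique A) (λ _ _ e e′ → trans (sym e) e′)))

    heavy-bound : ∀ {I} → Admissible I → ∀ q → q * (∑[ i ∈ I ] 𝟙 (¬? (light? q I i))) ≤ 18 * length (solutions I)
    heavy-bound {I} A q = begin
      q * ∑ I (λ i → 𝟙 (¬? (light? q I i)))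
        ≡⟨ sym (∑-*ˡ I q _) ⟩
      ∑ I (λ i → q * 𝟙 (¬? (light? q I i)))
        ≤⟨ ∑-mono I pointwise ⟩
      ∑ I (λ i → 6 * (deg ix I i + (deg iy I i + deg iz I i)))
        ≡⟨ trans (∑-*ˡ I 6 _) (cong (6 *_) (trans (∑-+ I (deg ix I) _) (cong (∑ I (deg ix I) +_) (∑-+ I (deg iy I) (deg iz I))))) ⟩
      6 * (∑ I (deg ix I) + (∑ I (deg iy I) + ∑ I (deg iz I)))
        ≤⟨ *-monoʳ-≤ 6 (+-mono-≤ (deg-total A ix) (+-mono-≤ (deg-total A iy) (deg-total A iz))) ⟩
      6 * (T + (T + T))
        ≡⟨ eighteen T ⟩
      18 * T ∎
      where
      open ≤-Reasoning
      T = length (solutions I)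
      eighteen : ∀ T → 6 * (T + (T + T)) ≡ 18 * T
      eighteen = solve-∀
      pointwise : ∀ i → q * 𝟙 (¬? (light? q I i)) ≤ 6 * (deg ix I i + (deg iy I i + deg iz I i))
      pointwise i = by (6 * deg ix I i ≤? q) (6 * deg iy I i ≤? q) (6 * deg iz I i ≤? q)
        where
        S = deg ix I i + (deg iy I i + deg iz I i)
        q≤ : ∀ s → ¬ 6 * s ≤ q → s ≤ S → q * 𝟙 (¬? (light? q I i)) ≤ 6 * S
        q≤ s ¬l s≤ = ≤-trans (*-monoʳ-≤ q (𝟙≤1 (¬? (light? q I i)))) (≤-trans (≤-reflexive (*-identityʳ q)) (≤-trans (<⇒≤ (≰⇒> ¬l)) (*-monoʳ-≤ 6 s≤)))
        by : Dec (6 * deg ix I i ≤ q) → Dec (6 * deg iy I i ≤ q) → Dec (6 * deg iz I i ≤ q) → q * 𝟙 (¬? (light? q I i)) ≤ 6 * S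
        by (no ¬l) _ _ = q≤ (deg ix I i) ¬l (m≤m+n _ _)
        by (yes _) (no ¬l) _ = q≤ (deg iy I i) ¬l (≤-trans (m≤m+n (deg iy I i) _) (m≤n+m _ (deg ix I i)))
        by (yes _) (yes _) (no ¬l) = q≤ (deg iz I i) ¬l (≤-trans (m≤n+m (deg iz I i) (deg iy I i)) (m≤n+m _ (deg ix I i)))
        by (yes l₁) (yes l₂) (yes l₃) = ≤-trans (≤-reflexive (trans (cong (q *_) (𝟙-no (¬? (light? q I i)) (λ ¬l → ¬l (l₁ , l₂ , l₃)))) (*-zeroʳ q))) z≤n

    Regular : ℕ → List (Fin m) → Set
    Regular q I = ∀ {i} → i ∈ I → Light q I i

    light-regular : ∀ {I} → Admissible I → ∀ q → Regular q (filter (light? q I) I)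
    light-regular {I} A q i∈ = let lx , ly , lz = proj₂ (∈-filter⁻ (light? q I) {xs = I} i∈) in
      ≤-trans (*-monoʳ-≤ 6 (deg-filter (light? q I) A ix _)) lx ,
      ≤-trans (*-monoʳ-≤ 6 (deg-filter (light? q I) A iy _)) ly ,
      ≤-trans (*-monoʳ-≤ 6 (deg-filter (light? q I) A iz _)) lz

    -- A conflicting triple shares one of three indices with the given one, and each degree is at
    -- most q/6.
    regular-conflicts : ∀ {I q} → Regular q I → 2 * conflicts (solutions I) ≤ q * length (solutions I)
    regular-conflicts {I} {q} reg = *-cancelˡ-≤ 3 (begin
      3 * (2 * conflicts 𝒯)
        ≡⟨ trans (sym (*-assoc 3 2 (conflicts 𝒯))) (sym (∑-*ˡ 𝒯 6 _)) ⟩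
      ∑ 𝒯 (λ τ → 6 * ∑ 𝒯 (λ σ → 𝟙 (conflict? τ σ)))
        ≤⟨ ∑-mono∈ 𝒯 per-triple ⟩
      ∑ 𝒯 (λ _ → 3 * q)
        ≡⟨ trans (∑-const 𝒯 (3 * q)) (shuffle (length 𝒯) q) ⟩
      3 * (q * length 𝒯) ∎)
      where
      open ≤-Reasoning
      𝒯 = solutions I
      shuffle : ∀ l q → l * (3 * q) ≡ 3 * (q * l)
      shuffle = solve-∀
      per-triple : ∀ {τ} → τ ∈ 𝒯 → 6 * ∑ 𝒯 (λ σ → 𝟙 (conflict? τ σ)) ≤ 3 * q
      per-triple {τ} τ∈ = begin
        6 * ∑ 𝒯 (λ σ → 𝟙 (conflict? τ σ))
          ≤⟨ *-monoʳ-≤ 6 (∑-mono 𝒯 shares) ⟩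
        6 * ∑ 𝒯 (λ σ → 𝟙 (ix σ ≟ᶠ ix τ) + (𝟙 (iy σ ≟ᶠ iy τ) + 𝟙 (iz σ ≟ᶠ iz τ)))
          ≡⟨ cong (6 *_) (trans (∑-+ 𝒯 _ _) (cong (deg ix I (ix τ) +_) (∑-+ 𝒯 _ _))) ⟩
        6 * (deg ix I (ix τ) + (deg iy I (iy τ) + deg iz I (iz τ)))
          ≡⟨ spread (deg ix I (ix τ)) (deg iy I (iy τ)) (deg iz I (iz τ)) ⟩
        6 * deg ix I (ix τ) + (6 * deg iy I (iy τ) + 6 * deg iz I (iz τ))
          ≤⟨ +-mono-≤ (proj₁ (reg i∈)) (+-mono-≤ (proj₁ (proj₂ (reg j∈))) (proj₂ (proj₂ (reg k∈)))) ⟩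
        q + (q + q)
          ≡⟨ three q ⟩
        3 * q ∎
        where
        i∈ = proj₁ (proj₁ (∈-solutions⁻ {I} τ∈))
        j∈ = proj₁ (proj₂ (proj₁ (∈-solutions⁻ {I} τ∈)))
        k∈ = proj₂ (proj₂ (proj₁ (∈-solutions⁻ {I} τ∈)))
        three : ∀ q → q + (q + q) ≡ 3 * q
        three = solve-∀
        spread : ∀ a b c → 6 * (a + (b + c)) ≡ 6 * a + (6 * b + 6 * c)
        spread = solve-∀
        shares : ∀ σ → 𝟙 (conflict? τ σ) ≤ 𝟙 (ix σ ≟ᶠ ix τ) + (𝟙 (iy σ ≟ᶠ iy τ) + 𝟙 (iz σ ≟ᶠ iz τ))
        shares σ = 𝟙-≤ (conflict? τ σ) (λ { (_ , s) → by s })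
          where
          by : ix τ ≡ ix σ ⊎ iy τ ≡ iy σ ⊎ iz τ ≡ iz σ → 1 ≤ 𝟙 (ix σ ≟ᶠ ix τ) + (𝟙 (iy σ ≟ᶠ iy τ) + 𝟙 (iz σ ≟ᶠ iz τ))
          by (inj₁ e)        = ≤-trans (≤-reflexive (sym (𝟙-yes (ix σ ≟ᶠ ix τ) (sym e)))) (m≤m+n _ _)
          by (inj₂ (inj₁ e)) = ≤-trans (≤-reflexive (sym (𝟙-yes (iy σ ≟ᶠ iy τ) (sym e)))) (≤-trans (m≤m+n _ _) (m≤n+m _ (𝟙 (ix σ ≟ᶠ ix τ))))
          by (inj₂ (inj₂ e)) = ≤-trans (≤-reflexive (sym (𝟙-yes (iz σ ≟ᶠ iz τ) (sym e)))) (≤-trans (m≤n+m _ (𝟙 (iy σ ≟ᶠ iy τ))) (m≤n+m _ (𝟙 (ix σ ≟ᶠ ix τ))))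

    sample′ : ∀ {d} j e → d ≡ j + e → {x y z : Fin m → Vec ℤ d} {𝒯 : List Triple} → Config x y z 𝒯 →
      p ^ j * length 𝒯 ≤ conflicts 𝒯 + p ^ j * p ^ j * p ^ j * (3 * length (Low e))
    sample′ j e refl C = sample j e C

    -- At scale p^j the conflicts absorb at most half of the left side of `sample`; the other half
    -- gives the bound.
    regular-solutions : ∀ {I} → Admissible I → ∀ j e → d ≡ j + e → Regular (p ^ j) I → length (solutions I) ≤ 6 * (p ^ j * p ^ j) * length (Low e)
    regular-solutions {I} A j e d≡ reg = *-cancelˡ-≤ (p ^ j) {{>-nonZero (m^n>0 p j)}} (linear _ _ (p ^ j * T) (begin
        p ^ j * T + p ^ j * T
          ≡⟨ two (p ^ j * T) ⟩
        2 * (p ^ j * T)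
          ≤⟨ *-monoʳ-≤ 2 (sample′ j e d≡ (config A)) ⟩
        2 * (conflicts (solutions I) + p ^ j * p ^ j * p ^ j * (3 * R))
          ≡⟨ *-distribˡ-+ 2 (conflicts (solutions I)) _ ⟩
        2 * conflicts (solutions I) + 2 * (p ^ j * p ^ j * p ^ j * (3 * R))
          ≤⟨ +-monoˡ-≤ _ (regular-conflicts {I} reg) ⟩
        p ^ j * T + 2 * (p ^ j * p ^ j * p ^ j * (3 * R))
          ≡⟨ cong (p ^ j * T +_) (collect (p ^ j) R) ⟩
        p ^ j * T + p ^ j * (6 * (p ^ j * p ^ j) * R) ∎) refl refl)
      where
      open ≤-Reasoning
      T = length (solutions I)
      R = length (Low e)
      two : ∀ t → t + t ≡ 2 * t
      two = solve-∀
      collect : ∀ P R → 2 * (P * P * P * (3 * R)) ≡ P * (6 * (P * P) * R)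
      collect = solve-∀

    -- Descent through the scales: indices not light at p^(j-1) are few by `regular-solutions`, and
    -- the rest are regular at the smaller scale, with one more dimension left after cutting. The
    -- losses form a geometric series of ratio 19/20, hence 2160 = 20 · 108.
    regular-size : ∀ j e → d ≡ j + e → ∀ {I} → Admissible I → Regular (p ^ j) I → length I * 20 ^ e ≤ 2160 * (p * p ^ d) * 19 ^ e
    regular-size zero e d≡ {[]} A reg = z≤n
    -- At scale p^0 = 1 lightness forces degree 0, whereas each index lies on its own diagonal
    -- solution.
    regular-size zero e d≡ {i ∷ I} A reg = ⊥-elim (<⇒≱ (s≤s (s≤s z≤n)) (≤-trans (*-monoʳ-≤ 6 self) (proj₁ (reg (here refl)))))
      where
      self : 1 ≤ deg ix (i ∷ I) i
      self = ≤-trans (≤-reflexive (sym (𝟙-yes (i ≟ᶠ i) refl)))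
        (∑-member (solutions (i ∷ I)) (λ τ → 𝟙 (ix τ ≟ᶠ i)) {i , i , i} (∈-solutions⁺ {i ∷ I} (here refl) (here refl) (here refl) (Admissible.diag A (here refl))))
    regular-size (suc j) e d≡ {I} A reg = *-cancelʳ-≤ _ _ 20 (begin
      length I * 20 ^ e * 20
        ≡⟨ cong (λ l → l * 20 ^ e * 20) (sym (trans (cong (_+ heavy) (length-filter-# (light? q I) I)) (#-¬ (light? q I) I))) ⟩
      (length I′ + heavy) * 20 ^ e * 20
        ≡⟨ distribute (length I′) heavy (20 ^ e) ⟩
      length I′ * (20 * 20 ^ e) + heavy * 20 ^ e * 20
        ≤⟨ +-mono-≤ (regular-size j (suc e) (trans d≡ (sym (+-suc j e))) (filter-admissible (light? q I) A) (light-regular A q)) (*-monoˡ-≤ 20 heavy≤) ⟩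
      2160 * (p * p ^ d) * (19 * 19 ^ e) + 108 * (p * p ^ d) * 19 ^ e * 20
        ≡⟨ total (p * p ^ d) (19 ^ e) ⟩
      2160 * (p * p ^ d) * 19 ^ e * 20 ∎)
      where
      open ≤-Reasoning
      q = p ^ j
      I′ = filter (light? q I) I
      heavy = ∑[ i ∈ I ] 𝟙 (¬? (light? q I i))
      distribute : ∀ a b c → (a + b) * c * 20 ≡ a * (20 * c) + b * c * 20
      distribute = solve-∀
      total : ∀ P N → 2160 * P * (19 * N) + 108 * P * N * 20 ≡ 2160 * P * N * 20
      total = solve-∀
      heavy≤′ : heavy ≤ 108 * (p * p * p ^ j) * length (Low e)
      heavy≤′ = *-cancelˡ-≤ q {{>-nonZero (m^n>0 p j)}} (begin
        q * heavy                                        ≤⟨ heavy-bound A q ⟩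
        18 * length (solutions I)                        ≤⟨ *-monoʳ-≤ 18 (regular-solutions A (suc j) e d≡ reg) ⟩
        18 * (6 * (p * q * (p * q)) * length (Low e))    ≡⟨ shuffle p q (length (Low e)) ⟩
        q * (108 * (p * p * q) * length (Low e))         ∎)
        where
        shuffle : ∀ p q R → 18 * (6 * (p * q * (p * q)) * R) ≡ q * (108 * (p * p * q) * R)
        shuffle = solve-∀
      heavy≤ : heavy * 20 ^ e ≤ 108 * (p * p ^ d) * 19 ^ e
      heavy≤ = begin
        heavy * 20 ^ e                                           ≤⟨ *-monoˡ-≤ (20 ^ e) heavy≤′ ⟩
        108 * (p * p * q) * length (Low e) * 20 ^ e              ≡⟨ *-assoc (108 * (p * p * q)) (length (Low e)) (20 ^ e) ⟩
        108 * (p * p * q) * (length (Low e) * 20 ^ e)            ≤⟨ *-monoʳ-≤ (108 * (p * p * q)) (low-count e) ⟩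
        108 * (p * p * q) * (19 ^ e * p ^ e)                     ≡⟨ shuffle p q (19 ^ e) (p ^ e) ⟩
        108 * (p * (p * q * p ^ e)) * 19 ^ e                     ≡⟨ cong (λ w → 108 * (p * w) * 19 ^ e) (sym (trans (cong (p ^_) d≡) (^-distribˡ-+-* p (suc j) e))) ⟩
        108 * (p * p ^ d) * 19 ^ e                               ∎
        where
        shuffle : ∀ p q N E → 108 * (p * p * q) * (N * E) ≡ 108 * (p * (p * q * E)) * N
        shuffle = solve-∀

    -- Two estimates for two halves: indices heavy at scale p^j are controlled by the number of
    -- solutions, which Γ will bound, and light ones by the slice rank bound, whatever the number of
    -- solutions.
    admissible-size : ∀ j e → d ≡ j + e → ∀ {I} → Admissible I → ∃ λ r → length I ≤ r + length (filter (light? (p ^ j) I) I) ×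
      p ^ j * r ≤ 18 * length (solutions I) × length (filter (light? (p ^ j) I) I) * 20 ^ e ≤ 2160 * (p * p ^ d) * 19 ^ e
    admissible-size j e d≡ {I} A = ∑ I (λ i → 𝟙 (¬? (light? (p ^ j) I i))) ,
      ≤-reflexive (trans (sym (#-¬ (light? (p ^ j) I) I)) (trans (+-comm (# (light? (p ^ j) I) I) _) (cong (∑ I (λ i → 𝟙 (¬? (light? (p ^ j) I i))) +_) (sym (length-filter-# (light? (p ^ j) I) I))))) ,
      heavy-bound A (p ^ j) , regular-size j e d≡ (filter-admissible (light? (p ^ j) I) A) (light-regular A (p ^ j))

  -- Projecting to bounded dimension

  apply : ∀ {d n} → Vec (Vec ℕ n) d → Vec ℤ n → Vec ℤ d
  apply []         v = []
  apply (r ∷ rows) v = dot r v ∷ apply rows v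

  apply-tri : ∀ {d n} (rows : Vec (Vec ℕ n) d) X Y Z → apply rows (tri X Y Z) ≡ tri (apply rows X) (apply rows Y) (apply rows Z)
  apply-tri []         X Y Z = refl
  apply-tri (r ∷ rows) X Y Z = cong₂ _∷_ (dot-tri r X Y Z) (apply-tri rows X Y Z)

  apply-sub : ∀ {d n} (rows : Vec (Vec ℕ n) d) X Y → apply rows (sub X Y) ≡ sub (apply rows X) (apply rows Y)
  apply-sub []         X Y = refl
  apply-sub (r ∷ rows) X Y = cong₂ _∷_ (dot-sub r X Y) (apply-sub rows X Y)

  module Projection (p : ℕ) (p-prime : Prime p) where

    open Mod p p-prime
    open TriColoured p p-prime using (Zero; p-nonZero)
    open Linear p p-prime

    apply-zero : ∀ {d n} (rows : Vec (Vec ℕ n) d) v → Zero v → Zero (apply rows v)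
    apply-zero []         v Z = VAll.[]
    apply-zero (r ∷ rows) v Z = D-dot r v Z VAll.∷ apply-zero rows v Z

    module _ {J : Set} {n : ℕ} (v : J → Vec ℤ n) where

      good-row : (T : List J) → (∀ {t} → t ∈ T → ¬ Zero (v t)) → ∃ λ r → p * (∑[ t ∈ T ] 𝟙 (D? (dot r (v t)))) ≤ length T
      good-row T nz = let r , _ , h = ∑-avg′ (vecs (upTo p) n) (≤-trans (m^n>0 p n) (≤-reflexive (sym (length-vecs n))))
                            (λ r → p * (∑[ t ∈ T ] 𝟙 (D? (dot r (v t))))) (λ _ → length T) totals in r , h
        where
        open ≤-Reasoning
        per-vector : ∀ {t} → t ∈ T → p * (∑[ r ∈ vecs (upTo p) n ] 𝟙 (D? (dot r (v t)))) ≤ p ^ n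
        per-vector {t} t∈ = ≤-trans (*-monoʳ-≤ p (∑-mono (vecs (upTo p) n) (λ r → 𝟙-mono (D? (dot r (v t))) (D? (0ℤ +ᶻ dot r (v t))) (subst D (sym (ℤP.+-identityˡ _))))))
          (hyperplane (v t) (nz t∈) 0ℤ)
        totals : ∑ (vecs (upTo p) n) (λ r → p * ∑ T (λ t → 𝟙 (D? (dot r (v t))))) ≤ ∑ (vecs (upTo p) n) (λ _ → length T)
        totals = begin
          ∑ (vecs (upTo p) n) (λ r → p * ∑ T (λ t → 𝟙 (D? (dot r (v t)))))
            ≡⟨ trans (∑-*ˡ (vecs (upTo p) n) p _) (trans (cong (p *_) (∑-swap (vecs (upTo p) n) T (λ r t → 𝟙 (D? (dot r (v t)))))) (sym (∑-*ˡ T p _))) ⟩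
          ∑ T (λ t → p * ∑ (vecs (upTo p) n) (λ r → 𝟙 (D? (dot r (v t)))))
            ≤⟨ ∑-atMost T per-vector ⟩
          length T * p ^ n
            ≡⟨ trans (*-comm (length T) (p ^ n)) (trans (cong (_* length T) (sym (length-vecs n))) (sym (∑-const (vecs (upTo p) n) (length T)))) ⟩
          ∑ (vecs (upTo p) n) (λ _ → length T) ∎

      -- Rows are chosen one after another; each kills at most a proportion 1/p of the vectors
      -- killed by all previous ones.
      good-rows : ∀ d (T : List J) → (∀ {t} → t ∈ T → ¬ Zero (v t)) →
        ∃ λ (rows : Vec (Vec ℕ n) d) → p ^ d * (∑[ t ∈ T ] 𝟙 (Zero? (apply rows (v t)))) ≤ length T
      good-rows zero    T nz = [] , ≤-trans (≤-reflexive (+-identityʳ _)) (∑≤length T (λ {t} _ → 𝟙≤1 (Zero? (apply [] (v t)))))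
      good-rows (suc d) T nz with good-row T nz
      ... | r , h with good-rows d (filter (λ t → D? (dot r (v t))) T) (λ t∈ → nz (proj₁ (∈-filter⁻ (λ t → D? (dot r (v t))) {xs = T} t∈)))
      ...   | rows , h′ = r ∷ rows , (begin
          p * p ^ d * ∑ T (λ t → 𝟙 (Zero? (dot r (v t) ∷ apply rows (v t))))
            ≤⟨ *-monoʳ-≤ (p * p ^ d) (∑-mono T split) ⟩
          p * p ^ d * ∑ T (λ t → 𝟙 (D? (dot r (v t))) * 𝟙 (Zero? (apply rows (v t))))
            ≡⟨ trans (*-assoc p (p ^ d) _) (cong (λ s → p * (p ^ d * s)) (sym (∑-filter (λ t → D? (dot r (v t))) T (λ t → 𝟙 (Zero? (apply rows (v t))))))) ⟩
          p * (p ^ d * ∑ (filter (λ t → D? (dot r (v t))) T) (λ t → 𝟙 (Zero? (apply rows (v t)))))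
            ≤⟨ *-monoʳ-≤ p h′ ⟩
          p * length (filter (λ t → D? (dot r (v t))) T)
            ≡⟨ cong (p *_) (length-filter-# (λ t → D? (dot r (v t))) T) ⟩
          p * ∑ T (λ t → 𝟙 (D? (dot r (v t))))
            ≤⟨ h ⟩
          length T ∎)
        where
        open ≤-Reasoning
        split : ∀ t → 𝟙 (Zero? (dot r (v t) ∷ apply rows (v t))) ≤ 𝟙 (D? (dot r (v t))) * 𝟙 (Zero? (apply rows (v t)))
        split t = ≤-trans (𝟙-mono (Zero? (dot r (v t) ∷ apply rows (v t))) (D? (dot r (v t)) ×-dec Zero? (apply rows (v t))) (λ { (z VAll.∷ Z) → z , Z }))
          (≤-reflexive (𝟙-× (D? (dot r (v t))) (Zero? (apply rows (v t)))))

    residues : ∀ {n} → Vec (Fin p) n → Vec ℤ n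
    residues = Vec.map (pos ∘ toℕ)

    residues-sub : ∀ {n} (u v : Vec (Fin p) n) → Zero (sub (residues u) (residues v)) → u ≡ v
    residues-sub []      []      VAll.[]      = refl
    residues-sub (x ∷ u) (y ∷ v) (d VAll.∷ ds) = cong₂ _∷_ (toℕ-injective (D-small⇒≡ (toℕ<n x) (toℕ<n y) d)) (residues-sub u v ds)

    mod-sub : ∀ a → D (pos a -ᶻ pos (toℕ (a mod p)))
    mod-sub a = subst D (sym (trans (cong (λ r → pos a -ᶻ pos r) (toℕ-fromℕ< (m%n<n a p)))
        (trans (cong (λ w → pos w -ᶻ pos (a %ᴺ p)) (m≡m%n+[m/n]*n a p)) (trans (cong (_-ᶻ pos (a %ᴺ p)) (ℤP.pos-+ (a %ᴺ p) (a /ᴺ p * p)))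
          (trans (cancel (pos (a %ᴺ p)) (pos (a /ᴺ p * p))) (ℤP.pos-* (a /ᴺ p) p))))))
      (∣n⇒∣m*n (pos (a /ᴺ p)) (∣ᵤ⇒∣ (divides 1 (sym (*-identityˡ p)))))
      where
      cancel : ∀ r q → r +ᶻ q -ᶻ r ≡ q
      cancel = solve-∀ᶻ

    residues-sum : ∀ {n} (u v : Vec (Fin p) n) → Zero (tri (residues u) (residues v) (residues (u +ₚ v)))
    residues-sum []      []      = VAll.[]
    residues-sum (x ∷ u) (y ∷ v) = subst D (cong (_-ᶻ pos (toℕ ((toℕ x + toℕ y) mod p))) (ℤP.pos-+ (toℕ x) (toℕ y))) (mod-sub (toℕ x + toℕ y)) VAll.∷ residues-sum u v

  length-cartesianProduct : ∀ {a b} {A : Set a} {B : Set b} (L : List A) (M : List B) → length (cartesianProduct L M) ≡ length L * length M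
  length-cartesianProduct L M = trans (sym (∑-1 (cartesianProduct L M))) (trans (∑-cartesianProduct L M (λ _ → 1))
    (trans (∑-cong L (λ _ → ∑-1 M)) (∑-const L (length M))))

  log-floor : ∀ b → 2 ≤ b → ∀ W → 1 ≤ W → ∃ λ d → b ^ d ≤ W × W < b * b ^ d
  log-floor b 2≤b (suc zero)       _ = 0 , s≤s z≤n , ≤-trans 2≤b (≤-reflexive (sym (*-identityʳ b)))
  log-floor b 2≤b (suc W@(suc _)) _ with log-floor b 2≤b W (s≤s z≤n)
  ... | d , lo , hi with suc W <? b * b ^ d
  ...   | yes lt = d , m≤n⇒m≤1+n lo , lt
  ...   | no ¬lt = suc d , ≮⇒≥ ¬lt , ≤-<-trans hi (≤-trans (≤-reflexive (sym (*-identityˡ (suc (b * b ^ d)))))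
                     (≤-trans (≤-reflexive (*-identityˡ _)) (≤-trans (m<n+m (b * b ^ d) {b * b ^ d} (≤-trans (s≤s z≤n) hi))
                       (≤-trans (≤-reflexive (cong (b * b ^ d +_) (sym (+-identityʳ _)))) (*-monoˡ-≤ (b * b ^ d) 2≤b)))))

  -- The family in a vector space and its projection

  module FamilyModel (p : ℕ) (p-prime : Prime p) {N n : ℕ} .{{_ : NonZero p}} (a b : Fin N → Vec (Fin p) n)
    (a-inj : ∀ i j → a i ≡ a j → i ≡ j) (b-inj : ∀ i j → b i ≡ b j → i ≡ j) (Γ : Rel₂ N) (s : ℕ)
    (hc : HasCard _≡_ (_+ₚ_ {p} {n}) (RestrictedSumset _≡_ _+ₚ_ a b Γ) s) where

    open Mod p p-prime
    open TriColoured p p-prime using (Zero)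
    open Linear p p-prime
    open Projection p p-prime

    value : Fin N × Fin N → Vec (Fin p) n
    value (i , j) = a i +ₚ b j

    _~_ : Fin N × Fin N → Fin N × Fin N → Set
    φ ~ ψ = value φ ≡ value ψ

    _~?_ : ∀ φ ψ → Dec (φ ~ ψ)
    φ ~? ψ = VecP.≡-dec _≟ᶠ_ (value φ) (value ψ)

    module _ (F : Family Γ (λ _ → ⊤) (λ _ → ⊤) _~_) where
      open Family F

      m : ℕ
      m = length pairs

      φ : Fin m → Fin N × Fin N
      φ = lookup pairs

      φ∈ : ∀ k → φ k ∈ pairs
      φ∈ k = ∈-lookup k

      φ-inj : ∀ k l → φ k ≡ φ l → k ≡ l
      φ-inj = lookup-injective pairs unique

      X Y Z : Fin m → Vec ℤ n
      X k = residues (a (proj₁ (φ k)))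
      Y k = residues (b (proj₂ (φ k)))
      Z k = residues (value (φ k))

      S : Fin s → Vec ℤ n
      S σ = residues (proj₁ hc σ)

      squares : List (Fin m × Fin m)
      squares = cartesianProduct (allFin m) (allFin m)

      -- Differences that the projection should not kill, each tagged with the member of the family to be
      -- discarded if it does.
      differences : List (Fin m × Vec ℤ n)
      differences = map (λ (k , l) → k , sub (X k) (X l)) squares ++ (map (λ (k , l) → k , sub (Y k) (Y l)) squares ++
        (map (λ (k , l) → k , sub (Z k) (Z l)) squares ++ map (λ (k , σ) → k , sub (Z k) (S σ)) (cartesianProduct (allFin m) (allFin s))))

      nonzero? : ∀ (t : Fin m × Vec ℤ n) → Dec (¬ Zero (proj₂ t))
      nonzero? t = ¬? (Zero? (proj₂ t))

      tags : List (Fin m × Vec ℤ n)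
      tags = filter nonzero? differences

      length-tags : length tags ≤ m * (3 * m + s)
      length-tags = ≤-trans (length-filter nonzero? differences) (≤-reflexive (begin
        length differences
          ≡⟨ trans (length-++ (map xs squares)) (cong₂ _+_ (len xs) (trans (length-++ (map ys squares)) (cong₂ _+_ (len ys)
               (trans (length-++ (map zs squares)) (cong₂ _+_ (len zs) (trans (length-map ss (cartesianProduct (allFin m) (allFin s))) (trans (length-cartesianProduct (allFin m) (allFin s)) (cong₂ _*_ (length-allFin m) (length-allFin s))))))))) ⟩
        m * m + (m * m + (m * m + m * s))
          ≡⟨ collect m s ⟩
        m * (3 * m + s) ∎))
        where
        open ≡-Reasoning
        xs ys zs : Fin m × Fin m → Fin m × Vec ℤ n
        xs (k , l) = k , sub (X k) (X l)
        ys (k , l) = k , sub (Y k) (Y l)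
        zs (k , l) = k , sub (Z k) (Z l)
        ss : Fin m × Fin s → Fin m × Vec ℤ n
        ss (k , σ) = k , sub (Z k) (S σ)
        len : (g : Fin m × Fin m → Fin m × Vec ℤ n) → length (map g squares) ≡ m * m
        len g = trans (length-map g squares) (trans (length-cartesianProduct (allFin m) (allFin m)) (cong₂ _*_ (length-allFin m) (length-allFin m)))
        collect : ∀ m s → m * m + (m * m + (m * m + m * s)) ≡ m * (3 * m + s)
        collect = solve-∀

      module Projected (d : ℕ) where

        abstract
          rows : Vec (Vec ℕ n) d
          rows = proj₁ (good-rows proj₂ d tags (λ t∈ → proj₂ (∈-filter⁻ nonzero? {xs = differences} t∈)))

          few-killed : p ^ d * (∑[ t ∈ tags ] 𝟙 (Zero? (apply rows (proj₂ t)))) ≤ length tags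
          few-killed = proj₂ (good-rows proj₂ d tags (λ t∈ → proj₂ (∈-filter⁻ nonzero? {xs = differences} t∈)))

        Killed : Fin m → Set
        Killed k = Any (λ t → proj₁ t ≡ k × Zero (apply rows (proj₂ t))) tags

        killed? : ∀ k → Dec (Killed k)
        killed? k = Any.any? (λ t → (proj₁ t ≟ᶠ k) ×-dec Zero? (apply rows (proj₂ t))) tags

        alive? : ∀ k → Dec (¬ Killed k)
        alive? k = ¬? (killed? k)

        I₀ : List (Fin m)
        I₀ = filter alive? (allFin m)

        alive : ∀ {k} → k ∈ I₀ → ¬ Killed k
        alive k∈ = proj₂ (∈-filter⁻ alive? {xs = allFin m} k∈)

        x y z : Fin m → Vec ℤ d
        x k = apply rows (X k)
        y k = apply rows (Y k)
        z k = apply rows (Z k)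

        survive : ∀ {k} → k ∈ I₀ → ∀ u v → (k , sub u v) ∈ differences → Zero (sub (apply rows u) (apply rows v)) → Zero (sub u v)
        survive k∈ u v t∈ Zs with Zero? (sub u v)
        ... | yes Zuv = Zuv
        ... | no ¬Zuv = ⊥-elim (alive k∈ (lose (∈-filter⁺ nonzero? t∈ ¬Zuv) (refl , subst Zero (sym (apply-sub rows u v)) Zs)))

        ∈x : ∀ k l → (k , sub (X k) (X l)) ∈ differences
        ∈x k l = ∈-++⁺ˡ (∈-map⁺ (λ (k , l) → k , sub (X k) (X l)) (∈-cartesianProduct⁺ (∈-allFin k) (∈-allFin l)))
        ∈y : ∀ k l → (k , sub (Y k) (Y l)) ∈ differences
        ∈y k l = ∈-++⁺ʳ (map (λ (k , l) → k , sub (X k) (X l)) squares)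
          (∈-++⁺ˡ (∈-map⁺ (λ (k , l) → k , sub (Y k) (Y l)) (∈-cartesianProduct⁺ (∈-allFin k) (∈-allFin l))))
        ∈z : ∀ k l → (k , sub (Z k) (Z l)) ∈ differences
        ∈z k l = ∈-++⁺ʳ (map (λ (k , l) → k , sub (X k) (X l)) squares) (∈-++⁺ʳ (map (λ (k , l) → k , sub (Y k) (Y l)) squares)
          (∈-++⁺ˡ (∈-map⁺ (λ (k , l) → k , sub (Z k) (Z l)) (∈-cartesianProduct⁺ (∈-allFin k) (∈-allFin l)))))
        ∈s : ∀ k σ → (k , sub (Z k) (S σ)) ∈ differences
        ∈s k σ = ∈-++⁺ʳ (map (λ (k , l) → k , sub (X k) (X l)) squares) (∈-++⁺ʳ (map (λ (k , l) → k , sub (Y k) (Y l)) squares)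
          (∈-++⁺ʳ (map (λ (k , l) → k , sub (Z k) (Z l)) squares)
            (∈-map⁺ (λ (k , σ) → k , sub (Z k) (S σ)) (∈-cartesianProduct⁺ (∈-allFin k) (∈-allFin σ)))))

        open Regular p p-prime x y z
        open Configurations p p-prime {m} using (Triple; ix; iy; iz)

        admissible : Admissible I₀
        admissible = record
          { unique = filter⁺ alive? (allFin⁺ m)
          ; diag   = λ {k} _ → subst Zero (apply-tri rows (X k) (Y k) (Z k)) (apply-zero rows (tri (X k) (Y k) (Z k)) (residues-sum (a (proj₁ (φ k))) (b (proj₂ (φ k)))))
          ; x-inj  = λ {k} {l} k∈ _ Zs → φ-inj k l (inj₁ᶠ (φ∈ k) (φ∈ l) (a-inj _ _ (residues-sub _ _ (survive k∈ (X k) (X l) (∈x k l) Zs))))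
          ; y-inj  = λ {k} {l} k∈ _ Zs → φ-inj k l (inj₂ᶠ (φ∈ k) (φ∈ l) (b-inj _ _ (residues-sub _ _ (survive k∈ (Y k) (Y l) (∈y k l) Zs))))
          ; z-inj  = λ {k} {l} k∈ _ Zs → φ-inj k l (inj~ (φ∈ k) (φ∈ l) (residues-sub _ _ (survive k∈ (Z k) (Z l) (∈z k l) Zs))) }

        -- The projection may create solutions that did not exist before, but not over Γ: if the
        -- pair were in Γ, its sum would be some S σ with the same projection as Z r. Survival of r
        -- gives Z r = S σ, which contradicts `avoids`.
        solution-outside-Γ : ∀ {τ} → τ ∈ solutions I₀ → ¬ proj₂ (φ (iy τ)) ∈ˢ Γ (proj₁ (φ (ix τ)))
        solution-outside-Γ {k , l , r} τ∈ j∈ with proj₂ (proj₂ (proj₂ hc)) (a (proj₁ (φ k)) +ₚ b (proj₂ (φ l))) (_ , _ , j∈ , refl)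
        ... | σ , eq = avoids (φ∈ r) j∈ (trans (residues-sub _ _ (survive r∈ (Z r) (S σ) (∈s r σ)
                (Zero-tri-sub (x k) (y l) (z r) (apply rows (S σ)) (proj₂ (∈-solutions⁻ {I₀} τ∈)) sum-S))) (sym eq))
          where
          r∈ : r ∈ I₀
          r∈ = proj₂ (proj₂ (proj₁ (∈-solutions⁻ {I₀} τ∈)))
          sum-S : Zero (tri (x k) (y l) (apply rows (S σ)))
          sum-S = subst Zero (apply-tri rows (X k) (Y l) (S σ)) (apply-zero rows (tri (X k) (Y l) (S σ))
            (subst (λ w → Zero (tri (X k) (Y l) (residues w))) eq (residues-sum (a (proj₁ (φ k))) (b (proj₂ (φ l))))))

        -- By the preceding lemma the first two indices give a pair outside Γ, and they determine
        -- the third through injectivity of the projected z's.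
        few-solutions : length (solutions I₀) ≤ nonΓ Γ
        few-solutions = ≤-trans (≤-reflexive (sym (∑-1 (solutions I₀))))
          (≤-trans (#-≤-rel {P = λ _ → ⊤} (λ _ → yes tt) (λ (w : Fin N × Fin N) → ¬? (proj₂ w ∈? Γ (proj₁ w)))
            (λ τ w → w ≡ (proj₁ (φ (ix τ)) , proj₂ (φ (iy τ)))) (solutions I₀) (cartesianProduct (allFin N) (allFin N)) (solutions-unique admissible)
            (λ {τ} τ∈ _ → _ , ∈-cartesianProduct⁺ (∈-allFin _) (∈-allFin _) , solution-outside-Γ τ∈ , refl)
            same)
          (≤-reflexive (∑-cartesianProduct (allFin N) (allFin N) (λ w → non Γ (proj₁ w) (proj₂ w)))))
          where
          same : ∀ {τ τ′ : Triple} {w} → τ ∈ solutions I₀ → τ′ ∈ solutions I₀ → w ≡ (proj₁ (φ (ix τ)) , proj₂ (φ (iy τ))) → w ≡ (proj₁ (φ (ix τ′)) , proj₂ (φ (iy τ′))) → τ ≡ τ′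
          same {k , l , r} {k′ , l′ , r′} τ∈ τ′∈ refl e =
            by (φ-inj k k′ (inj₁ᶠ (φ∈ k) (φ∈ k′) (cong proj₁ e))) (φ-inj l l′ (inj₂ᶠ (φ∈ l) (φ∈ l′) (cong proj₂ e))) τ′∈
            where
            by : ∀ {k′ l′} → k ≡ k′ → l ≡ l′ → (k′ , l′ , r′) ∈ solutions I₀ → (k , l , r) ≡ (k′ , l′ , r′)
            by refl refl τ′∈ = cong (λ r → k , l , r) (Admissible.z-inj admissible (proj₂ (proj₂ (proj₁ (∈-solutions⁻ {I₀} τ∈)))) (proj₂ (proj₂ (proj₁ (∈-solutions⁻ {I₀} τ′∈))))
              (Zero-tri-sub (x k) (y l) (z r) (z r′) (proj₂ (∈-solutions⁻ {I₀} τ∈)) (proj₂ (∈-solutions⁻ {I₀} τ′∈))))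

        I₀≤solutions : length I₀ ≤ length (solutions I₀)
        I₀≤solutions = ≤-trans (≤-reflexive (sym (∑-1 I₀))) (≤-trans
          (#-≤-rel {P = λ _ → ⊤} (λ _ → yes tt) {Q = λ (τ : Triple) → ⊤} (λ _ → yes tt) (λ i τ → τ ≡ (i , i , i)) I₀ (solutions I₀) (Admissible.unique admissible)
            (λ {i} i∈ _ → (i , i , i) , ∈-solutions⁺ {I₀} i∈ i∈ i∈ (Admissible.diag admissible i∈) , tt , refl)
            (λ _ _ e e′ → cong ix (trans (sym e) e′)))
          (≤-reflexive (∑-1 (solutions I₀))))

        -- There are at most m W tagged differences and at most a proportion p^(-d) of them is
        -- killed; with p^d ≥ 2W at most half of the family is lost.
        many-alive : ∀ W → 1 ≤ W → 2 * (3 * m + s) ≤ 2 * W → 2 * W ≤ p ^ d → m ≤ 2 * length I₀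
        many-alive W 1≤W tags≤ W≤ = *-cancelʳ-≤ m (2 * length I₀) (2 * W) {{>-nonZero (*-mono-≤ {1} {2} (s≤s z≤n) 1≤W)}}
            (linear _ _ (m * (2 * W)) (begin
              m * (2 * W) + m * (2 * W)               ≡⟨ double m W ⟩
              2 * m * (2 * W)                         ≡⟨ cong (λ l → 2 * l * (2 * W)) (sym (trans (cong (_+ K) (length-filter-# alive? (allFin m))) total)) ⟩
              2 * (length I₀ + K) * (2 * W)           ≡⟨ spread (length I₀) K W ⟩
              2 * (2 * W * K) + 2 * length I₀ * (2 * W) ≤⟨ +-monoˡ-≤ _ (*-monoʳ-≤ 2 (≤-trans (*-monoˡ-≤ K W≤) (≤-trans killed≤ tag-count))) ⟩
              2 * (m * W) + 2 * length I₀ * (2 * W)   ≡⟨ cong (_+ 2 * length I₀ * (2 * W)) (swap m W) ⟩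
              m * (2 * W) + 2 * length I₀ * (2 * W)   ∎) refl refl)
          where
          open ≤-Reasoning
          K = # killed? (allFin m)
          total : # alive? (allFin m) + K ≡ m
          total = trans (+-comm (# alive? (allFin m)) K) (trans (#-¬ killed? (allFin m)) (length-allFin m))
          double : ∀ m W → m * (2 * W) + m * (2 * W) ≡ 2 * m * (2 * W)
          double = solve-∀
          spread : ∀ l K W → 2 * (l + K) * (2 * W) ≡ 2 * (2 * W * K) + 2 * l * (2 * W)
          spread = solve-∀
          swap : ∀ m W → 2 * (m * W) ≡ m * (2 * W)
          swap = solve-∀
          killed≤ : p ^ d * K ≤ length tags
          killed≤ = ≤-trans (*-monoʳ-≤ (p ^ d) (#-≤-rel killed? (λ t → Zero? (apply rows (proj₂ t))) (λ k t → proj₁ t ≡ k) (allFin m) tags (allFin⁺ m)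
              (λ _ κ → let t , t∈ , e , Zt = find κ in t , t∈ , Zt , e) (λ _ _ e e′ → trans (sym e) e′))) few-killed
          tag-count : length tags ≤ m * W
          tag-count = ≤-trans length-tags (*-monoʳ-≤ m (*-cancelˡ-≤ 2 tags≤))

  -- Choice of the codimension and of the exponent

  module VectorBounds (p : ℕ) (p-prime : Prime p) where

    open Mod p p-prime using (1<p)

    -- With 2^λ ≤ q < 2^(λ+1) the codimension is 14 B λ. `B` makes 2^(B λ) exceed 138240 p² q², and
    -- `C₁` makes p^(14 B λ) at most q^C₁ through the crude estimate p ≤ 2^p.
    B C₁ : ℕ
    B  = 22 + 2 * p
    C₁ = p * (14 * B)

    n≤2^n : ∀ n → n ≤ 2 ^ n
    n≤2^n zero    = z≤n
    n≤2^n (suc n) = ≤-trans (+-mono-≤ (m^n>0 2 n) (n≤2^n n)) (≤-reflexive (cong (2 ^ n +_) (sym (+-identityʳ _))))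

    module Log (q : ℕ) (2≤q : 2 ≤ q) (l : ℕ) (lo : 2 ^ suc l ≤ q) (hi : q < 2 * 2 ^ suc l) where
      λ′ : ℕ
      λ′ = suc l
      open ≤-Reasoning
      h : ℕ
      h = B * λ′
      power : 144 * q * p ^ (14 * h) ≤ q ^ (9 + C₁)
      power = begin
        144 * q * p ^ (14 * h)            ≤⟨ *-mono-≤ (*-monoˡ-≤ q (≤-trans (≤ᵇ⇒≤ 144 (2 ^ 8) _) (^-monoˡ-≤ 8 2≤q))) (^-monoˡ-≤ (14 * h) (n≤2^n p)) ⟩
        q ^ 8 * q * (2 ^ p) ^ (14 * h)    ≡⟨ cong₂ _*_ (*-comm (q ^ 8) q) (trans (^-*-assoc 2 p (14 * h)) (trans (cong (2 ^_) (regroup p B λ′)) (sym (^-*-assoc 2 λ′ C₁)))) ⟩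
        q ^ 9 * (2 ^ λ′) ^ C₁             ≤⟨ *-monoʳ-≤ (q ^ 9) (^-monoˡ-≤ C₁ lo) ⟩
        q ^ 9 * q ^ C₁                    ≡⟨ sym (^-distribˡ-+-* q 9 C₁) ⟩
        q ^ (9 + C₁)                      ∎
        where
        regroup : ∀ p B l → p * (14 * (B * l)) ≡ l * (p * (14 * B))
        regroup = solve-∀
      base : 2 ^ h * 19 ^ (14 * h) ≤ 20 ^ (14 * h)
      base = begin
        2 ^ h * 19 ^ (14 * h)    ≡⟨ cong (2 ^ h *_) (sym (^-*-assoc 19 14 h)) ⟩
        2 ^ h * (19 ^ 14) ^ h    ≡⟨ sym (^-distrib 2 (19 ^ 14) h) ⟩
        (2 * 19 ^ 14) ^ h        ≤⟨ ^-monoˡ-≤ h (≤ᵇ⇒≤ (2 * 19 ^ 14) (20 ^ 14) _) ⟩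
        (20 ^ 14) ^ h            ≡⟨ ^-*-assoc 20 14 h ⟩
        20 ^ (14 * h)            ∎
      constants : ∀ c k → c ≤ 2 ^ k → k + (p + p) + (suc λ′ + suc λ′) ≤ h → c * (p * p) * (q * q) ≤ 2 ^ h
      constants c k c≤ exponent = begin
        c * (p * p) * (q * q)
          ≤⟨ *-mono-≤ (*-mono-≤ c≤ (*-mono-≤ (n≤2^n p) (n≤2^n p))) (*-mono-≤ (<⇒≤ hi) (<⇒≤ hi)) ⟩
        2 ^ k * (2 ^ p * 2 ^ p) * (2 ^ suc λ′ * 2 ^ suc λ′)
          ≡⟨ sym (trans (^-distribˡ-+-* 2 (k + (p + p)) (suc λ′ + suc λ′)) (cong₂ _*_ (trans (^-distribˡ-+-* 2 k (p + p)) (cong (2 ^ k *_) (^-distribˡ-+-* 2 p p))) (^-distribˡ-+-* 2 (suc λ′) (suc λ′)))) ⟩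
        2 ^ (k + (p + p) + (suc λ′ + suc λ′))
          ≤⟨ ^-monoʳ-≤ 2 exponent ⟩
        2 ^ h ∎
      -- The exponents come from 138240 ≤ 2^18, p² ≤ 2^(2p) and q² ≤ 2^(2(λ+1)). Equality holds at λ
      -- = 1, which determines B = 22 + 2p.
      exponent : 18 + (p + p) + (suc λ′ + suc λ′) ≤ h
      exponent = ≤-trans (m≤m+n _ ((20 + 2 * p) * l)) (≤-reflexive (expand-h p l))
        where
        expand-h : ∀ p l → 18 + (p + p) + (suc (suc l) + suc (suc l)) + (20 + 2 * p) * l ≡ (22 + 2 * p) * suc l
        expand-h = solve-∀
      gap : 138240 * (p * p) * (q * q) * 19 ^ (14 * h) ≤ 20 ^ (14 * h)
      gap = ≤-trans (*-monoˡ-≤ (19 ^ (14 * h)) (constants 138240 18 (≤ᵇ⇒≤ 138240 (2 ^ 18) _) exponent)) base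

    -- The codimension is 14 B λ with 2^λ ≤ q < 2^(λ+1), since 2 · 19¹⁴ ≤ 20¹⁴.
    codimension : ∀ q → 2 ≤ q → ∃ λ e → 144 * q * p ^ e ≤ q ^ (9 + C₁) × 138240 * (p * p) * (q * q) * 19 ^ e ≤ 20 ^ e
    codimension q 2≤q = by (log-floor 2 ≤-refl q (≤-trans (s≤s z≤n) 2≤q))
      where
      by : (∃ λ l → 2 ^ l ≤ q × q < 2 * 2 ^ l) → ∃ λ e → 144 * q * p ^ e ≤ q ^ (9 + C₁) × 138240 * (p * p) * (q * q) * 19 ^ e ≤ 20 ^ e
      by (zero , _ , q<2)     = ⊥-elim (<⇒≱ q<2 2≤q)
      by (suc l , lo , hi) = 14 * Log.h q 2≤q l lo hi , Log.power q 2≤q l lo hi , Log.gap q 2≤q l lo hi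

  module VectorSpace (p : ℕ) (p-prime : Prime p) .{{_ : NonZero p}} where

    open VectorBounds p p-prime
    open Mod p p-prime using (1<p)

    -- Heavy indices number at most 18 T/p^j ≤ 18 U p^e/N, and U ≤ N²/D. Hence D needs the size 144
    -- q p^e, where 144 = 8 · 18.
    remainder-small : ∀ {N q e j r T U D} → 1 ≤ N → N ≤ p ^ j * p ^ e → p ^ j * r ≤ 18 * T → T ≤ U → D * U ≤ N * N →
      144 * q * p ^ e ≤ D → 8 * q * r ≤ N
    remainder-small {N} {q} {e} {j} {r} {T} {U} {D} 1≤N N≤ r≤ T≤U DU≤ ≤D =
      *-cancelʳ-≤ _ N (18 * (p ^ e * N)) {{>-nonZero (*-mono-≤ {1} {18} (s≤s z≤n) (*-mono-≤ (m^n>0 p e) 1≤N))}} (begin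
        8 * q * r * (18 * (P * N))           ≡⟨ shuffle₁ q r P N ⟩
        144 * q * P * r * N                  ≤⟨ *-mono-≤ (*-monoˡ-≤ r ≤D) N≤ ⟩
        D * r * (Q * P)                      ≡⟨ shuffle₂ D r Q P ⟩
        D * P * (Q * r)                      ≤⟨ *-monoʳ-≤ (D * P) (≤-trans r≤ (*-monoʳ-≤ 18 T≤U)) ⟩
        D * P * (18 * U)                     ≡⟨ shuffle₃ D P U ⟩
        18 * P * (D * U)                     ≤⟨ *-monoʳ-≤ (18 * P) DU≤ ⟩
        18 * P * (N * N)                     ≡⟨ shuffle₄ P N ⟩
        N * (18 * (P * N))                   ∎)
      where
      open ≤-Reasoning
      P = p ^ e
      Q = p ^ j
      shuffle₁ : ∀ q r P N → 8 * q * r * (18 * (P * N)) ≡ 144 * q * P * r * N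
      shuffle₁ = solve-∀
      shuffle₂ : ∀ D r J P → D * r * (J * P) ≡ D * P * (J * r)
      shuffle₂ = solve-∀
      shuffle₃ : ∀ D P U → D * P * (18 * U) ≡ 18 * P * (D * U)
      shuffle₃ = solve-∀
      shuffle₄ : ∀ P N → 18 * P * (N * N) ≡ N * (18 * (P * N))
      shuffle₄ = solve-∀

    -- Here M stands for p^d, which is at most p · 2 (3 + q) N and so at most 8 p q N; with the
    -- outer 8 q this makes 64 p² q², and the gap F/E has to absorb it.
    light-small : ∀ k {N q l E F M} → 1 ≤ q → 1 ≤ E → l * E ≤ k * (p * M) * F → M ≤ p * (2 * ((3 + q) * N)) →
      k * 64 * (p * p) * (q * q) * F ≤ E → 8 * q * l ≤ N
    light-small k {N} {q} {l} {E} {F} {M} 1≤q 1≤E l≤ M≤ gap = *-cancelʳ-≤ _ N E {{>-nonZero 1≤E}} (begin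
      8 * q * l * E                                             ≡⟨ *-assoc (8 * q) l E ⟩
      8 * q * (l * E)                                           ≤⟨ *-monoʳ-≤ (8 * q) l≤ ⟩
      8 * q * (k * (p * M) * F)                                 ≤⟨ *-monoʳ-≤ (8 * q) (*-monoˡ-≤ F (*-monoʳ-≤ k (*-monoʳ-≤ p M≤))) ⟩
      8 * q * (k * (p * (p * (2 * ((3 + q) * N)))) * F)         ≤⟨ *-monoʳ-≤ (8 * q) (*-monoˡ-≤ F (*-monoʳ-≤ k (*-monoʳ-≤ p (*-monoʳ-≤ p (*-monoʳ-≤ 2 (*-monoˡ-≤ N four)))))) ⟩
      8 * q * (k * (p * (p * (2 * (4 * q * N)))) * F)           ≡⟨ collect k p q N F ⟩
      N * (k * 64 * (p * p) * (q * q) * F)                      ≤⟨ *-monoʳ-≤ N gap ⟩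
      N * E                                                     ∎)
      where
      open ≤-Reasoning
      four : 3 + q ≤ 4 * q
      four = ≤-trans (+-monoˡ-≤ q (*-monoʳ-≤ 3 1≤q)) (≤-reflexive (collect-q q))
        where
        collect-q : ∀ q → 3 * q + q ≡ 4 * q
        collect-q = solve-∀
      collect : ∀ k p q N F → 8 * q * (k * (p * (p * (2 * (4 * q * N)))) * F) ≡ N * (k * 64 * (p * p) * (q * q) * F)
      collect = solve-∀

    module _ {N n : ℕ} (a b : Fin N → Vec (Fin p) n)
      (a-inj : ∀ i j → a i ≡ a j → i ≡ j) (b-inj : ∀ i j → b i ≡ b j → i ≡ j) (Γ : Rel₂ N) (s : ℕ)
      (hc : HasCard _≡_ (_+ₚ_ {p} {n}) (RestrictedSumset _≡_ _+ₚ_ a b Γ) s) where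

      open FamilyModel p p-prime a b a-inj b-inj Γ s hc

      family-small : ∀ (F : Family Γ (λ _ → ⊤) (λ _ → ⊤) _~_) q → 2 ≤ q → 1 ≤ N → s ≤ q * N →
        q ^ (9 + C₁) * nonΓ Γ ≤ N * N → 2 * q * length (Family.pairs F) ≤ N
      family-small F q 2≤q 1≤N s≤ few = by-dim (log-floor p 1<p (2 * W) 1≤2W)
        where
        open ≤-Reasoning
        W : ℕ
        W = (3 + q) * N
        1≤q : 1 ≤ q
        1≤q = ≤-trans (s≤s z≤n) 2≤q
        1≤W : 1 ≤ W
        1≤W = *-mono-≤ {1} {3 + q} (s≤s z≤n) 1≤N
        1≤2W : 1 ≤ 2 * W
        1≤2W = *-mono-≤ {1} {2} (s≤s z≤n) 1≤W
        M : ℕ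
        M = length (Family.pairs F)
        M≤N : M ≤ N
        M≤N = ≤-trans (≤-reflexive (sym (∑-1 (Family.pairs F)))) (≤-trans
          (#-≤-rel {P = λ _ → ⊤} (λ _ → yes tt) {Q = λ (i : Fin N) → ⊤} (λ _ → yes tt) (λ φ i → i ≡ proj₁ φ) (Family.pairs F) (allFin N) (Family.unique F)
            (λ {φ} _ _ → proj₁ φ , ∈-allFin (proj₁ φ) , tt , refl) (λ φ∈ ψ∈ e e′ → Family.inj₁ᶠ F φ∈ ψ∈ (trans (sym e) e′)))
          (≤-reflexive (trans (∑-1 (allFin N)) (length-allFin N))))
        tags≤ : 2 * (3 * M + s) ≤ 2 * W
        tags≤ = *-monoʳ-≤ 2 (≤-trans (+-mono-≤ (*-monoʳ-≤ 3 M≤N) s≤) (≤-reflexive (sym (*-distribʳ-+ N 3 q))))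
        N≤2W : N ≤ 2 * W
        N≤2W = ≤-trans (≤-trans (m≤m+n N ((2 + q) * N)) (m≤m+n W _)) ≤-refl
        e : ℕ
        e = proj₁ (codimension q 2≤q)
        ≤D : 144 * q * p ^ e ≤ q ^ (9 + C₁)
        ≤D = proj₁ (proj₂ (codimension q 2≤q))
        by-dim : (∃ λ d → p ^ d ≤ 2 * W × 2 * W < p * p ^ d) → 2 * q * M ≤ N
        by-dim (d′ , lo , hi) = by-size (e ≤? d)
          where
          d : ℕ
          -- One above the floor of the logarithm: p^d exceeds 2W, as `many-alive` requires, while
          -- p^d ≤ p · 2W keeps the dimension bounded for `light-small`.
          d = suc d′
          open Projected F d
          open Regular p p-prime x y z
          N≤p^d : N ≤ p ^ d
          N≤p^d = ≤-trans N≤2W (<⇒≤ hi)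
          half : M ≤ 2 * length I₀
          half = many-alive W 1≤W tags≤ (<⇒≤ hi)
          from-I₀ : 4 * q * length I₀ ≤ N → 2 * q * M ≤ N
          from-I₀ h = ≤-trans (*-monoʳ-≤ (2 * q) half) (≤-trans (≤-reflexive (shuffle q (length I₀))) h)
            where
            shuffle : ∀ q l → 2 * q * (2 * l) ≡ 4 * q * l
            shuffle = solve-∀
          from-8 : ∀ {r} → 8 * q * r ≤ N → 4 * q * r ≤ N
          from-8 {r} h = ≤-trans (*-monoˡ-≤ r (*-monoˡ-≤ q (≤ᵇ⇒≤ 4 8 _))) h
          by-size : Dec (e ≤ d) → 2 * q * M ≤ N
          -- The dimension is too small for the slice rank gain. All indices are then treated as
          -- heavy at scale 1: their diagonal solutions alone outnumber the pairs outside Γ unless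
          -- there are few indices.
          by-size (no ¬e≤d) = from-I₀ (from-8 {length I₀} (remainder-small {q = q} {e = e} {j = 0} {T = length (solutions I₀)} 1≤N
              (≤-trans N≤p^d (≤-trans (^-monoʳ-≤ p {{>-nonZero (<⇒≤ 1<p)}} (<⇒≤ (≰⇒> ¬e≤d))) (≤-reflexive (sym (+-identityʳ (p ^ e))))))
              (≤-trans (≤-reflexive (+-identityʳ (length I₀))) (≤-trans I₀≤solutions (m≤m+n _ _))) few-solutions few ≤D))
          by-size (yes e≤d) = from-I₀ (finish (admissible-size (d ∸ e) e (sym (m∸n+n≡m e≤d)) admissible))
            where
            finish : (∃ λ r → length I₀ ≤ r + length (filter (light? (p ^ (d ∸ e)) I₀) I₀) × p ^ (d ∸ e) * r ≤ 18 * length (solutions I₀) ×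
              length (filter (light? (p ^ (d ∸ e)) I₀) I₀) * 20 ^ e ≤ 2160 * (p * p ^ d) * 19 ^ e) → 4 * q * length I₀ ≤ N
            finish (r , I₀≤ , r≤ , l≤) = *-cancelˡ-≤ 2 (begin
              2 * (4 * q * length I₀)       ≤⟨ *-monoʳ-≤ 2 (*-monoʳ-≤ (4 * q) I₀≤) ⟩
              2 * (4 * q * (r + l))         ≡⟨ shuffle q r l ⟩
              8 * q * r + 8 * q * l         ≤⟨ +-mono-≤ (remainder-small {q = q} {e = e} {j = d ∸ e} 1≤N
                                                  (≤-trans N≤p^d (≤-reflexive (trans (cong (p ^_) (sym (m∸n+n≡m e≤d))) (^-distribˡ-+-* p (d ∸ e) e)))) r≤ few-solutions few ≤D)
                                                (light-small 2160 1≤q (m^n>0 20 e) l≤ (*-monoʳ-≤ p lo) (proj₂ (proj₂ (codimension q 2≤q)))) ⟩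
              N + N                         ≡⟨ cong (N +_) (sym (+-identityʳ N)) ⟩
              2 * N                         ∎)
              where
              l = length (filter (light? (p ^ (d ∸ e)) I₀) I₀)
              shuffle : ∀ q r l → 2 * (4 * q * (r + l)) ≡ 8 * q * r + 8 * q * l
              shuffle = solve-∀

    worksNat-vector : ∀ n q → 2 ≤ q → WorksNat _≡_ (_+ₚ_ {p} {n}) q (q ^ (9 + C₁))
    worksNat-vector n q 2≤q zero    a b a-inj b-inj Γ s hc dense s≤ = Vec.[] , Vec.[] , ≤-trans (≤-reflexive (*-zeroʳ q)) z≤n , ≤-trans (≤-reflexive (*-zeroʳ q)) z≤n ,
      0 , ≤-trans (≤-reflexive (*-zeroʳ q)) z≤n , (λ ()) , (λ { x (() , _) })
    worksNat-vector n q 2≤q N@(suc _) a b a-inj b-inj Γ s hc dense s≤ =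
      assemble _≡_ _+ₚ_ ≡-isEquivalence a b Γ s q hc any₁? any₁? _~?_ sym id none none
        (family-small a b a-inj b-inj Γ s hc (maximal-family _≡_ _+ₚ_ ≡-isEquivalence a b Γ s q hc any₁? any₁? _~?_ sym id) q 2≤q (s≤s z≤n) s≤ (few-non Γ (q ^ (9 + C₁)) dense))
      where
      open FamilyModel p p-prime a b a-inj b-inj Γ s hc using (_~_; _~?_)
      any₁? : (i : Fin N) → Dec ⊤
      any₁? _ = yes tt
      none : 2 * q * (∑[ i ∈ allFin N ] 𝟙 (¬? (any₁? i))) ≤ N
      none = ≤-trans (≤-reflexive (trans (cong (2 * q *_) (∑-0 (allFin N) (λ _ → refl))) (*-zeroʳ (2 * q)))) z≤n

  -- Rational parameters

  fromℕ : ℕ → ℚ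
  fromℕ n = mkℚ (ℤ.+ n) 0 (Coprimality.sym (Coprimality.1-coprimeTo n))

  ℕ→ℚ≡fromℕ : ∀ n → ℕ→ℚ n ≡ fromℕ n
  ℕ→ℚ≡fromℕ n = ℚP.normalize-coprime (Coprimality.sym (Coprimality.1-coprimeTo n))

  ℕ→ℚ-mono : ∀ m n → m ≤ n → ℕ→ℚ m ≤ʳ ℕ→ℚ n
  ℕ→ℚ-mono m n m≤n = subst₂ _≤ʳ_ (sym (ℕ→ℚ≡fromℕ m)) (sym (ℕ→ℚ≡fromℕ n)) (*≤* (ℤP.*-monoʳ-≤-nonNeg (ℤ.+ 1) (ℤ.+≤+ m≤n)))

  ℕ→ℚ-cancel : ∀ m n → ℕ→ℚ m ≤ʳ ℕ→ℚ n → m ≤ n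
  ℕ→ℚ-cancel m n h with subst₂ _≤ʳ_ (ℕ→ℚ≡fromℕ m) (ℕ→ℚ≡fromℕ n) h
  ... | *≤* le = ℤP.drop‿+≤+ (subst₂ ℤ._≤_ (ℤP.*-identityʳ (ℤ.+ m)) (ℤP.*-identityʳ (ℤ.+ n)) le)

  ℕ→ℚ-+ : ∀ m n → ℕ→ℚ (m + n) ≡ ℕ→ℚ m +ʳ ℕ→ℚ n
  ℕ→ℚ-+ m n = trans (ℕ→ℚ≡fromℕ (m + n)) (trans (ℚP.toℚᵘ-injective (ℚᵘP.≃-trans (ℚᵘ.*≡* values)
      (ℚᵘP.≃-sym (ℚP.toℚᵘ-homo-+ (fromℕ m) (fromℕ n))))) (sym (cong₂ _+ʳ_ (ℕ→ℚ≡fromℕ m) (ℕ→ℚ≡fromℕ n))))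
    where
    values : ℤ.+ (m + n) ℤ.* ℤ.+ 1 ≡ (ℤ.+ m ℤ.* ℤ.+ 1 ℤ.+ ℤ.+ n ℤ.* ℤ.+ 1) ℤ.* ℤ.+ 1
    values = cong (ℤ._* ℤ.+ 1) (trans (ℤP.pos-+ m n) (sym (cong₂ ℤ._+_ (ℤP.*-identityʳ (ℤ.+ m)) (ℤP.*-identityʳ (ℤ.+ n)))))

  ℕ→ℚ-* : ∀ m n → ℕ→ℚ (m * n) ≡ ℕ→ℚ m *ʳ ℕ→ℚ n
  ℕ→ℚ-* m n = trans (ℕ→ℚ≡fromℕ (m * n)) (trans (ℚP.toℚᵘ-injective (ℚᵘP.≃-trans (ℚᵘ.*≡* (cong (ℤ._* ℤ.+ 1) (ℤP.pos-* m n)))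
      (ℚᵘP.≃-sym (ℚP.toℚᵘ-homo-* (fromℕ m) (fromℕ n))))) (sym (cong₂ _*ʳ_ (ℕ→ℚ≡fromℕ m) (ℕ→ℚ≡fromℕ n))))

  ℕ→ℚ-nonNeg : ∀ n → NonNegative (ℕ→ℚ n)
  ℕ→ℚ-nonNeg n = nonNegative (ℕ→ℚ-mono 0 n z≤n)

  ℕ→ℚ-pos : ∀ {n} → 1 ≤ n → Positive (ℕ→ℚ n)
  ℕ→ℚ-pos {n} 1≤n = positive (ℚP.<-≤-trans (*<* (ℤ.+<+ (s≤s z≤n))) (ℕ→ℚ-mono 1 n 1≤n))

  ≤ʳ-scale : ∀ r {x y} → NonNegative r → x ≤ʳ y → r *ʳ x ≤ʳ r *ʳ y
  ≤ʳ-scale r nn h = ℚP.*-monoˡ-≤-nonNeg r {{nn}} h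

  works-from-nat : ∀ {c ℓ} {G : Set c} (_≈_ : G → G → Set ℓ) (_∙_ : G → G → G) {K ε δ : ℚ} {q D : ℕ} →
    K ≤ʳ ℕ→ℚ q → 1ℚ ≤ʳ ε *ʳ ℕ→ℚ q → δ *ʳ ℕ→ℚ D ≤ʳ 1ℚ → WorksNat _≈_ _∙_ q D → Works _≈_ _∙_ K ε δ
  works-from-nat _≈_ _∙_ {K} {ε} {δ} {q} {D} K≤q 1≤εq δD≤1 worksNat N a b a-inj b-inj Γ s hc dense s≤KN =
    finish (worksNat N a b a-inj b-inj Γ s hc dense′ s≤qN)
    where
    dense′ : D * (N * N) ≤ D * cardΓ Γ + N * N
    dense′ = ℕ→ℚ-cancel (D * (N * N)) (D * cardΓ Γ + N * N) (subst₂ _≤ʳ_ (sym (ℕ→ℚ-* D (N * N))) (sym (trans (ℕ→ℚ-+ (D * cardΓ Γ) (N * N)) (cong (_+ʳ S) (ℕ→ℚ-* D (cardΓ Γ)))))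
      (begin
        d *ʳ S                              ≡⟨ split d S δ ⟩
        d *ʳ ((1ℚ -ʳ δ) *ʳ S) +ʳ δ *ʳ d *ʳ S  ≤⟨ ℚP.+-mono-≤ (≤ʳ-scale d (ℕ→ℚ-nonNeg D) dense) (ℚP.*-monoʳ-≤-nonNeg S {{ℕ→ℚ-nonNeg (N * N)}} δD≤1) ⟩
        d *ʳ ℕ→ℚ (cardΓ Γ) +ʳ 1ℚ *ʳ S       ≡⟨ cong (d *ʳ ℕ→ℚ (cardΓ Γ) +ʳ_) (ℚP.*-identityˡ S) ⟩
        d *ʳ ℕ→ℚ (cardΓ Γ) +ʳ S             ∎))
      where
      open ℚP.≤-Reasoning
      d S : ℚ
      d = ℕ→ℚ D
      S = ℕ→ℚ (N * N)
      split : ∀ d S δ → d *ʳ S ≡ d *ʳ ((1ℚ -ʳ δ) *ʳ S) +ʳ δ *ʳ d *ʳ S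
      split = solve 3 (λ d S δ → d :* S := d :* ((con 1ℚ :- δ) :* S) :+ δ :* d :* S) refl
        where open +-*-Solver
    s≤qN : s ≤ q * N
    s≤qN = ℕ→ℚ-cancel s (q * N) (subst (ℕ→ℚ s ≤ʳ_) (sym (ℕ→ℚ-* q N)) (ℚP.≤-trans s≤KN (ℚP.*-monoʳ-≤-nonNeg (ℕ→ℚ N) {{ℕ→ℚ-nonNeg N}} K≤q)))
    open ℚP.≤-Reasoning
    Q n : ℚ
    Q = ℕ→ℚ q
    n = ℕ→ℚ N
    1≤q : 1 ≤ q
    1≤q = n≢0⇒n>0 λ q≡0 → <⇒≱ (s≤s z≤n) (ℕ→ℚ-cancel 1 0 (subst (1ℚ ≤ʳ_) (trans (cong (λ q → ε *ʳ ℕ→ℚ q) q≡0) (ℚP.*-zeroʳ ε)) 1≤εq))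
    n≤ : n ≤ʳ ε *ʳ Q *ʳ n
    n≤ = ℚP.≤-trans (ℚP.≤-reflexive (sym (ℚP.*-identityˡ n))) (ℚP.*-monoʳ-≤-nonNeg n {{ℕ→ℚ-nonNeg N}} 1≤εq)
    large : ∀ k → q * N ≤ q * k + N → (1ℚ -ʳ ε) *ʳ n ≤ʳ ℕ→ℚ k
    large k h = ℚP.*-cancelˡ-≤-pos Q {{ℕ→ℚ-pos 1≤q}} (begin
      Q *ʳ ((1ℚ -ʳ ε) *ʳ n)            ≡⟨ split Q n ε ⟩
      Q *ʳ n -ʳ ε *ʳ Q *ʳ n            ≤⟨ ℚP.+-mono-≤ le (ℚP.neg-antimono-≤ n≤) ⟩
      Q *ʳ ℕ→ℚ k +ʳ n -ʳ n             ≡⟨ cancel (Q *ʳ ℕ→ℚ k) n ⟩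
      Q *ʳ ℕ→ℚ k                       ∎)
      where
      le : Q *ʳ n ≤ʳ Q *ʳ ℕ→ℚ k +ʳ n
      le = subst₂ _≤ʳ_ (ℕ→ℚ-* q N) (trans (ℕ→ℚ-+ (q * k) N) (cong (_+ʳ n) (ℕ→ℚ-* q k))) (ℕ→ℚ-mono (q * N) (q * k + N) h)
      split : ∀ Q n ε → Q *ʳ ((1ℚ -ʳ ε) *ʳ n) ≡ Q *ʳ n -ʳ ε *ʳ Q *ʳ n
      split = solve 3 (λ Q n ε → Q :* ((con 1ℚ :- ε) :* n) := Q :* n :- ε :* Q :* n) refl
        where open +-*-Solver
      cancel : ∀ x n → x +ʳ n -ʳ n ≡ x
      cancel = solve 2 (λ x n → x :+ n :- n := x) refl
        where open +-*-Solver
    small : ∀ m → q * m ≤ q * s + N → ℕ→ℚ m ≤ʳ ℕ→ℚ s +ʳ ε *ʳ n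
    small m m≤ = ℚP.*-cancelˡ-≤-pos Q {{ℕ→ℚ-pos 1≤q}} (begin
      Q *ʳ ℕ→ℚ m                       ≡⟨ sym (ℕ→ℚ-* q m) ⟩
      ℕ→ℚ (q * m)                      ≤⟨ ℕ→ℚ-mono (q * m) (q * s + N) m≤ ⟩
      ℕ→ℚ (q * s + N)                  ≡⟨ trans (ℕ→ℚ-+ (q * s) N) (cong (_+ʳ n) (ℕ→ℚ-* q s)) ⟩
      Q *ʳ ℕ→ℚ s +ʳ n                  ≤⟨ ℚP.+-monoʳ-≤ (Q *ʳ ℕ→ℚ s) n≤ ⟩
      Q *ʳ ℕ→ℚ s +ʳ ε *ʳ Q *ʳ n        ≡⟨ collect Q (ℕ→ℚ s) ε n ⟩
      Q *ʳ (ℕ→ℚ s +ʳ ε *ʳ n)           ∎)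
      where
      collect : ∀ Q s ε n → Q *ʳ s +ʳ ε *ʳ Q *ʳ n ≡ Q *ʳ (s +ʳ ε *ʳ n)
      collect = solve 4 (λ Q s ε n → Q :* s :+ ε :* Q :* n := Q :* (s :+ ε :* n)) refl
        where open +-*-Solver
    finish : Conclusion _≈_ _∙_ a b s q → ∃₂ λ (A′ B′ : Subset N) →
      ((1ℚ -ʳ ε) *ʳ ℕ→ℚ N ≤ʳ ℕ→ℚ ∣ A′ ∣) × ((1ℚ -ʳ ε) *ʳ ℕ→ℚ N ≤ʳ ℕ→ℚ ∣ B′ ∣) ×
      (∃ λ m → (ℕ→ℚ m ≤ʳ ℕ→ℚ s +ʳ ε *ʳ ℕ→ℚ N) × CardAtMost _≈_ _∙_ (Sumset _≈_ _∙_ a b A′ B′) m)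
    finish (A′ , B′ , sizeA , sizeB , m , m≤ , cover) = A′ , B′ , large (∣ A′ ∣) sizeA , large (∣ B′ ∣) sizeB , m , small m m≤ , cover

  1≤ε*denominator : ∀ ε → 0ℚ <ʳ ε → 1ℚ ≤ʳ ε *ʳ ℕ→ℚ (↧ₙ ε)
  1≤ε*denominator ε@(mkℚ (ℤ.+ zero) b _)   (*<* (ℤ.+<+ ()))
  1≤ε*denominator ε@(mkℚ ℤ.+[1+ a ] b _)   _ = subst (λ w → 1ℚ ≤ʳ ε *ʳ w) (sym (ℕ→ℚ≡fromℕ (suc b)))
    (ℚP.toℚᵘ-cancel-≤ (ℚᵘP.≤-respʳ-≃ (ℚᵘP.≃-sym (ℚP.toℚᵘ-homo-* ε (fromℕ (suc b)))) (ℚᵘ.*≤* (ℤ.+≤+ bound))))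
    where
    bound : 1 * (suc b * 1) ≤ suc a * suc b * 1
    bound = ≤-trans (≤-reflexive (sym (*-assoc 1 (suc b) 1))) (*-monoˡ-≤ 1 {1 * suc b} {suc a * suc b} (*-monoˡ-≤ (suc b) {1} {suc a} (s≤s z≤n)))
  1≤ε*denominator ε@(mkℚ ℤ.-[1+ a ] b _)   (*<* ())

  K≤numerator : ∀ K → K ≤ʳ ℕ→ℚ ℤ.∣ ↥ K ∣
  K≤numerator K@(mkℚ (ℤ.+ c) d _)     = subst (K ≤ʳ_) (sym (ℕ→ℚ≡fromℕ c)) (*≤* (ℤP.*-monoˡ-≤-nonNeg (ℤ.+ c) (ℤ.+≤+ {1} {suc d} (s≤s z≤n))))
  K≤numerator K@(mkℚ ℤ.-[1+ c ] d _)  = subst (K ≤ʳ_) (sym (ℕ→ℚ≡fromℕ (suc c))) (*≤* ℤ.-≤+)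

  threshold-crossing : {P : ℕ → Set} → (∀ n → Dec (P n)) → ∀ M → P M → ¬ P 0 → ∃ λ n → P (suc n) × ¬ P n
  threshold-crossing P? zero    pM ¬p0 = ⊥-elim (¬p0 pM)
  threshold-crossing P? (suc M) pM ¬p0 with P? M
  ... | yes p = threshold-crossing P? M p ¬p0
  ... | no ¬p = M , pM , ¬p

  0≤1ʳ : 0ℚ ≤ʳ 1ℚ
  0≤1ʳ = toWitness {a? = 0ℚ ℚP.≤? 1ℚ} _

  ½≤1ʳ : ½ ≤ʳ 1ℚ
  ½≤1ʳ = toWitness {a? = ½ ℚP.≤? 1ℚ} _

  ½<1ʳ : ½ <ʳ 1ℚ
  ½<1ʳ = toWitness {a? = ½ ℚP.<? 1ℚ} _

  <ʳ⇒≱ : ∀ {x y} → x <ʳ y → ¬ y ≤ʳ x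
  <ʳ⇒≱ x<y y≤x = ℚP.<-irrefl refl (ℚP.<-≤-trans x<y y≤x)

  module Scale (K ε : ℚ) (1≤K : 1ℚ ≤ʳ K) (0<ε : 0ℚ <ʳ ε) (ε<½ : ε <ʳ ½) where

    0≤ε : 0ℚ ≤ʳ ε
    0≤ε = ℚP.<⇒≤ 0<ε

    0<1ʳ : 0ℚ <ʳ 1ℚ
    0<1ʳ = ℚP.<-trans 0<ε (ℚP.<-trans ε<½ ½<1ʳ)

    crossing : ∃ λ n → K ≤ʳ ε *ʳ ℕ→ℚ (suc n) × ¬ K ≤ʳ ε *ʳ ℕ→ℚ n
    crossing = threshold-crossing (λ n → K ℚP.≤? ε *ʳ ℕ→ℚ n) (↧ₙ ε * c) reached
      (λ h → <ʳ⇒≱ 0<1ʳ (ℚP.≤-trans 1≤K (ℚP.≤-trans h (ℚP.≤-reflexive (ℚP.*-zeroʳ ε)))))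
      where
      open ℚP.≤-Reasoning
      c : ℕ
      c = ℤ.∣ ↥ K ∣
      reached : K ≤ʳ ε *ʳ ℕ→ℚ (↧ₙ ε * c)
      reached = begin
        K                                ≤⟨ K≤numerator K ⟩
        ℕ→ℚ c                            ≡⟨ sym (ℚP.*-identityˡ (ℕ→ℚ c)) ⟩
        1ℚ *ʳ ℕ→ℚ c                      ≤⟨ ℚP.*-monoʳ-≤-nonNeg (ℕ→ℚ c) {{ℕ→ℚ-nonNeg c}} (1≤ε*denominator ε 0<ε) ⟩
        ε *ʳ ℕ→ℚ (↧ₙ ε) *ʳ ℕ→ℚ c          ≡⟨ trans (ℚP.*-assoc ε (ℕ→ℚ (↧ₙ ε)) (ℕ→ℚ c)) (cong (ε *ʳ_) (sym (ℕ→ℚ-* (↧ₙ ε) c))) ⟩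
        ε *ʳ ℕ→ℚ (↧ₙ ε * c)              ∎

    -- The least natural number that is at least K / ε.
    q : ℕ
    q = suc (proj₁ crossing)

    K≤εq : K ≤ʳ ε *ʳ ℕ→ℚ q
    K≤εq = proj₁ (proj₂ crossing)

    1≤εq : 1ℚ ≤ʳ ε *ʳ ℕ→ℚ q
    1≤εq = ℚP.≤-trans 1≤K K≤εq

    K≤q : K ≤ʳ ℕ→ℚ q
    K≤q = ℚP.≤-trans K≤εq (ℚP.≤-trans (ℚP.*-monoʳ-≤-nonNeg (ℕ→ℚ q) {{ℕ→ℚ-nonNeg q}} (ℚP.≤-trans (ℚP.<⇒≤ ε<½) ½≤1ʳ))
      (ℚP.≤-reflexive (ℚP.*-identityˡ (ℕ→ℚ q))))

    2≤q : 2 ≤ q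
    2≤q = ≮⇒≥ λ q<2 → <ʳ⇒≱ ½<1ʳ (ℚP.≤-trans 1≤εq (ℚP.≤-trans (≤ʳ-scale ε (nonNegative 0≤ε) (ℕ→ℚ-mono q 1 (≤-pred q<2)))
      (ℚP.≤-trans (ℚP.≤-reflexive (ℚP.*-identityʳ ε)) (ℚP.<⇒≤ ε<½))))

    0≤K : 0ℚ ≤ʳ K
    0≤K = ℚP.≤-trans 0≤1ʳ 1≤K

    -- Minimality of q gives ε q ≤ K + ε ≤ 2K, and one more factor ε < ½ removes the 2. Thus (ε/K)²
    -- ≤ 1/q, without a stray constant.
    ε²q≤K² : ε *ʳ ε *ʳ ℕ→ℚ q ≤ʳ K *ʳ K
    ε²q≤K² = begin
      ε *ʳ ε *ʳ ℕ→ℚ q           ≡⟨ ℚP.*-assoc ε ε (ℕ→ℚ q) ⟩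
      ε *ʳ (ε *ʳ ℕ→ℚ q)         ≤⟨ ≤ʳ-scale ε (nonNegative 0≤ε) εq≤2K ⟩
      ε *ʳ (K +ʳ K)             ≤⟨ ℚP.*-monoʳ-≤-nonNeg (K +ʳ K) {{nonNegative (ℚP.+-mono-≤ 0≤K 0≤K)}} (ℚP.<⇒≤ ε<½) ⟩
      ½ *ʳ (K +ʳ K)             ≡⟨ halve K ⟩
      1ℚ *ʳ K                   ≤⟨ ℚP.*-monoʳ-≤-nonNeg K {{nonNegative 0≤K}} 1≤K ⟩
      K *ʳ K                    ∎
      where
      open ℚP.≤-Reasoning
      halve : ∀ K → ½ *ʳ (K +ʳ K) ≡ 1ℚ *ʳ K
      halve = solve 1 (λ K → con ½ :* (K :+ K) := con 1ℚ :* K) refl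
        where open +-*-Solver
      n : ℕ
      n = proj₁ crossing
      εq≤2K : ε *ʳ ℕ→ℚ q ≤ʳ K +ʳ K
      εq≤2K = begin
        ε *ʳ ℕ→ℚ q                    ≡⟨ cong (ε *ʳ_) (ℕ→ℚ-+ 1 n) ⟩
        ε *ʳ (1ℚ +ʳ ℕ→ℚ n)            ≡⟨ expand ε (ℕ→ℚ n) ⟩
        ε +ʳ ε *ʳ ℕ→ℚ n               ≤⟨ ℚP.+-mono-≤ (ℚP.≤-trans (ℚP.<⇒≤ ε<½) (ℚP.≤-trans ½≤1ʳ 1≤K)) (ℚP.<⇒≤ (ℚP.≰⇒> (proj₂ (proj₂ crossing)))) ⟩
        K +ʳ K                        ∎
        where
        expand : ∀ ε n → ε *ʳ (1ℚ +ʳ n) ≡ ε +ʳ ε *ʳ n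
        expand = solve 2 (λ ε n → ε :* (con 1ℚ :+ n) := ε :+ ε :* n) refl
          where open +-*-Solver

  -- Powers of rationals and the choice of δ

  ^ℚ-+ : ∀ x a b → x ^ℚ (a + b) ≡ x ^ℚ a *ʳ x ^ℚ b
  ^ℚ-+ x zero    b = sym (ℚP.*-identityˡ _)
  ^ℚ-+ x (suc a) b = trans (cong (x *ʳ_) (^ℚ-+ x a b)) (sym (ℚP.*-assoc x _ _))

  ^ℚ-* : ∀ x y a → (x *ʳ y) ^ℚ a ≡ x ^ℚ a *ʳ y ^ℚ a
  ^ℚ-* x y zero    = refl
  ^ℚ-* x y (suc a) = trans (cong (x *ʳ y *ʳ_) (^ℚ-* x y a)) (shuffle x y (x ^ℚ a) (y ^ℚ a))
    where
    shuffle : ∀ x y a b → x *ʳ y *ʳ (a *ʳ b) ≡ x *ʳ a *ʳ (y *ʳ b)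
    shuffle = solve 4 (λ x y a b → x :* y :* (a :* b) := x :* a :* (y :* b)) refl
      where open +-*-Solver

  ^ℚ-double : ∀ x a → x ^ℚ (a + a) ≡ (x *ʳ x) ^ℚ a
  ^ℚ-double x a = trans (^ℚ-+ x a a) (sym (^ℚ-* x x a))

  ^ℚ-pos : ∀ {x} → Positive x → ∀ a → Positive (x ^ℚ a)
  ^ℚ-pos x-pos zero        = _
  ^ℚ-pos {x} x-pos (suc a) = ℚP.pos*pos⇒pos x {{x-pos}} (x ^ℚ a) {{^ℚ-pos x-pos a}}

  ^ℚ-mono : ∀ {x y} → 0ℚ ≤ʳ x → x ≤ʳ y → ∀ a → 0ℚ ≤ʳ x ^ℚ a × x ^ℚ a ≤ʳ y ^ℚ a
  ^ℚ-mono {x} {y} 0≤x x≤y zero    = 0≤1ʳ , ℚP.≤-refl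
  ^ℚ-mono {x} {y} 0≤x x≤y (suc a) with ^ℚ-mono 0≤x x≤y a
  ... | 0≤xa , xa≤ya = ℚP.≤-trans (ℚP.≤-reflexive (sym (ℚP.*-zeroʳ x))) (≤ʳ-scale x (nonNegative 0≤x) 0≤xa) ,
    ℚP.≤-trans (≤ʳ-scale x (nonNegative 0≤x) xa≤ya) (ℚP.*-monoʳ-≤-nonNeg (y ^ℚ a) {{nonNegative (ℚP.≤-trans 0≤xa xa≤ya)}} x≤y)

  ℕ→ℚ-^ : ∀ q a → ℕ→ℚ (q ^ a) ≡ ℕ→ℚ q ^ℚ a
  ℕ→ℚ-^ q zero    = refl
  ℕ→ℚ-^ q (suc a) = trans (ℕ→ℚ-* q (q ^ a)) (cong (ℕ→ℚ q *ʳ_) (ℕ→ℚ-^ q a))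

  works-general : ∀ {c ℓ} (K ε : ℚ) → 1ℚ ≤ʳ K → 0ℚ <ʳ ε → ε <ʳ ½ →
    ∃ λ δ → 0ℚ <ʳ δ × ((𝔾 : AbelianGroup c ℓ) → Works (AbelianGroup._≈_ 𝔾) (AbelianGroup._∙_ 𝔾) K ε δ)
  works-general {c} {ℓ} K ε 1≤K 0<ε ε<½ = from (worksNat-general {c} {ℓ} q)
    where
    open Scale K ε 1≤K 0<ε ε<½
    from : (∃ λ D → 1 ≤ D × ((𝔾 : AbelianGroup c ℓ) → WorksNat (AbelianGroup._≈_ 𝔾) (AbelianGroup._∙_ 𝔾) q D)) →
      ∃ λ δ → 0ℚ <ʳ δ × ((𝔾 : AbelianGroup c ℓ) → Works (AbelianGroup._≈_ 𝔾) (AbelianGroup._∙_ 𝔾) K ε δ)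
    from (suc D , _ , works) = δ , *<* (ℤ.+<+ (s≤s z≤n)) , λ 𝔾 →
        works-from-nat (AbelianGroup._≈_ 𝔾) (AbelianGroup._∙_ 𝔾) {K} {ε} {δ} {q} {suc D} K≤q 1≤εq δD≤1 (works 𝔾)
      where
      δ : ℚ
      δ = mkℚ (ℤ.+ 1) D (Coprimality.1-coprimeTo (suc D))
      δD≤1 : δ *ʳ ℕ→ℚ (suc D) ≤ʳ 1ℚ
      δD≤1 = subst (λ w → δ *ʳ w ≤ʳ 1ℚ) (sym (ℕ→ℚ≡fromℕ (suc D)))
        (ℚP.toℚᵘ-cancel-≤ (ℚᵘP.≤-respˡ-≃ (ℚᵘP.≃-sym (ℚP.toℚᵘ-homo-* δ (fromℕ (suc D)))) (ℚᵘ.*≤* (ℤ.+≤+ bound))))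
        where
        bound : 1 * suc D * 1 ≤ 1 * (suc D * 1)
        bound = ≤-reflexive (*-assoc 1 (suc D) 1)

  works-vector : ∀ (p : ℕ) .{{_ : NonZero p}} → Prime p →
    ∃ λ (C : ℕ) → ∀ (K ε δ : ℚ) → 1ℚ ≤ʳ K → 0ℚ <ʳ ε → ε <ʳ ½ → δ *ʳ (K ^ℚ C) ≡ ε ^ℚ C →
    (n : ℕ) → Works {G = Vec (Fin p) n} _≡_ _+ₚ_ K ε δ
  -- The natural-number version allows density loss q^(-C). As (ε/K)² ≤ 1/q, doubling the exponent
  -- brings δ = (ε/K)^(2C) below it.
  works-vector p p-prime = C + C , works
    where
    C : ℕ
    C = 9 + VectorBounds.C₁ p p-prime
    works : ∀ (K ε δ : ℚ) → 1ℚ ≤ʳ K → 0ℚ <ʳ ε → ε <ʳ ½ → δ *ʳ (K ^ℚ (C + C)) ≡ ε ^ℚ (C + C) →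
      (n : ℕ) → Works {G = Vec (Fin p) n} _≡_ _+ₚ_ K ε δ
    works K ε δ 1≤K 0<ε ε<½ δ≡ n = works-from-nat _≡_ _+ₚ_ {K} {ε} {δ} {q} {q ^ C} K≤q 1≤εq δD≤1 (VectorSpace.worksNat-vector p p-prime n q 2≤q)
      where
      open Scale K ε 1≤K 0<ε ε<½
      open ℚP.≤-Reasoning
      KC : ℚ
      KC = K ^ℚ (C + C)
      KC-pos : Positive KC
      KC-pos = ^ℚ-pos {K} (positive (ℚP.<-≤-trans 0<1ʳ 1≤K)) (C + C)
      0≤ε²q : 0ℚ ≤ʳ ε *ʳ ε *ʳ ℕ→ℚ q
      0≤ε²q = ℚP.≤-trans (ℚP.≤-reflexive (sym (ℚP.*-zeroʳ ε))) (ℚP.≤-trans (≤ʳ-scale ε (nonNegative 0≤ε) (ℚP.≤-trans 0≤1ʳ 1≤εq))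
        (ℚP.≤-reflexive (sym (ℚP.*-assoc ε ε (ℕ→ℚ q)))))
      δD≤1 : δ *ʳ ℕ→ℚ (q ^ C) ≤ʳ 1ℚ
      δD≤1 = ℚP.*-cancelˡ-≤-pos KC {{KC-pos}} (begin
        KC *ʳ (δ *ʳ ℕ→ℚ (q ^ C))            ≡⟨ regroup KC δ (ℕ→ℚ (q ^ C)) ⟩
        δ *ʳ KC *ʳ ℕ→ℚ (q ^ C)              ≡⟨ cong₂ _*ʳ_ (trans δ≡ (^ℚ-double ε C)) (ℕ→ℚ-^ q C) ⟩
        (ε *ʳ ε) ^ℚ C *ʳ (ℕ→ℚ q) ^ℚ C        ≡⟨ sym (^ℚ-* (ε *ʳ ε) (ℕ→ℚ q) C) ⟩
        (ε *ʳ ε *ʳ ℕ→ℚ q) ^ℚ C              ≤⟨ proj₂ (^ℚ-mono 0≤ε²q ε²q≤K² C) ⟩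
        (K *ʳ K) ^ℚ C                       ≡⟨ sym (^ℚ-double K C) ⟩
        KC                                  ≡⟨ sym (ℚP.*-identityʳ KC) ⟩
        KC *ʳ 1ℚ                            ∎)
        where
        regroup : ∀ k d q → k *ʳ (d *ʳ q) ≡ d *ʳ k *ʳ q
        regroup = solve 3 (λ k d q → k :* (d :* q) := d :* k :* q) refl
          where open +-*-Solver

open import Defs
open import Data.Nat using (ℕ; NonZero)
open import Data.Fin using (Fin)
open import Data.Vec using (Vec)
open import Data.Product using (∃; _×_; _,_)
open import Data.Nat.Primality using (Prime)
open import Data.Rational using (ℚ; _*_; _≤_; _<_; 0ℚ; 1ℚ; ½)
open import Algebra.Bundles using (AbelianGroup)
open import Relation.Binary.PropositionalEquality using (_≡_)

theorem1p1 : ∀ {c ℓ} →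
    (∀ (K ε : ℚ) → 1ℚ ≤ K → 0ℚ < ε → ε < ½ →
    ∃ λ δ → (0ℚ < δ) ×
    ((G : AbelianGroup c ℓ) →
    Works (AbelianGroup._≈_ G) (AbelianGroup._∙_ G) K ε δ)) ×
    (∀ (p : ℕ) .{{_ : NonZero p}} → Prime p →
    ∃ λ (C : ℕ) → ∀ (K ε δ : ℚ) → 1ℚ ≤ K → 0ℚ < ε → ε < ½ →
    δ * (K ^ℚ C) ≡ ε ^ℚ C →
    (n : ℕ) → Works {G = Vec (Fin p) n} _≡_ _+ₚ_ K ε δ)
theorem1p1 = AlmostAllSums.works-general , AlmostAllSums.works-vector
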